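{- Put $c_{\rm BSG}:=\frac{21}{128}$, $C_{\rm BSG}:=\frac{2^{69}}9$, $C_{\rm BSG,H}:=\frac{2^{33}}9$. There is a randomized algorithm with the following properties. It receives deterministic membership access to a nonempty set $S\subseteq\mathbb F_2^n$, independent exact uniform samples from $S$, and parameters $\alpha,\rho_{\rm snd},\rho_{\rm cmp}\in(0,1)$. It always terminates and returns either $\mathsf{FAIL}$ or a finite record $D$. (Soundness) Every nonfailure record $D$ defines one deterministic set $Y_D\subseteq S$. For an arbitrary input set $S$, without any energy assumption, there is an event of probability at least $1-\rho_{\rm snd}$ on which every nonfailure output satisfies $|Y_D|\ge c_{\rm BSG}\sqrt\alpha|S|$ and $|Y_D+Y_D|\le C_{\rm BSG}\alpha^{ -4}|Y_D|$; that is, $$\Pr\Big[D\ne\mathsf{FAIL}\ \text{and}\ \big(|Y_D|<c_{\rm BSG}\sqrt\alpha\,|S|\ \text{or}\ |Y_D+Y_D|>C_{\rm BSG}\alpha^{ -4}|Y_D|\big)\Big]\le\rho_{\rm snd}.$$ If the output has a high-branch tag, then on the same event it satisfies the stronger estimate $|Y_D+Y_D|\le C_{\rm BSG,H}\alpha^{ -3}|Y_D|$. (Completeness) If, in addition, $E(S)\ge\alpha|S|^3$, then $\Pr[D=\mathsf{FAIL}]\le\rho_{\rm cmp}$. (Persistence and resources) Once $D$ is fixed, membership in $Y_D$ is deterministic, and every later query refers to this same set. If $$\Lambda:=1+n+\log\frac1\alpha+\log\frac1{\rho_{\rm snd}}+\log\frac1{\rho_{\rm cmp}},$$ then producing the output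 uses $O(\alpha^{ -2}\Lambda^4)$ samples from $S$ and $O(\alpha^{ -4}\Lambda^5)$ membership queries to $S$. One membership query to $Y_D$ uses $O(\alpha^{ -4}\Lambda^3)$ membership queries to $S$, and the record length is $O(n\alpha^{ -2}\Lambda)$ bits. All these bounds are worst-case over the random choices of the algorithm.
   Context: For $S,T\subseteq\mathbb F_2^n$, $S+T=\{s+t:s\in S,t\in T\}$; $\log$ is base two. The additive energy is $E(S)=|\{(x_1,x_2,x_3,x_4)\in S^4:x_1+x_2=x_3+x_4\}|$. Implied constants in $O(\cdot)$ are absolute. Membership access means a deterministic oracle $x\mapsto\mathbf 1_S(x)$. A record is a finite bit string storing all the data needed to evaluate, with further membership queries to $S$, a fixed deterministic predicate $x\mapsto\mathbf 1_{Y_D}(x)$. Each nonfailure record carries a tag, either high-branch or low-branch: a high-branch record stores a difference $d\in\mathbb F_2^n$ and its set $Y_D$ is obtained by cleaning the fibre $S\cap(S+d)$; a low-branch record stores a centre $a\in S$ and a set $Q$ of differences (implicitly, through sampled data), and its set $Y_D$ is obtained by cleaning the neighbourhood $\{x\in S:a+x\in Q\}$. -}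

module Defs where

open import Data.Bool.Base using (Bool; true; false; T; not; _xor_; if_then_else_)
import Data.Bool.Properties as Bool
open import Data.Integer.Base using (+_; ∣_∣)
open import Data.List.Base using (List; []; _∷_; _++_; map; foldr; length; filter; filterᵇ; cartesianProduct)
open import Data.List.Relation.Unary.Any using (any?)
open import Data.Nat.Base as ℕ using (ℕ; zero; suc)
open import Data.Product.Base using (∃; ∃-syntax; _×_; _,_)
open import Data.Rational.Base as ℚ using (ℚ; 0ℚ; 1ℚ; ½; ↥_; ↧ₙ_)
open import Data.Sum.Base using (_⊎_)
open import Data.Vec.Base using (Vec; []; _∷_; zipWith)
import Data.Vec.Properties as Vec
open import Relation.Binary.Definitions using (DecidableEquality)
open import Relation.Nullary using (¬_; does)

-- Two-sided (located) Dedekind reals:  L q  is  q < x  and  U q  is  x < q.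
record ℝ : Set₁ where
  field
    L U         : ℚ → Set
    L-inhabited : ∃ L
    U-inhabited : ∃ U
    L-lower     : ∀ {p q} → p ℚ.< q → L q → L p
    U-upper     : ∀ {p q} → p ℚ.< q → U p → U q
    L-open      : ∀ {p} → L p → ∃[ q ] p ℚ.< q × L q
    U-open      : ∀ {q} → U q → ∃[ p ] p ℚ.< q × U p
    disjoint    : ∀ {q} → L q → ¬ U q
    located     : ∀ {p q} → p ℚ.< q → L p ⊎ U q

record OpenUnit : Set₁ where
  field
    real     : ℝ
    positive : ℝ.L real 0ℚ
    below-1  : ℝ.U real 1ℚ
  open ℝ real public

-- The estimates involve only nonnegative reals x, and there each x is given
-- by its upper cut { q ∈ ℚ : x < q }.  All cuts below are open, upward closed
-- and contain only positive rationals, provided their arguments are such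
-- cuts; on these cuts the operations are the usual ones of [0,∞).
UpperCut : Set₁
UpperCut = ℚ → Set

infix  4 _≤_
infixl 6 _+_
infixl 7 _*_
infixr 8 _^_
infix  9 _⁻¹

-- x ≤ y  iff every rational above y is above x.
_≤_ : UpperCut → UpperCut → Set
x ≤ y = ∀ q → y q → x q

-- Used only for r ≥ 0.
fromℚ : ℚ → UpperCut
fromℚ r q = r ℚ.< q

fromℕ : ℕ → UpperCut
fromℕ m = fromℚ (+ m ℚ./ 1)

-- The inclusion of (0,1) into the nonnegative reals.
⌜_⌝ : OpenUnit → UpperCut
⌜ x ⌝ = OpenUnit.U x

_+_ : UpperCut → UpperCut → UpperCut
(x + y) q = ∃[ u ] ∃[ v ] x u × y v × u ℚ.+ v ℚ.≤ q

_*_ : UpperCut → UpperCut → UpperCut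
(x * y) q = ∃[ u ] ∃[ v ] x u × y v × u ℚ.* v ℚ.≤ q

_^_ : UpperCut → ℕ → UpperCut
x ^ zero  = fromℚ 1ℚ
x ^ suc k = x * x ^ k

-- 1/x < q  iff  1/a ≤ q for some rational 0 < a < x.
_⁻¹ : OpenUnit → UpperCut
(x ⁻¹) q = ∃[ a ] 0ℚ ℚ.< a × OpenUnit.L x a × 1ℚ ℚ.≤ a ℚ.* q

-- √x < q  iff  0 < q and x < q².
√ : UpperCut → UpperCut
√ x q = 0ℚ ℚ.< q × x (q ℚ.* q)

-- Base-two logarithm of a real x ≥ 1:  for p, d > 0,
-- log₂ x < p/d  iff  x^d < 2^p.
log₂ : UpperCut → UpperCut
log₂ x q = 0ℚ ℚ.< q × (x ^ ↧ₙ q) (+ (2 ℕ.^ ∣ ↥ q ∣) ℚ./ 1)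

𝔽₂^ : ℕ → Set
𝔽₂^ n = Vec Bool n

infixl 6 _⊞_ _⊕_
infix  4 _≟_ _∈_ _⊆_

_⊞_ : ∀ {n} → 𝔽₂^ n → 𝔽₂^ n → 𝔽₂^ n
_⊞_ = zipWith _xor_

_≟_ : ∀ {n} → DecidableEquality (𝔽₂^ n)
_≟_ = Vec.≡-dec Bool._≟_

points : ∀ n → List (𝔽₂^ n)
points zero    = [] ∷ []
points (suc n) = map (false ∷_) (points n) ++ map (true ∷_) (points n)

-- A subset is its indicator function, which is also the membership oracle.
Subset : ℕ → Set
Subset n = 𝔽₂^ n → Bool

_∈_ : ∀ {n} → 𝔽₂^ n → Subset n → Set
x ∈ S = T (S x)

_⊆_ : ∀ {n} → Subset n → Subset n → Set
A ⊆ B = ∀ x → x ∈ A → x ∈ B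

Nonempty : ∀ {n} → Subset n → Set
Nonempty S = ∃[ x ] x ∈ S

elements : ∀ {n} → Subset n → List (𝔽₂^ n)
elements {n} S = filterᵇ S (points n)

card : ∀ {n} → Subset n → ℕ
card S = length (elements S)

_⊕_ : ∀ {n} → Subset n → Subset n → Subset n
(A ⊕ B) x = does (any? (λ s → any? (λ t → (s ⊞ t) ≟ x) (elements B)) (elements A))

energy : ∀ {n} → Subset n → ℕ
energy S = length (filter (λ ((x₁ , x₂) , (x₃ , x₄)) → (x₁ ⊞ x₂) ≟ (x₃ ⊞ x₄)) (cartesianProduct pairs pairs))
  where pairs = cartesianProduct (elements S) (elements S)

-- Deterministic computations with membership queries to a subset of 𝔽₂ⁿ.
data Query (n : ℕ) (A : Set) : Set where
  answer : A → Query n A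
  ask    : 𝔽₂^ n → (Bool → Query n A) → Query n A

-- The result, and the number of queries, when the oracle is S.
⟦_⟧ : ∀ {n A} → Query n A → Subset n → A
⟦ answer a ⟧ S = a
⟦ ask x k  ⟧ S = ⟦ k (S x) ⟧ S

#queries : ∀ {n A} → Query n A → Subset n → ℕ
#queries (answer a) S = 0
#queries (ask x k)  S = suc (#queries (k (S x)) S)

-- Randomized computations: membership queries, independent uniform samples
-- from the input set, and independent fair coin flips.  The trees are well
-- founded, so every run terminates.
data Randomized (n : ℕ) (A : Set) : Set where
  return : A → Randomized n A
  ask    : 𝔽₂^ n → (Bool → Randomized n A) → Randomized n A
  draw   : (𝔽₂^ n → Randomized n A) → Randomized n A
  flip   : (Bool → Randomized n A) → Randomized n A

mean : List ℚ → ℚ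
mean []          = 0ℚ
mean ps@(_ ∷ qs) = foldr ℚ._+_ 0ℚ ps ℚ.* (+ 1 ℚ./ suc (length qs))

-- Pr S t E  is the probability that the output of t on input set S lies in E.
Pr : ∀ {n A} → Subset n → Randomized n A → (A → Bool) → ℚ
Pr S (return a) E = if E a then 1ℚ else 0ℚ
Pr S (ask x k)  E = Pr S (k (S x)) E
Pr S (draw k)   E = mean (map (λ x → Pr S (k x) E) (elements S))
Pr S (flip k)   E = ½ ℚ.* (Pr S (k false) E ℚ.+ Pr S (k true) E)

-- S ⊢ t ⇓ a ⟨ s , q ⟩ : some possible run of t on input set S outputs a after
-- drawing s samples and making q membership queries.
data _⊢_⇓_⟨_,_⟩ {n A} (S : Subset n) : Randomized n A → A → ℕ → ℕ → Set where
  return : ∀ {a} → S ⊢ return a ⇓ a ⟨ 0 , 0 ⟩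
  ask    : ∀ {x k a s q} → S ⊢ k (S x) ⇓ a ⟨ s , q ⟩ → S ⊢ ask x k ⇓ a ⟨ s , suc q ⟩
  draw   : ∀ {k a s q} x → x ∈ S → S ⊢ k x ⇓ a ⟨ s , q ⟩ → S ⊢ draw k ⇓ a ⟨ suc s , q ⟩
  flip   : ∀ {k a s q} b → S ⊢ k b ⇓ a ⟨ s , q ⟩ → S ⊢ flip k ⇓ a ⟨ s , q ⟩

Record : Set
Record = List Bool

data Output : Set where
  FAIL : Output
  rec  : Record → Output

isFAIL : Output → Bool
isFAIL FAIL    = true
isFAIL (rec _) = false

-- The arguments are n, α, ρ_snd and ρ_cmp.
Algorithm : Set₁
Algorithm = ∀ n → OpenUnit → OpenUnit → OpenUnit → Randomized n Output

-- The tag of a record with the data belonging to it.  The set of differences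
-- of a low-branch record is implicit: membership in it is computed from the
-- record with the help of membership queries to S.
data Branch (n : ℕ) : Set where
  high : (d : 𝔽₂^ n) → Branch n
  low  : (a : 𝔽₂^ n) (Q : 𝔽₂^ n → Query n Bool) → Branch n

-- How records are read.  Since neither the parameters nor the random choices
-- of the algorithm are available here, the record must hold everything that
-- evaluating the membership predicate of its set requires.
record Reader : Set where
  field
    branch : ∀ {n} → Record → Branch n
    member : ∀ {n} → Record → 𝔽₂^ n → Query n Bool

  -- The set Y_D defined by the record D when the input set is S.
  Y : ∀ {n} → Subset n → Record → Subset n
  Y S D x = ⟦ member D x ⟧ S

data IsHigh {n} : Branch n → Set where
  high : ∀ {d} → IsHigh (high d)

-- Cleaning a set means discarding some of its points, so Y comes from
-- S ∩ (S + d), respectively from { x ∈ S : a + x ∈ Q } with a ∈ S.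
CleanedFrom : ∀ {n} → Subset n → Branch n → Subset n → Set
CleanedFrom S (high d)  Y = ∀ x → x ∈ Y → x ∈ S × x ⊞ d ∈ S
CleanedFrom S (low a Q) Y = a ∈ S × (∀ x → x ∈ Y → x ∈ S × T (⟦ Q (a ⊞ x) ⟧ S))

c-BSG C-BSG C-BSG-H : UpperCut
c-BSG   = fromℚ (+ 21 ℚ./ 128)
C-BSG   = fromℚ (+ (2 ℕ.^ 69) ℚ./ 9)
C-BSG-H = fromℚ (+ (2 ℕ.^ 33) ℚ./ 9)

Λ : ℕ → OpenUnit → OpenUnit → OpenUnit → UpperCut
Λ n α ρₛ ρ꜀ = fromℕ (1 ℕ.+ n) + log₂ (α ⁻¹) + log₂ (ρₛ ⁻¹) + log₂ (ρ꜀ ⁻¹)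

module Submission where

-- Let r(d) be the number of pairs in S² with sum d.  Four independent samples
-- of Θ(α⁻¹ Λ) pairs are used in turn: the first one estimates r, which defines
-- for every threshold j a set Q of popular differences; the second one
-- estimates how many l ∈ S have x + l, y + l ∈ Q; the third one estimates the
-- sizes of a candidate B, which is a fibre S ∩ (S + d) or a neighbourhood
-- { x ∈ S : a + x ∈ Q }, and of the sets of bad partners y ∈ B of each x, so
-- that points with many bad partners can be discarded; the fourth one supplies
-- candidates and estimates the sizes of the cleaned sets Y.  Each sample is
-- tested against exponentially many sets determined by the preceding ones.
--
-- Two points of Y have many common good partners y, hence their sum has many
-- representations (x + y) + (y + x′) by elements of a set Z of popular sums.
-- For fibres |Z| = O(|S| / α); for neighbourhoods, with δ the density of pairs
-- with sum in Q and τ = j / m for the sample size m, |Z| = O(|S| / τ²) because |Q| = O(δ |S| / τ).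
--
-- If no threshold τ of order at most √α satisfies δ ≥ c max(√α, α² / τ²), then
-- integrating δ over τ shows that differences with r(d) ≥ c √α |S| carry a
-- positive proportion of the energy, and the fibre of some such difference has
-- few bad pairs by double counting.  For a threshold that does satisfy the
-- inequality, the second moment of the degrees yields a centre a whose
-- neighbourhood has at least 7/8 of the mean size and few bad pairs.

-- Inequalities about a real `α` cannot be decided, so the algorithm works with `B = 2 ^ i`, found
-- by locating `α`, such that `15 / (16 B²) < α < 4 / B²`. Thus `B` stands for `1 / √α`, and the
-- combinatorics becomes arithmetic of natural numbers. The stated constants are the integer ones
-- after this exchange: `21/128` is half of `21/64`, `2 ^ 69` is `4 ^ 4 · 2 ^ 61` and `2 ^ 33` is
-- `4 ^ 3 · 2 ^ 27`. A sampled count is trusted up to a factor `9/8` and an additive `k`. Failure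
-- probabilities are then powers of `8/9`, so the tail bounds avoid real exponentials. The choice
-- `k = 400 κ`, with `κ ≤ 4 Λ`, makes the union bound over all tested sets affordable. Once every
-- estimate is fair, the rest is deterministic: soundness uses fairness alone, and the energy enters
-- only through completeness. All membership queries are made on a list fixed by the samples, so
-- their number, cubic in the sample size, is the same on every run.

module Prelude where

  open import Data.Bool.Base public using (Bool; true; false; T; _∧_; _∨_; not; _xor_; if_then_else_)
  open import Data.Empty public using (⊥-elim)
  open import Data.List.Base public using (List; []; _∷_; _++_; map; length; foldr; filter; filterᵇ; cartesianProduct; concatMap; upTo)
  open import Data.List.Membership.Propositional public using (find; lose) renaming (_∈_ to _∈ˡ_)
  open import Data.List.Membership.Propositional.Properties public using (∈-map⁺; ∈-map⁻; ∈-++⁺ˡ; ∈-++⁺ʳ; ∈-++⁻; ∈-concatMap⁺; ∈-concatMap⁻; ∈-upTo⁺; ∈-upTo⁻; ∈-filter⁺; ∈-filter⁻)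
  open import Data.List.Properties public using (length-map; length-++; length-upTo)
  open import Data.List.Relation.Unary.All public using (All; []; _∷_)
  open import Data.List.Relation.Unary.Any public using (any?; here; there)
  open import Data.Nat.Base public
  open import Data.Nat.Properties public hiding (_≟_)
  open import Data.Product.Base public using (Σ-syntax; ∃-syntax; _×_; _,_; proj₁; proj₂; map₁)
  open import Data.Sum.Base public using (_⊎_; inj₁; inj₂)
  open import Data.Unit.Base public using (⊤; tt)
  open import Data.Vec.Base public using ([]; _∷_)
  open import Function.Base public using (_∘_)
  open import Relation.Binary.PropositionalEquality public hiding (J)
  open import Relation.Nullary public using (¬_; Dec; does; yes; no)

-- Polynomial inequalities over the natural numbers by reflection

module Certificates where

  open Prelude
  open import Data.Nat.Tactic.RingSolver using (solve-∀)
  open import Algebra.Properties.CommutativeSemigroup *-commutativeSemigroup using () renaming (interchange to *-interchange)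

  infixl 6 _:+_
  infixl 7 _:*_
  infixr 8 _:^_

  data Expr : Set where
    var       : ℕ → Expr
    con       : ℕ → Expr
    _:+_ _:*_ : Expr → Expr → Expr
    _:^_      : Expr → ℕ → Expr

  -- Variables beyond the end of an environment are 0.
  Env : Set
  Env = List ℕ

  hd : Env → ℕ
  hd []      = 0
  hd (x ∷ _) = x

  tl : Env → Env
  tl []      = []
  tl (_ ∷ ρ) = ρ

  _!_ : Env → ℕ → ℕ
  ρ ! zero  = hd ρ
  ρ ! suc i = tl ρ ! i

  ⟦_⟧ : Expr → Env → ℕ
  ⟦ var i ⟧ ρ  = ρ ! i
  ⟦ con c ⟧ ρ  = c
  ⟦ a :+ b ⟧ ρ = ⟦ a ⟧ ρ + ⟦ b ⟧ ρ
  ⟦ a :* b ⟧ ρ = ⟦ a ⟧ ρ * ⟦ b ⟧ ρ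
  ⟦ a :^ k ⟧ ρ = ⟦ a ⟧ ρ ^ k

  private
    Monomial : Set
    Monomial = List ℕ

    Poly : Set
    Poly = List (ℕ × Monomial)

    ⟦_⟧ₘ : Monomial → Env → ℕ
    ⟦ [] ⟧ₘ    ρ = 1
    ⟦ e ∷ M ⟧ₘ ρ = hd ρ ^ e * ⟦ M ⟧ₘ (tl ρ)

    ⟦_⟧ₚ : Poly → Env → ℕ
    ⟦ [] ⟧ₚ          ρ = 0
    ⟦ (c , M) ∷ p ⟧ₚ ρ = c * ⟦ M ⟧ₘ ρ + ⟦ p ⟧ₚ ρ

    data Ord : Set where
      lt eq gt : Ord

    -- The third argument is the verdict on the later exponents and decides only ties, which makes
    -- `cmp` lexicographic.
    cmpℕ : ℕ → ℕ → Ord → Ord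
    cmpℕ a b o with a <ᵇ b | b <ᵇ a
    ... | true  | _     = lt
    ... | false | true  = gt
    ... | false | false = o

    cmp : Monomial → Monomial → Ord
    cmp []      []      = eq
    cmp []      (_ ∷ _) = lt
    cmp (_ ∷ _) []      = gt
    cmp (a ∷ M) (b ∷ K) = cmpℕ a b (cmp M K)

    ≮ᵇ⇒≥ : ∀ a b → (a <ᵇ b) ≡ false → b ≤ a
    ≮ᵇ⇒≥ a b e = ≮⇒≥ λ a<b → subst T e (<⇒<ᵇ a<b)

    cmpℕ-eq : ∀ a b o → cmpℕ a b o ≡ eq → a ≡ b × o ≡ eq
    cmpℕ-eq a b o h with a <ᵇ b in p | b <ᵇ a in q
    ... | false | false = ≤-antisym (≮ᵇ⇒≥ b a q) (≮ᵇ⇒≥ a b p) , h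

    cmp-eq : ∀ M K → cmp M K ≡ eq → M ≡ K
    cmp-eq []      []      h = refl
    cmp-eq (a ∷ M) (b ∷ K) h =
      let a≡b , h′ = cmpℕ-eq a b (cmp M K) h in cong₂ _∷_ a≡b (cmp-eq M K h′)

    insert : ℕ → Monomial → Poly → Poly
    insert c M []            = (c , M) ∷ []
    insert c M ((d , K) ∷ p) with cmp M K
    ... | lt = (c , M) ∷ (d , K) ∷ p
    ... | eq = (c + d , K) ∷ p
    ... | gt = (d , K) ∷ insert c M p

    insert-sound : ∀ c M p ρ → ⟦ insert c M p ⟧ₚ ρ ≡ c * ⟦ M ⟧ₘ ρ + ⟦ p ⟧ₚ ρ
    insert-sound c M []            ρ = refl
    insert-sound c M ((d , K) ∷ p) ρ with cmp M K in h
    ... | lt = refl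
    ... | eq rewrite cmp-eq M K h =
      trans (cong (_+ ⟦ p ⟧ₚ ρ) (*-distribʳ-+ (⟦ K ⟧ₘ ρ) c d)) (+-assoc (c * ⟦ K ⟧ₘ ρ) _ _)
    ... | gt rewrite insert-sound c M p ρ = swap (d * ⟦ K ⟧ₘ ρ) (c * ⟦ M ⟧ₘ ρ) (⟦ p ⟧ₚ ρ)
      where
      swap : ∀ x y z → x + (y + z) ≡ y + (x + z)
      swap = solve-∀

    _+ₚ_ : Poly → Poly → Poly
    []            +ₚ q = q
    ((c , M) ∷ p) +ₚ q = insert c M (p +ₚ q)

    +ₚ-sound : ∀ p q ρ → ⟦ p +ₚ q ⟧ₚ ρ ≡ ⟦ p ⟧ₚ ρ + ⟦ q ⟧ₚ ρ
    +ₚ-sound []            q ρ = refl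
    +ₚ-sound ((c , M) ∷ p) q ρ =
      trans (insert-sound c M (p +ₚ q) ρ)
        (trans (cong (c * ⟦ M ⟧ₘ ρ +_) (+ₚ-sound p q ρ)) (sym (+-assoc (c * ⟦ M ⟧ₘ ρ) _ _)))

    _*ₘ_ : Monomial → Monomial → Monomial
    []      *ₘ K       = K
    (a ∷ M) *ₘ []      = a ∷ M
    (a ∷ M) *ₘ (b ∷ K) = a + b ∷ M *ₘ K

    *ₘ-sound : ∀ M K ρ → ⟦ M *ₘ K ⟧ₘ ρ ≡ ⟦ M ⟧ₘ ρ * ⟦ K ⟧ₘ ρ
    *ₘ-sound []      K       ρ = sym (+-identityʳ _)
    *ₘ-sound (a ∷ M) []      ρ = sym (*-identityʳ _)
    *ₘ-sound (a ∷ M) (b ∷ K) ρ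
      rewrite *ₘ-sound M K (tl ρ) | ^-distribˡ-+-* (hd ρ) a b =
      *-interchange (hd ρ ^ a) (hd ρ ^ b) (⟦ M ⟧ₘ (tl ρ)) (⟦ K ⟧ₘ (tl ρ))

    scale : ℕ → Monomial → Poly → Poly
    scale c M []            = []
    scale c M ((d , K) ∷ p) = insert (c * d) (M *ₘ K) (scale c M p)

    scale-sound : ∀ c M p ρ → ⟦ scale c M p ⟧ₚ ρ ≡ c * ⟦ M ⟧ₘ ρ * ⟦ p ⟧ₚ ρ
    scale-sound c M []            ρ = sym (*-zeroʳ (c * ⟦ M ⟧ₘ ρ))
    scale-sound c M ((d , K) ∷ p) ρ
      rewrite insert-sound (c * d) (M *ₘ K) (scale c M p) ρ | *ₘ-sound M K ρ | scale-sound c M p ρ =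
      lemma c d (⟦ M ⟧ₘ ρ) (⟦ K ⟧ₘ ρ) (⟦ p ⟧ₚ ρ)
      where
      lemma : ∀ c d x y z → c * d * (x * y) + c * x * z ≡ c * x * (d * y + z)
      lemma = solve-∀

    _*ₚ_ : Poly → Poly → Poly
    []            *ₚ q = []
    ((c , M) ∷ p) *ₚ q = scale c M q +ₚ (p *ₚ q)

    *ₚ-sound : ∀ p q ρ → ⟦ p *ₚ q ⟧ₚ ρ ≡ ⟦ p ⟧ₚ ρ * ⟦ q ⟧ₚ ρ
    *ₚ-sound []            q ρ = refl
    *ₚ-sound ((c , M) ∷ p) q ρ
      rewrite +ₚ-sound (scale c M q) (p *ₚ q) ρ | scale-sound c M q ρ | *ₚ-sound p q ρ =
      sym (*-distribʳ-+ (⟦ q ⟧ₚ ρ) (c * ⟦ M ⟧ₘ ρ) (⟦ p ⟧ₚ ρ))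

    one : Poly
    one = (1 , []) ∷ []

    _^ₚ_ : Poly → ℕ → Poly
    p ^ₚ zero  = one
    p ^ₚ suc k = p *ₚ (p ^ₚ k)

    ^ₚ-sound : ∀ p k ρ → ⟦ p ^ₚ k ⟧ₚ ρ ≡ ⟦ p ⟧ₚ ρ ^ k
    ^ₚ-sound p zero    ρ = refl
    ^ₚ-sound p (suc k) ρ = trans (*ₚ-sound p (p ^ₚ k) ρ) (cong (⟦ p ⟧ₚ ρ *_) (^ₚ-sound p k ρ))

    varₘ : ℕ → Monomial
    varₘ zero    = 1 ∷ []
    varₘ (suc i) = 0 ∷ varₘ i

    varₘ-sound : ∀ i ρ → ⟦ varₘ i ⟧ₘ ρ ≡ ρ ! i
    varₘ-sound zero    ρ = trans (*-identityʳ (hd ρ * 1)) (*-identityʳ (hd ρ))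
    varₘ-sound (suc i) ρ = trans (*-identityˡ (⟦ varₘ i ⟧ₘ (tl ρ))) (varₘ-sound i (tl ρ))

    normal : Expr → Poly
    normal (var i)  = (1 , varₘ i) ∷ []
    normal (con 0)  = []
    normal (con c)  = (c , []) ∷ []
    normal (a :+ b) = normal a +ₚ normal b
    normal (a :* b) = normal a *ₚ normal b
    normal (a :^ k) = normal a ^ₚ k

    normal-sound : ∀ a ρ → ⟦ normal a ⟧ₚ ρ ≡ ⟦ a ⟧ ρ
    normal-sound (var i)  ρ = trans (+-identityʳ _) (trans (*-identityˡ _) (varₘ-sound i ρ))
    normal-sound (con zero)    ρ = refl
    normal-sound (con (suc c)) ρ = trans (+-identityʳ _) (*-identityʳ (suc c))
    normal-sound (a :+ b) ρ =
      trans (+ₚ-sound (normal a) (normal b) ρ) (cong₂ _+_ (normal-sound a ρ) (normal-sound b ρ))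
    normal-sound (a :* b) ρ =
      trans (*ₚ-sound (normal a) (normal b) ρ) (cong₂ _*_ (normal-sound a ρ) (normal-sound b ρ))
    normal-sound (a :^ k) ρ =
      trans (^ₚ-sound (normal a) k ρ) (cong (_^ k) (normal-sound a ρ))

    -- Both lists are sorted when they come from `normal`, so one pass finds every match. A skipped
    -- term of the right-hand side is nonnegative and only enlarges it.
    dominated : Poly → Poly → Bool
    dominated []            q             = true
    dominated ((c , M) ∷ p) []            = false
    dominated ((c , M) ∷ p) ((d , K) ∷ q) with cmp M K
    ... | eq = (c ≤ᵇ d) ∧ dominated p q
    ... | _  = dominated ((c , M) ∷ p) q

    ∧-T : ∀ {a b} → T (a ∧ b) → T a × T b
    ∧-T {true} {true} _ = tt , tt

    dominated-sound : ∀ p q ρ → T (dominated p q) → ⟦ p ⟧ₚ ρ ≤ ⟦ q ⟧ₚ ρ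
    dominated-sound []            q             ρ h = z≤n
    dominated-sound ((c , M) ∷ p) ((d , K) ∷ q) ρ h with cmp M K in e
    ... | eq rewrite cmp-eq M K e =
      let c≤d , h′ = ∧-T {c ≤ᵇ d} h
      in +-mono-≤ (*-monoˡ-≤ (⟦ K ⟧ₘ ρ) (≤ᵇ⇒≤ c d c≤d)) (dominated-sound p q ρ h′)
    ... | lt = ≤-trans (dominated-sound ((c , M) ∷ p) q ρ h) (m≤n+m _ _)
    ... | gt = ≤-trans (dominated-sound ((c , M) ∷ p) q ρ h) (m≤n+m _ _)

  -- a ≤ b because b − a has nonnegative coefficients.
  poly-≤ : ∀ ρ a b → T (dominated (normal a) (normal b)) → ⟦ a ⟧ ρ ≤ ⟦ b ⟧ ρ
  poly-≤ ρ a b h =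
    subst₂ _≤_ (normal-sound a ρ) (normal-sound b ρ) (dominated-sound (normal a) (normal b) ρ h)

  infix 4 _:≤_∶_

  record Hyp (ρ : Env) : Set where
    constructor _:≤_∶_
    field
      l r   : Expr
      proof : ⟦ l ⟧ ρ ≤ ⟦ r ⟧ ρ

  infix 3 _×ʰ_

  _×ʰ_ : ∀ {ρ} → Expr → Hyp ρ → Hyp ρ
  _×ʰ_ {ρ} c (l :≤ r ∶ h) = c :* l :≤ c :* r ∶ *-monoʳ-≤ (⟦ c ⟧ ρ) h

  sumˡ sumʳ : ∀ {ρ} → List (Hyp ρ) → Expr
  sumˡ = foldr (λ h e → Hyp.l h :+ e) (con 0)
  sumʳ = foldr (λ h e → Hyp.r h :+ e) (con 0)

  -- Positivstellensatz certificate: b − a = Σ (rᵢ − lᵢ) + (a polynomial with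
  -- nonnegative coefficients).
  certify : ∀ ρ a b (hs : List (Hyp ρ)) →
            T (dominated (normal (a :+ sumʳ hs)) (normal (b :+ sumˡ hs))) → ⟦ a ⟧ ρ ≤ ⟦ b ⟧ ρ
  certify ρ a b hs h =
    +-cancelʳ-≤ (⟦ sumʳ hs ⟧ ρ) _ _
      (≤-trans (poly-≤ ρ (a :+ sumʳ hs) (b :+ sumˡ hs) h) (+-monoʳ-≤ (⟦ b ⟧ ρ) (sum-≤ hs)))
    where
    sum-≤ : ∀ hs → ⟦ sumˡ hs ⟧ ρ ≤ ⟦ sumʳ hs ⟧ ρ
    sum-≤ []                  = z≤n
    sum-≤ ((l :≤ r ∶ h) ∷ hs) = +-mono-≤ h (sum-≤ hs)

  certify-≡ : ∀ ρ a b (hs : List (Hyp ρ)) (hs′ : List (Hyp ρ)) →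
              T (dominated (normal (a :+ sumʳ hs)) (normal (b :+ sumˡ hs))) →
              T (dominated (normal (b :+ sumʳ hs′)) (normal (a :+ sumˡ hs′))) → ⟦ a ⟧ ρ ≡ ⟦ b ⟧ ρ
  certify-≡ ρ a b hs hs′ h h′ = ≤-antisym (certify ρ a b hs h) (certify ρ b a hs′ h′)

  v0 v1 v2 v3 v4 v5 v6 v7 v8 : Expr
  v0 = var 0
  v1 = var 1
  v2 = var 2
  v3 = var 3
  v4 = var 4
  v5 = var 5
  v6 = var 6
  v7 = var 7
  v8 = var 8

-- Finite sums, indicator counts and the group 𝔽₂ⁿ

module Counting where

  open Prelude
  open import Data.Bool.Properties as Bool using (xor-assoc; xor-comm)
  open import Defs using (𝔽₂^; _⊞_; _≟_; points; Subset; elements; card)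
  open import Algebra.Properties.CommutativeSemigroup +-commutativeSemigroup using () renaming (interchange to +-interchange)

  private variable
    A B : Set

  ∑ : List A → (A → ℕ) → ℕ
  ∑ []       f = 0
  ∑ (x ∷ xs) f = f x + ∑ xs f

  𝟙 : Bool → ℕ
  𝟙 true  = 1
  𝟙 false = 0

  infixr 9 #
  # : List A → (A → Bool) → ℕ
  # xs p = ∑ xs (λ x → 𝟙 (p x))

  ∑-cong : ∀ (xs : List A) {f g : A → ℕ} → (∀ x → f x ≡ g x) → ∑ xs f ≡ ∑ xs g
  ∑-cong []       e = refl
  ∑-cong (x ∷ xs) e = cong₂ _+_ (e x) (∑-cong xs e)

  ∑-mono : ∀ (xs : List A) {f g : A → ℕ} → (∀ x → f x ≤ g x) → ∑ xs f ≤ ∑ xs g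
  ∑-mono []       e = z≤n
  ∑-mono (x ∷ xs) e = +-mono-≤ (e x) (∑-mono xs e)

  ∑-mono-∈ : ∀ (xs : List A) {f g : A → ℕ} → (∀ x → x ∈ˡ xs → f x ≤ g x) → ∑ xs f ≤ ∑ xs g
  ∑-mono-∈ []       e = z≤n
  ∑-mono-∈ (x ∷ xs) e = +-mono-≤ (e x (here refl)) (∑-mono-∈ xs (λ y y∈ → e y (there y∈)))

  ∑-cong-∈ : ∀ (xs : List A) {f g : A → ℕ} → (∀ x → x ∈ˡ xs → f x ≡ g x) → ∑ xs f ≡ ∑ xs g
  ∑-cong-∈ xs e = ≤-antisym (∑-mono-∈ xs λ x x∈ → ≤-reflexive (e x x∈)) (∑-mono-∈ xs λ x x∈ → ≤-reflexive (sym (e x x∈)))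

  ∑-+ : ∀ (xs : List A) (f g : A → ℕ) → ∑ xs (λ x → f x + g x) ≡ ∑ xs f + ∑ xs g
  ∑-+ []       f g = refl
  ∑-+ (x ∷ xs) f g = trans (cong (f x + g x +_) (∑-+ xs f g)) (+-interchange (f x) (g x) _ _)

  ∑-*ʳ : ∀ (xs : List A) (f : A → ℕ) c → ∑ xs (λ x → f x * c) ≡ ∑ xs f * c
  ∑-*ʳ []       f c = refl
  ∑-*ʳ (x ∷ xs) f c = trans (cong (f x * c +_) (∑-*ʳ xs f c)) (sym (*-distribʳ-+ c (f x) (∑ xs f)))

  ∑-*ˡ : ∀ (xs : List A) (f : A → ℕ) c → ∑ xs (λ x → c * f x) ≡ c * ∑ xs f
  ∑-*ˡ xs f c = trans (∑-cong xs λ x → *-comm c (f x)) (trans (∑-*ʳ xs f c) (*-comm _ c))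

  ∑-const : ∀ (xs : List A) c → ∑ xs (λ _ → c) ≡ length xs * c
  ∑-const []       c = refl
  ∑-const (x ∷ xs) c = cong (c +_) (∑-const xs c)

  ∑-zero : ∀ (xs : List A) → ∑ xs (λ _ → 0) ≡ 0
  ∑-zero xs = trans (∑-const xs 0) (*-zeroʳ (length xs))

  ∑-swap : ∀ (xs : List A) (ys : List B) (f : A → B → ℕ) →
           ∑ xs (λ x → ∑ ys (f x)) ≡ ∑ ys (λ y → ∑ xs (λ x → f x y))
  ∑-swap []       ys f = sym (∑-zero ys)
  ∑-swap (x ∷ xs) ys f = trans (cong (∑ ys (f x) +_) (∑-swap xs ys f)) (sym (∑-+ ys (f x) _))

  ∑-++ : ∀ (xs ys : List A) (f : A → ℕ) → ∑ (xs ++ ys) f ≡ ∑ xs f + ∑ ys f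
  ∑-++ []       ys f = refl
  ∑-++ (x ∷ xs) ys f = trans (cong (f x +_) (∑-++ xs ys f)) (sym (+-assoc (f x) _ _))

  ∑-map : ∀ (h : A → B) xs (f : B → ℕ) → ∑ (map h xs) f ≡ ∑ xs (f ∘ h)
  ∑-map h []       f = refl
  ∑-map h (x ∷ xs) f = cong (f (h x) +_) (∑-map h xs f)

  ∑-filter : ∀ (p : A → Bool) xs (f : A → ℕ) → ∑ (filterᵇ p xs) f ≡ ∑ xs (λ x → 𝟙 (p x) * f x)
  ∑-filter p []       f = refl
  ∑-filter p (x ∷ xs) f with p x
  ... | true  = cong₂ _+_ (sym (+-identityʳ (f x))) (∑-filter p xs f)
  ... | false = ∑-filter p xs f

  ∑-cartesianProduct : ∀ (xs : List A) (ys : List B) (f : A × B → ℕ) →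
                       ∑ (cartesianProduct xs ys) f ≡ ∑ xs (λ x → ∑ ys (λ y → f (x , y)))
  ∑-cartesianProduct []       ys f = refl
  ∑-cartesianProduct (x ∷ xs) ys f = trans (∑-++ (map (x ,_) ys) _ f)
    (cong₂ _+_ (∑-map (x ,_) ys f) (∑-cartesianProduct xs ys f))

  length≡∑ : ∀ (xs : List A) → length xs ≡ ∑ xs (λ _ → 1)
  length≡∑ xs = trans (sym (*-identityʳ _)) (sym (∑-const xs 1))

  length-filter : ∀ (p : A → Bool) xs → length (filterᵇ p xs) ≡ # xs p
  length-filter p xs = trans (length≡∑ (filterᵇ p xs))
    (trans (∑-filter p xs _) (∑-cong xs λ x → *-identityʳ (𝟙 (p x))))

  𝟙-∧ : ∀ a b → 𝟙 (a ∧ b) ≡ 𝟙 a * 𝟙 b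
  𝟙-∧ true  b = sym (+-identityʳ (𝟙 b))
  𝟙-∧ false b = refl

  𝟙-≤1 : ∀ b → 𝟙 b ≤ 1
  𝟙-≤1 true  = ≤-refl
  𝟙-≤1 false = z≤n

  𝟙-T : ∀ {b} → T b → 𝟙 b ≡ 1
  𝟙-T {true} _ = refl

  𝟙-mono : ∀ {a b} → (T a → T b) → 𝟙 a ≤ 𝟙 b
  𝟙-mono {false}         h = z≤n
  𝟙-mono {true}  {true}  h = ≤-refl
  𝟙-mono {true}  {false} h = ⊥-elim (h tt)

  𝟙-*-mono : ∀ b {x y} → (T b → x ≤ y) → 𝟙 b * x ≤ 𝟙 b * y
  𝟙-*-mono true  h = *-monoʳ-≤ 1 (h tt)
  𝟙-*-mono false h = z≤n

  #-mono : ∀ (xs : List A) {p q : A → Bool} → (∀ x → T (p x) → T (q x)) → # xs p ≤ # xs q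
  #-mono xs h = ∑-mono xs λ x → 𝟙-mono (h x)

  #-cong : ∀ (xs : List A) {p q : A → Bool} → (∀ x → p x ≡ q x) → # xs p ≡ # xs q
  #-cong xs h = ∑-cong xs λ x → cong 𝟙 (h x)

  #-≤-length : ∀ (xs : List A) p → # xs p ≤ length xs
  #-≤-length xs p = ≤-trans (∑-mono xs λ x → 𝟙-≤1 (p x)) (≤-reflexive (sym (length≡∑ xs)))

  #-exists : ∀ (xs : List A) p → 1 ≤ # xs p → ∃[ x ] x ∈ˡ xs × T (p x)
  #-exists (x ∷ xs) p h with p x in e
  ... | true  = x , here refl , subst T (sym e) tt
  ... | false = let y , y∈ , py = #-exists xs p h in y , there y∈ , py

  ⊞-comm : ∀ {n} (x y : 𝔽₂^ n) → x ⊞ y ≡ y ⊞ x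
  ⊞-comm []       []       = refl
  ⊞-comm (a ∷ x) (b ∷ y) = cong₂ _∷_ (xor-comm a b) (⊞-comm x y)

  ⊞-assoc : ∀ {n} (x y z : 𝔽₂^ n) → x ⊞ y ⊞ z ≡ x ⊞ (y ⊞ z)
  ⊞-assoc []      []      []      = refl
  ⊞-assoc (a ∷ x) (b ∷ y) (c ∷ z) = cong₂ _∷_ (xor-assoc a b c) (⊞-assoc x y z)

  ⊞-cancel : ∀ {n} (x y : 𝔽₂^ n) → x ⊞ (x ⊞ y) ≡ y
  ⊞-cancel []      []      = refl
  ⊞-cancel (a ∷ x) (b ∷ y) = cong₂ _∷_ (lemma a b) (⊞-cancel x y)
    where
    lemma : ∀ a b → a xor (a xor b) ≡ b
    lemma false b = refl
    lemma true  b = Bool.not-involutive b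

  ⊞-triangle : ∀ {n} (x y z : 𝔽₂^ n) → x ⊞ y ⊞ (x ⊞ z) ≡ y ⊞ z
  ⊞-triangle x y z = trans (cong (_⊞ (x ⊞ z)) (⊞-comm x y))
    (trans (⊞-assoc y x (x ⊞ z)) (cong (y ⊞_) (⊞-cancel x z)))

  ∑-points-suc : ∀ n (f : 𝔽₂^ (suc n) → ℕ) →
    ∑ (points (suc n)) f ≡ ∑ (points n) (f ∘ (false ∷_)) + ∑ (points n) (f ∘ (true ∷_))
  ∑-points-suc n f = trans (∑-++ (map (false ∷_) (points n)) _ f)
    (cong₂ _+_ (∑-map (false ∷_) (points n) f) (∑-map (true ∷_) (points n) f))

  ∈-points : ∀ {n} (x : 𝔽₂^ n) → x ∈ˡ points n
  ∈-points []          = here refl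
  ∈-points (false ∷ x) = ∈-++⁺ˡ (∈-map⁺ (false ∷_) (∈-points x))
  ∈-points (true ∷ x)  = ∈-++⁺ʳ (map (false ∷_) (points _)) (∈-map⁺ (true ∷_) (∈-points x))

  length-points : ∀ n → length (points n) ≡ 2 ^ n
  length-points zero    = refl
  length-points (suc n) = trans (length≡∑ (points (suc n))) (trans (∑-points-suc n (λ _ → 1))
    (cong₂ _+_ ih (trans ih (sym (+-identityʳ _)))))
    where ih = trans (sym (length≡∑ (points n))) (length-points n)

  ∑-shift : ∀ {n} (z : 𝔽₂^ n) (f : 𝔽₂^ n → ℕ) → ∑ (points n) (λ x → f (z ⊞ x)) ≡ ∑ (points n) f
  ∑-shift {zero}  []      f = refl
  ∑-shift {suc n} (b ∷ z) f = trans (∑-points-suc n _) (trans (go b) (sym (∑-points-suc n f)))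
    where
    ih : ∀ b → ∑ (points n) (λ x → f (b ∷ z ⊞ x)) ≡ ∑ (points n) (f ∘ (b ∷_))
    ih b = ∑-shift z (f ∘ (b ∷_))
    go : ∀ b → ∑ (points n) (λ x → f ((b xor false) ∷ (z ⊞ x))) + ∑ (points n) (λ x → f ((b xor true) ∷ (z ⊞ x)))
             ≡ ∑ (points n) (f ∘ (false ∷_)) + ∑ (points n) (f ∘ (true ∷_))
    go false = cong₂ _+_ (ih false) (ih true)
    go true  = trans (cong₂ _+_ (ih true) (ih false)) (+-comm (∑ (points n) (f ∘ (true ∷_))) _)

  does-≟-refl : ∀ {n} (x : 𝔽₂^ n) → does (x ≟ x) ≡ true
  does-≟-refl x with x ≟ x
  ... | yes _ = refl
  ... | no ¬p = ⊥-elim (¬p refl)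

  does-≟-≢ : ∀ {n} {x y : 𝔽₂^ n} → x ≢ y → does (x ≟ y) ≡ false
  does-≟-≢ {x = x} {y} x≢y with x ≟ y
  ... | yes p = ⊥-elim (x≢y p)
  ... | no _  = refl

  does-≟-⇔ : ∀ {m n} {a b : 𝔽₂^ m} {c d : 𝔽₂^ n} → (a ≡ b → c ≡ d) → (c ≡ d → a ≡ b) → does (a ≟ b) ≡ does (c ≟ d)
  does-≟-⇔ {a = a} {b} {c} {d} f g with a ≟ b | c ≟ d
  ... | yes _ | yes _ = refl
  ... | yes p | no ¬q = ⊥-elim (¬q (f p))
  ... | no ¬p | yes q = ⊥-elim (¬p (g q))
  ... | no _  | no _  = refl

  ∑-delta : ∀ {n} (z : 𝔽₂^ n) (f : 𝔽₂^ n → ℕ) → ∑ (points n) (λ x → 𝟙 (does (z ≟ x)) * f x) ≡ f z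
  ∑-delta {zero}  []      f = trans (+-identityʳ _) (trans (cong (λ b → 𝟙 b * f []) (does-≟-refl [])) (+-identityʳ (f [])))
  ∑-delta {suc n} (b ∷ z) f = trans (∑-points-suc n _) (go b)
    where
    off : ∀ b c → b ≢ c → ∑ (points n) (λ x → 𝟙 (does (b ∷ z ≟ c ∷ x)) * f (c ∷ x)) ≡ 0
    off b c b≢c = trans (∑-cong (points n) λ x → cong (λ b → 𝟙 b * f (c ∷ x)) (lemma x)) (∑-zero (points n))
      where
      lemma : ∀ x → does (b ∷ z ≟ c ∷ x) ≡ false
      lemma x = does-≟-≢ {x = b ∷ z} {c ∷ x} λ { refl → b≢c refl }
    on : ∀ b → ∑ (points n) (λ x → 𝟙 (does (b ∷ z ≟ b ∷ x)) * f (b ∷ x)) ≡ f (b ∷ z)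
    on b = trans (∑-cong (points n) λ x → cong (λ c → 𝟙 c * f (b ∷ x))
             (does-≟-⇔ {a = b ∷ z} {b ∷ x} {z} {x} (λ { refl → refl }) (cong (b ∷_))))
           (∑-delta z (f ∘ (b ∷_)))
    go : ∀ b → ∑ (points n) (λ x → 𝟙 (does (b ∷ z ≟ false ∷ x)) * f (false ∷ x)) +
               ∑ (points n) (λ x → 𝟙 (does (b ∷ z ≟ true ∷ x)) * f (true ∷ x)) ≡ f (b ∷ z)
    go false = trans (cong₂ _+_ (on false) (off false true λ ())) (+-identityʳ _)
    go true  = cong₂ _+_ (off true false λ ()) (on true)

  module _ {n} (S : Subset n) where

    ∑-elements : ∀ f → ∑ (elements S) f ≡ ∑ (points n) (λ x → 𝟙 (S x) * f x)
    ∑-elements = ∑-filter S (points n)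

    card≡# : card S ≡ # (points n) S
    card≡# = length-filter S (points n)

    #-elements : ∀ p → # (elements S) p ≡ # (points n) (λ x → S x ∧ p x)
    #-elements p = trans (∑-elements _) (∑-cong (points n) λ x → sym (𝟙-∧ (S x) (p x)))

    ∈-elements : ∀ x → x ∈ˡ elements S → T (S x)
    ∈-elements x = go (points n)
      where
      go : ∀ xs → x ∈ˡ filterᵇ S xs → T (S x)
      go (y ∷ xs) x∈ with S y in e
      go (y ∷ xs) (here refl) | true = subst T (sym e) tt
      go (y ∷ xs) (there x∈)  | true = go xs x∈
      go (y ∷ xs) x∈          | false = go xs x∈

    elements-∈ : ∀ x → T (S x) → x ∈ˡ elements S
    elements-∈ x Sx = go (points n) (∈-points x)
      where
      go : ∀ xs → x ∈ˡ xs → x ∈ˡ filterᵇ S xs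
      go (y ∷ xs) (here refl) with S x
      ... | true = here refl
      go (y ∷ xs) (there x∈) with S y
      ... | true  = there (go xs x∈)
      ... | false = go xs x∈

    0<card : ∀ x → T (S x) → 0 < card S
    0<card x Sx = nonempty (elements S) (elements-∈ x Sx)
      where
      nonempty : ∀ xs → x ∈ˡ xs → 0 < length xs
      nonempty (_ ∷ _) _ = z<s

  card-mono : ∀ {n} (X Y : Subset n) → (∀ x → T (X x) → T (Y x)) → card X ≤ card Y
  card-mono X Y h = subst₂ _≤_ (sym (card≡# X)) (sym (card≡# Y)) (#-mono (points _) h)

-- The sequences (1 + 1/v)^v and (1 + 1/v)^(v+1) as integer substitutes for e

module ExponentialBounds where

  open Prelude
  open import Algebra.Properties.CommutativeSemigroup *-commutativeSemigroup using () renaming (interchange to *-interchange)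
  open Certificates

  private variable
    A : Set

  ^-distribʳ-* : ∀ n x y → (x * y) ^ n ≡ x ^ n * y ^ n
  ^-distribʳ-* zero    x y = refl
  ^-distribʳ-* (suc n) x y = trans (cong (x * y *_) (^-distribʳ-* n x y)) (*-interchange x y (x ^ n) (y ^ n))

  -- Mean value bounds for the increment of `x ^ (n + 1)` from `b` to `b + 1`: the derivative is
  -- taken at the left end here and at the right end in `bernoulli-≤`.
  bernoulli-≥ : ∀ b n → b ^ suc n + suc n * b ^ n ≤ suc b ^ suc n
  bernoulli-≥ b zero    = poly-≤ (b ∷ []) (v0 :* con 1 :+ con 1) ((con 1 :+ v0) :* con 1) tt
  bernoulli-≥ b (suc n) =
    certify (b ∷ n ∷ b ^ n ∷ suc b ^ n ∷ []) (v0 :* (v0 :* v2) :+ (con 2 :+ v1) :* (v0 :* v2)) ((con 1 :+ v0) :* ((con 1 :+ v0) :* v3))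
      ((con 1 :+ v0 ×ʰ v0 :* v2 :+ (con 1 :+ v1) :* v2 :≤ (con 1 :+ v0) :* v3 ∶ bernoulli-≥ b n) ∷ []) tt

  bernoulli-≤ : ∀ b n → suc b ^ suc n ≤ b ^ suc n + suc n * suc b ^ n
  bernoulli-≤ b zero    = poly-≤ (b ∷ []) ((con 1 :+ v0) :* con 1) (v0 :* con 1 :+ con 1) tt
  bernoulli-≤ b (suc n) =
    certify (b ∷ n ∷ b ^ n ∷ suc b ^ n ∷ []) ((con 1 :+ v0) :* ((con 1 :+ v0) :* v3)) (v0 :* (v0 :* v2) :+ (con 2 :+ v1) :* ((con 1 :+ v0) :* v3))
      ((v0 ×ʰ (con 1 :+ v0) :* v3 :≤ v0 :* v2 :+ (con 1 :+ v1) :* v3 ∶ bernoulli-≤ b n) ∷ []) tt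

  -- The product of the neighbours of v + 1, one less than (v + 1)².
  private
    b⟨_⟩ : ℕ → ℕ
    b⟨ v ⟩ = v * suc (suc v)

    suc-b : ∀ v → suc b⟨ v ⟩ ≡ suc v * suc v
    suc-b v = cong suc (trans (*-suc v (suc v)) refl)

  -- (1 + 1/v)^v increases and (1 + 1/v)^(v+1) decreases with v.
  ^-increasing : ∀ v → suc v ^ v * suc v ^ suc v * v ≤ v ^ v * suc (suc v) ^ suc v * v
  ^-increasing v = ≤-trans step₁ (≤-reflexive eq)
    where
    s = suc v
    X = s ^ v
    pow : suc b⟨ v ⟩ ^ v ≡ X * X
    pow = trans (cong (_^ v) (suc-b v)) (^-distribʳ-* v s s)
    -- The ratio of consecutive terms of `(1 + 1/v) ^ v` is, up to a simple factor, a power of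
    -- `b⟨ v ⟩ / s²`. Since `s² = b⟨ v ⟩ + 1`, `bernoulli-≤` applies to it.
    h : (s * s) * (X * X) ≤ b⟨ v ⟩ ^ suc v + s * (X * X)
    h = subst₂ (λ a c → a * c ≤ b⟨ v ⟩ ^ suc v + s * c) (suc-b v) pow (bernoulli-≤ b⟨ v ⟩ v)
    step₁ : X * (s * X) * v ≤ b⟨ v ⟩ ^ suc v
    step₁ = certify (v ∷ X ∷ b⟨ v ⟩ ^ suc v ∷ []) (v1 :* ((con 1 :+ v0) :* v1) :* v0) v2
      ((((con 1 :+ v0) :* (con 1 :+ v0)) :* (v1 :* v1) :≤ v2 :+ (con 1 :+ v0) :* (v1 :* v1) ∶ h) ∷ []) tt
    eq : b⟨ v ⟩ ^ suc v ≡ v ^ v * suc s ^ suc v * v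
    eq = trans (^-distribʳ-* (suc v) v (suc s)) (trans (*-assoc v (v ^ v) (suc s ^ suc v)) (*-comm v _))

  ^-decreasing : ∀ v → suc (suc v) ^ suc (suc v) * v ^ suc v ≤ suc v ^ suc v * suc v ^ suc (suc v)
  ^-decreasing v = ≤-trans (≤-reflexive eq₁) (≤-trans step (≤-reflexive eq₂))
    where
    s = suc v
    b = b⟨ v ⟩
    step : suc s * b ^ suc v ≤ s * suc b ^ suc v
    step = certify (v ∷ b ∷ b ^ v ∷ suc b ^ v ∷ [])
      ((con 2 :+ v0) :* (v1 :* v2)) ((con 1 :+ v0) :* ((con 1 :+ v1) :* v3))
      ((con 1 :+ v0 ×ʰ v1 :* v2 :+ (con 1 :+ v0) :* v2 :≤ (con 1 :+ v1) :* v3 ∶ bernoulli-≥ b v) ∷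
       (v2 ×ʰ (con 1 :+ v1) :≤ (con 1 :+ v0) :* (con 1 :+ v0) ∶ ≤-reflexive (suc-b v)) ∷
       (v2 ×ʰ (con 1 :+ v0) :* (con 1 :+ v0) :≤ (con 1 :+ v1) ∶ ≤-reflexive (sym (suc-b v))) ∷
       (v2 ×ʰ v1 :≤ (con 1 :+ v0) :* (con 1 :+ v0) ∶ ≤-trans (n≤1+n b) (≤-reflexive (suc-b v))) ∷ []) tt
    eq₁ : suc s ^ suc s * v ^ suc v ≡ suc s * b ^ suc v
    eq₁ = trans (*-assoc (suc s) (suc s ^ s) (v ^ s))
      (cong (suc s *_) (trans (*-comm (suc s ^ s) (v ^ s)) (sym (^-distribʳ-* s v (suc s)))))
    eq₂ : s * suc b ^ suc v ≡ s ^ suc v * s ^ suc s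
    eq₂ = trans (cong (λ c → s * c ^ suc v) (suc-b v))
      (trans (cong (s *_) (^-distribʳ-* (suc v) s s))
        (trans (sym (*-assoc s (s ^ s) (s ^ s))) (*-comm (s ^ suc s) (s ^ s))))

  module _ {p q : ℕ} where

    -- As `(1 + 1/v) ^ (v + 1)` decreases, an upper bound `q / p` at `v₀` holds from there on. In
    -- the same way `increasing-≤` propagates a lower bound on `(1 + 1/v) ^ v`.
    decreasing-≤ : ∀ v₀ → suc v₀ ^ suc v₀ * p ≤ v₀ ^ suc v₀ * q → NonZero v₀ →
                   ∀ d → suc (d + v₀) ^ suc (d + v₀) * p ≤ (d + v₀) ^ suc (d + v₀) * q
    decreasing-≤ v₀       h nz zero    = h
    decreasing-≤ (suc v₀) h nz (suc d) = *-cancelˡ-≤ Z {{m^n≢0 v (suc v) {{v≢0}}}}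
      (certify (Z ∷ suc (suc v) ^ suc (suc v) ∷ suc v ^ suc v ∷ suc v ^ suc (suc v) ∷ p ∷ q ∷ [])
        (v0 :* (v1 :* v4)) (v0 :* (v3 :* v5))
        ((v4 ×ʰ v1 :* v0 :≤ v2 :* v3 ∶ ^-decreasing v) ∷ (v3 ×ʰ v2 :* v4 :≤ v0 :* v5 ∶ decreasing-≤ (suc v₀) h nz d) ∷ []) tt)
      where
      v = d + suc v₀
      Z = v ^ suc v
      v≢0 : NonZero v
      v≢0 = subst NonZero (sym (+-suc d v₀)) _

    increasing-≤ : ∀ v₀ → v₀ ^ v₀ * q ≤ suc v₀ ^ v₀ * p → NonZero v₀ →
                   ∀ d → (d + v₀) ^ (d + v₀) * q ≤ suc (d + v₀) ^ (d + v₀) * p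
    increasing-≤ v₀       h nz zero    = h
    increasing-≤ (suc v₀) h nz (suc d) = *-cancelˡ-≤ Y {{m*n≢0 (v ^ v) v {{m^n≢0 v v {{v≢0}}}} {{v≢0}}}}
      (certify (v ^ v ∷ v ∷ suc v ^ v ∷ suc v ^ suc v ∷ suc (suc v) ^ suc v ∷ p ∷ q ∷ [])
        (v0 :* v1 :* (v3 :* v6)) (v0 :* v1 :* (v4 :* v5))
        ((v3 :* v1 ×ʰ v0 :* v6 :≤ v2 :* v5 ∶ increasing-≤ (suc v₀) h nz d) ∷
         (v5 ×ʰ v2 :* v3 :* v1 :≤ v0 :* v4 :* v1 ∶ ^-increasing v) ∷ []) tt)
      where
      v = d + suc v₀
      Y = v ^ v * v
      v≢0 : NonZero v
      v≢0 = subst NonZero (sym (+-suc d v₀)) _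

    drop-last : ∀ v → suc v ^ suc v * p ≤ v ^ suc v * q → suc v ^ v * p ≤ v ^ v * q
    drop-last v h = *-cancelˡ-≤ (suc v)
      (certify (v ∷ suc v ^ v ∷ v ^ v ∷ p ∷ q ∷ []) ((con 1 :+ v0) :* (v1 :* v3)) ((con 1 :+ v0) :* (v2 :* v4))
        (((con 1 :+ v0) :* v1 :* v3 :≤ v0 :* v2 :* v4 ∶ h) ∷ []) tt)

    add-last : ∀ v → v ^ v * q ≤ suc v ^ v * p → v ^ suc v * q ≤ suc v ^ suc v * p
    add-last v h = certify (v ∷ suc v ^ v ∷ v ^ v ∷ p ∷ q ∷ []) (v0 :* v2 :* v4) ((con 1 :+ v0) :* v1 :* v3)
        ((v0 ×ʰ v2 :* v4 :≤ v1 :* v3 ∶ h) ∷ []) tt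

  split-≥ : ∀ {a} b → a ≤ b → ∃[ d ] d + a ≡ b
  split-≥ {a} b a≤b = b ∸ a , m∸n+n≡m a≤b

  -- (9/8)⁸ < e < (9/8)⁹.
  e-upper : ∀ v → 1 ≤ v → suc v ^ v * 8 ^ 9 ≤ v ^ v * 9 ^ 9
  e-upper v 1≤v with 8 ≤? v
  ... | yes 8≤v with split-≥ v 8≤v
  -- At `v = 8` the decreasing sequence equals `(9/8) ^ 9`, hence the base case `≤-refl`. For
  -- smaller `v` it is larger than that, and the weaker exponent `v` is checked by computation.
  ... | d , refl = drop-last (d + 8) (decreasing-≤ 8 ≤-refl _ d)
  e-upper 1 1≤v | no _ = ≤ᵇ⇒≤ _ _ tt
  e-upper 2 1≤v | no _ = ≤ᵇ⇒≤ _ _ tt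
  e-upper 3 1≤v | no _ = ≤ᵇ⇒≤ _ _ tt
  e-upper 4 1≤v | no _ = ≤ᵇ⇒≤ _ _ tt
  e-upper 5 1≤v | no _ = ≤ᵇ⇒≤ _ _ tt
  e-upper 6 1≤v | no _ = ≤ᵇ⇒≤ _ _ tt
  e-upper 7 1≤v | no _ = ≤ᵇ⇒≤ _ _ tt
  e-upper (suc (suc (suc (suc (suc (suc (suc (suc v)))))))) 1≤v | no ¬p = ⊥-elim (¬p (m≤m+n 8 v))

  e-lower : ∀ v → 1 ≤ v → v ^ suc v * 9 ^ 8 ≤ suc v ^ suc v * 8 ^ 8
  e-lower v 1≤v with 8 ≤? v
  ... | yes 8≤v with split-≥ v 8≤v
  ... | d , refl = add-last (d + 8) (increasing-≤ 8 ≤-refl _ d)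
  e-lower 1 1≤v | no _ = ≤ᵇ⇒≤ _ _ tt
  e-lower 2 1≤v | no _ = ≤ᵇ⇒≤ _ _ tt
  e-lower 3 1≤v | no _ = ≤ᵇ⇒≤ _ _ tt
  e-lower 4 1≤v | no _ = ≤ᵇ⇒≤ _ _ tt
  e-lower 5 1≤v | no _ = ≤ᵇ⇒≤ _ _ tt
  e-lower 6 1≤v | no _ = ≤ᵇ⇒≤ _ _ tt
  e-lower 7 1≤v | no _ = ≤ᵇ⇒≤ _ _ tt
  e-lower (suc (suc (suc (suc (suc (suc (suc (suc v)))))))) 1≤v | no ¬p = ⊥-elim (¬p (m≤m+n 8 v))

  ^-cancel-≤ : ∀ {x y} n → 1 ≤ n → x ^ n ≤ y ^ n → x ≤ y
  ^-cancel-≤ {x} {y} n@(suc _) _ h with x ≤? y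
  ... | yes x≤y = x≤y
  ... | no  x≰y = ⊥-elim (<⇒≱ (^-monoˡ-< n (≰⇒> x≰y)) h)

  ratio-mono : ∀ {x y a b} → x ≤ y → a ≤ b → y ^ a * x ^ b ≤ x ^ a * y ^ b
  ratio-mono {x} {y} {a} x≤y a≤b with m≤n⇒∃[o]m+o≡n a≤b
  ... | d , refl rewrite ^-distribˡ-+-* x a d | ^-distribˡ-+-* y a d =
    certify (x ^ a ∷ y ^ a ∷ x ^ d ∷ y ^ d ∷ []) (v1 :* (v0 :* v2)) (v0 :* (v1 :* v3))
      ((v0 :* v1 ×ʰ v2 :≤ v3 ∶ ^-monoˡ-≤ d x≤y) ∷ []) tt

  -- This is `(1 + t/W) ^ W ≤ (q/p) ^ t`, with `q/p` in the role of `e`. The left side is a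
  -- telescoping product over `v = W, …, W + t − 1`, and `(1 + 1/v) ^ W ≤ (1 + 1/v) ^ v ≤ q/p` for
  -- each factor.
  growth-upper : ∀ {p q} → (∀ v → 1 ≤ v → suc v ^ v * p ≤ v ^ v * q) →
                 ∀ W → 1 ≤ W → ∀ t → (W + t) ^ W * p ^ t ≤ W ^ W * q ^ t
  growth-upper         h W 1≤W zero    rewrite +-identityʳ W = ≤-refl
  growth-upper {p} {q} h W 1≤W (suc t) rewrite +-suc W t =
    certify (suc v ^ W ∷ v ^ W ∷ W ^ W ∷ p ∷ p ^ t ∷ q ∷ q ^ t ∷ []) (v0 :* (v3 :* v4)) (v2 :* (v5 :* v6))
      ((v4 ×ʰ v0 :* v3 :≤ v1 :* v5 ∶ step) ∷ (v5 ×ʰ v1 :* v4 :≤ v2 :* v6 ∶ growth-upper h W 1≤W t) ∷ []) tt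
    where
    v = W + t
    h′ : suc v ^ W * suc v ^ t * p ≤ v ^ W * v ^ t * q
    h′ = subst₂ (λ a b → a * p ≤ b * q) (^-distribˡ-+-* (suc v) W t) (^-distribˡ-+-* v W t)
           (h v (≤-trans 1≤W (m≤m+n W t)))
    step : suc v ^ W * p ≤ v ^ W * q
    step = *-cancelˡ-≤ (suc v ^ t) {{m^n≢0 (suc v) t}}
      (certify (suc v ^ W ∷ suc v ^ t ∷ v ^ W ∷ v ^ t ∷ p ∷ q ∷ []) (v1 :* (v0 :* v4)) (v1 :* (v2 :* v5))
        ((v0 :* v1 :* v4 :≤ v2 :* v3 :* v5 ∶ h′) ∷ (v2 :* v5 ×ʰ v3 :≤ v1 ∶ ^-monoˡ-≤ t (n≤1+n v)) ∷ []) tt)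

  -- This is `(1 − t/W) ^ W ≤ (p/q) ^ t`. The product telescopes over `v = V, …, W − 1`, and `(1 +
  -- 1/v) ^ W ≥ (1 + 1/v) ^ (v + 1) ≥ q/p` because `v + 1 ≤ W`.
  growth-lower : ∀ {p q} → (∀ v → 1 ≤ v → v ^ suc v * q ≤ suc v ^ suc v * p) →
                 ∀ W t V → 1 ≤ V → V + t ≡ W → V ^ W * q ^ t ≤ W ^ W * p ^ t
  growth-lower         h W zero    V 1≤V refl rewrite +-identityʳ V = ≤-refl
  growth-lower {p} {q} h W (suc t) V 1≤V refl rewrite +-suc V t =
    certify (V ^ (suc V + t) ∷ suc V ^ (suc V + t) ∷ (suc V + t) ^ (suc V + t) ∷ p ∷ p ^ t ∷ q ∷ q ^ t ∷ [])
      (v0 :* (v5 :* v6)) (v2 :* (v3 :* v4))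
      ((v6 ×ʰ v0 :* v5 :≤ v1 :* v3 ∶ step) ∷
       (v3 ×ʰ v1 :* v6 :≤ v2 :* v4 ∶ growth-lower h (suc V + t) t (suc V) (s≤s z≤n) refl) ∷ []) tt
    where
    step : V ^ (suc V + t) * q ≤ suc V ^ (suc V + t) * p
    step = subst₂ (λ a b → a * q ≤ b * p) (sym (^-distribˡ-+-* V (suc V) t)) (sym (^-distribˡ-+-* (suc V) (suc V) t))
      (certify (V ^ suc V ∷ V ^ t ∷ suc V ^ suc V ∷ suc V ^ t ∷ p ∷ q ∷ []) (v0 :* v1 :* v5) (v2 :* v3 :* v4)
        ((v1 ×ʰ v0 :* v5 :≤ v2 :* v4 ∶ h V 1≤V) ∷ (v2 :* v4 ×ʰ v1 :≤ v3 ∶ ^-monoˡ-≤ t (n≤1+n V)) ∷ []) tt)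

  ^-swap : ∀ x a b → (x ^ a) ^ b ≡ (x ^ b) ^ a
  ^-swap x a b = trans (^-*-assoc x a b) (trans (cong (x ^_) (*-comm a b)) (sym (^-*-assoc x b a)))

  module _ {x y : ℕ} (1≤x : 1 ≤ x) (x≤y : x ≤ y) where

    private
      ^-≢0 : ∀ {z} → 1 ≤ z → ∀ n → NonZero (z ^ n)
      ^-≢0 {suc z} _ n = m^n≢0 (suc z) n

    -- Taking `W`-th powers clears the denominator of the exponent `9 t m / W`; `growth-upper` then
    -- replaces `(1 + t/W) ^ W` by a power of `y/x`. In the application `(1 + t/W) ^ m` is the mean
    -- of `(9/8) ^ X` for the number of hits `X`.
    upper-tail-ratio : (∀ v → 1 ≤ v → suc v ^ v * x ^ 9 ≤ v ^ v * y ^ 9) →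
      ∀ W t m k X → 1 ≤ W → W * k + t * 9 * m ≤ W * X → y ^ k * (W + t) ^ m * x ^ X ≤ x ^ k * W ^ m * y ^ X
    upper-tail-ratio h W t m k X 1≤W bad = ^-cancel-≤ W 1≤W
      (subst₂ _≤_ (sym (expand (y ^ k) (W + t) (x ^ X))) (sym (expand (x ^ k) W (y ^ X))) main)
      where
      expand : ∀ a b c → (a * b ^ m * c) ^ W ≡ a ^ W * (b ^ W) ^ m * c ^ W
      expand a b c = trans (^-distribʳ-* W (a * b ^ m) c)
        (cong (_* c ^ W) (trans (^-distribʳ-* W a (b ^ m)) (cong (a ^ W *_) (^-swap b m W))))
      exponents : ∀ z → z ^ (W * k + t * 9 * m) ≡ (z ^ k) ^ W * ((z ^ 9) ^ t) ^ m
      exponents z = trans (^-distribˡ-+-* z (W * k) (t * 9 * m)) (cong₂ _*_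
        (trans (sym (^-*-assoc z W k)) (^-swap z W k))
        (trans (sym (^-*-assoc z (t * 9) m)) (cong (_^ m) (trans (sym (^-*-assoc z t 9)) (^-swap z t 9)))))
      exponent : ∀ z → z ^ (W * X) ≡ (z ^ X) ^ W
      exponent z = trans (sym (^-*-assoc z W X)) (^-swap z W X)
      h₁ : ((W + t) ^ W) ^ m * ((x ^ 9) ^ t) ^ m ≤ (W ^ W) ^ m * ((y ^ 9) ^ t) ^ m
      h₁ = subst₂ _≤_ (^-distribʳ-* m ((W + t) ^ W) ((x ^ 9) ^ t)) (^-distribʳ-* m (W ^ W) ((y ^ 9) ^ t))
        (^-monoˡ-≤ m (growth-upper h W 1≤W t))
      h₂ : (y ^ k) ^ W * ((y ^ 9) ^ t) ^ m * (x ^ X) ^ W ≤ (x ^ k) ^ W * ((x ^ 9) ^ t) ^ m * (y ^ X) ^ W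
      h₂ = subst₂ _≤_ (cong₂ _*_ (exponents y) (exponent x)) (cong₂ _*_ (exponents x) (exponent y)) (ratio-mono x≤y bad)
      main : (y ^ k) ^ W * ((W + t) ^ W) ^ m * (x ^ X) ^ W ≤ (x ^ k) ^ W * (W ^ W) ^ m * (y ^ X) ^ W
      main = *-cancelˡ-≤ (((x ^ 9) ^ t) ^ m) {{^-≢0 (m^n>0 (x ^ 9) {{^-≢0 1≤x 9}} t) m}}
        (certify ((y ^ k) ^ W ∷ ((W + t) ^ W) ^ m ∷ (x ^ X) ^ W ∷ (x ^ k) ^ W ∷ (W ^ W) ^ m ∷ (y ^ X) ^ W ∷
                  ((x ^ 9) ^ t) ^ m ∷ ((y ^ 9) ^ t) ^ m ∷ [])
          (v6 :* (v0 :* v1 :* v2)) (v6 :* (v3 :* v4 :* v5))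
          ((v0 :* v2 ×ʰ v1 :* v6 :≤ v4 :* v7 ∶ h₁) ∷ (v4 ×ʰ v0 :* v7 :* v2 :≤ v3 :* v6 :* v5 ∶ h₂) ∷ []) tt)

    -- The same device with `W = V + t`. In the application `(V/W) ^ m` is the mean of `(8/9) ^ X`,
    -- and the number of hits is included in `k`.
    lower-tail-ratio : (∀ v → 1 ≤ v → v ^ suc v * y ^ 8 ≤ suc v ^ suc v * x ^ 8) →
      ∀ V t m k → 1 ≤ V → (V + t) * k ≤ t * 8 * m → y ^ k * V ^ m ≤ x ^ k * (V + t) ^ m
    lower-tail-ratio h V t m k 1≤V bad = ^-cancel-≤ W (≤-trans 1≤V (m≤m+n V t))
      (subst₂ _≤_ (sym (expand (y ^ k) V)) (sym (expand (x ^ k) W)) main)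
      where
      W = V + t
      expand : ∀ a b → (a * b ^ m) ^ W ≡ a ^ W * (b ^ W) ^ m
      expand a b = trans (^-distribʳ-* W a (b ^ m)) (cong (a ^ W *_) (^-swap b m W))
      exponentˡ : ∀ z → z ^ (W * k) ≡ (z ^ k) ^ W
      exponentˡ z = trans (sym (^-*-assoc z W k)) (^-swap z W k)
      exponentʳ : ∀ z → z ^ (t * 8 * m) ≡ ((z ^ 8) ^ t) ^ m
      exponentʳ z = trans (sym (^-*-assoc z (t * 8) m)) (cong (_^ m) (trans (sym (^-*-assoc z t 8)) (^-swap z t 8)))
      h₁ : (V ^ W) ^ m * ((y ^ 8) ^ t) ^ m ≤ (W ^ W) ^ m * ((x ^ 8) ^ t) ^ m
      h₁ = subst₂ _≤_ (^-distribʳ-* m (V ^ W) ((y ^ 8) ^ t)) (^-distribʳ-* m (W ^ W) ((x ^ 8) ^ t))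
        (^-monoˡ-≤ m (growth-lower h W t V 1≤V refl))
      h₂ : (y ^ k) ^ W * ((x ^ 8) ^ t) ^ m ≤ (x ^ k) ^ W * ((y ^ 8) ^ t) ^ m
      h₂ = subst₂ _≤_ (cong₂ _*_ (exponentˡ y) (exponentʳ x)) (cong₂ _*_ (exponentˡ x) (exponentʳ y)) (ratio-mono x≤y bad)
      main : (y ^ k) ^ W * (V ^ W) ^ m ≤ (x ^ k) ^ W * (W ^ W) ^ m
      main = *-cancelˡ-≤ (((y ^ 8) ^ t) ^ m) {{^-≢0 (m^n>0 (y ^ 8) {{^-≢0 (≤-trans 1≤x x≤y) 8}} t) m}}
        (certify ((y ^ k) ^ W ∷ (V ^ W) ^ m ∷ (x ^ k) ^ W ∷ (W ^ W) ^ m ∷ ((x ^ 8) ^ t) ^ m ∷ ((y ^ 8) ^ t) ^ m ∷ [])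
          (v5 :* (v0 :* v1)) (v5 :* (v2 :* v3))
          ((v0 ×ʰ v1 :* v5 :≤ v3 :* v4 ∶ h₁) ∷ (v3 ×ʰ v0 :* v4 :≤ v2 :* v5 ∶ h₂) ∷ []) tt)

-- Chernoff bounds for independent samples, and the union bound

module TailBounds where

  open Prelude
  open import Data.Bool.ListAction using (all)
  open import Algebra.Properties.CommutativeSemigroup *-commutativeSemigroup using () renaming (interchange to *-interchange)
  open Certificates
  open Counting
  open ExponentialBounds

  private variable
    A : Set

  -- The unnormalised expectation over `m` independent uniform draws from `Ω`.
  Σ^ : List A → ℕ → (List A → ℕ) → ℕ
  Σ^ Ω zero    f = f []
  Σ^ Ω (suc m) f = ∑ Ω λ x → Σ^ Ω m (f ∘ (x ∷_))

  ∏ : (A → ℕ) → List A → ℕ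
  ∏ h []      = 1
  ∏ h (x ∷ ω) = h x * ∏ h ω

  Σ^-mono : ∀ (Ω : List A) m {f g} → (∀ ω → length ω ≡ m → f ω ≤ g ω) → Σ^ Ω m f ≤ Σ^ Ω m g
  Σ^-mono Ω zero    h = h [] refl
  Σ^-mono Ω (suc m) h = ∑-mono Ω λ x → Σ^-mono Ω m λ ω e → h (x ∷ ω) (cong suc e)

  Σ^-+ : ∀ (Ω : List A) m f g → Σ^ Ω m (λ ω → f ω + g ω) ≡ Σ^ Ω m f + Σ^ Ω m g
  Σ^-+ Ω zero    f g = refl
  Σ^-+ Ω (suc m) f g = trans (∑-cong Ω λ x → Σ^-+ Ω m (f ∘ (x ∷_)) (g ∘ (x ∷_))) (∑-+ Ω _ _)

  Σ^-*ʳ : ∀ (Ω : List A) m f c → Σ^ Ω m (λ ω → f ω * c) ≡ Σ^ Ω m f * c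
  Σ^-*ʳ Ω zero    f c = refl
  Σ^-*ʳ Ω (suc m) f c = trans (∑-cong Ω λ x → Σ^-*ʳ Ω m (f ∘ (x ∷_)) c) (∑-*ʳ Ω _ c)

  Σ^-*ˡ : ∀ (Ω : List A) m f c → Σ^ Ω m (λ ω → c * f ω) ≡ c * Σ^ Ω m f
  Σ^-*ˡ Ω zero    f c = refl
  Σ^-*ˡ Ω (suc m) f c = trans (∑-cong Ω λ x → Σ^-*ˡ Ω m (f ∘ (x ∷_)) c) (∑-*ˡ Ω _ c)

  Σ^-∏ : ∀ (Ω : List A) m h → Σ^ Ω m (∏ h) ≡ ∑ Ω h ^ m
  Σ^-∏ Ω zero    h = refl
  Σ^-∏ Ω (suc m) h = trans (∑-cong Ω λ x → trans (Σ^-*ˡ Ω m (∏ h) (h x)) (cong (h x *_) (Σ^-∏ Ω m h)))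
    (∑-*ʳ Ω h (∑ Ω h ^ m))

  -- Markov's inequality for a product of independent factors, whose expectation is an `m`-th power.
  -- The constants `c` and `d` keep it free of divisions.
  markov : ∀ (Ω : List A) m (bad : List A → Bool) h c d →
    (∀ ω → length ω ≡ m → T (bad ω) → c ≤ d * ∏ h ω) → Σ^ Ω m (𝟙 ∘ bad) * c ≤ d * ∑ Ω h ^ m
  markov Ω m bad h c d H =
    subst₂ _≤_ (Σ^-*ʳ Ω m (𝟙 ∘ bad) c) (trans (Σ^-*ˡ Ω m (∏ h) d) (cong (d *_) (Σ^-∏ Ω m h)))
      (Σ^-mono Ω m λ ω e → pointwise (bad ω) (H ω e))
    where
    pointwise : ∀ b {y} → (T b → c ≤ y) → 𝟙 b * c ≤ y
    pointwise true  H = ≤-trans (≤-reflexive (*-identityˡ c)) (H tt)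
    pointwise false H = z≤n

  not-≤ᵇ : ∀ {a b} → T (not (a ≤ᵇ b)) → b ≤ a
  not-≤ᵇ {a} {b} h with a ≤ᵇ b in e
  ... | false = <⇒≤ (≰⇒> λ a≤b → subst T e (≤⇒≤ᵇ a≤b))

  𝟙-not-∧ : ∀ a b → 𝟙 (not (a ∧ b)) ≤ 𝟙 (not a) + 𝟙 (not b)
  𝟙-not-∧ true  b = ≤-refl
  𝟙-not-∧ false b = s≤s z≤n

  T-∧⁻ : ∀ {a b} → T (a ∧ b) → T a × T b
  T-∧⁻ {true} {true} _ = tt , tt

  T-∧⁺ : ∀ {a b} → T a → T b → T (a ∧ b)
  T-∧⁺ {true} _ b = b

  T-all : ∀ {p : A → Bool} {xs} → T (all p xs) → ∀ {x} → x ∈ˡ xs → T (p x)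
  T-all {xs = _ ∷ _} h (here refl) = proj₁ (T-∧⁻ h)
  T-all {xs = _ ∷ _} h (there x∈)  = T-all (proj₂ (T-∧⁻ h)) x∈

  module Sampling {A : Set} (Ω : List A) (m k : ℕ) where

    L : ℕ
    L = length Ω

    upperᵇ lowerᵇ rep : (A → Bool) → List A → Bool
    upperᵇ P ω = L * # ω P * 8 ≤ᵇ m * # Ω P * 9 + L * k * 8
    lowerᵇ P ω = m * # Ω P * 8 ≤ᵇ L * (# ω P + k) * 9
    rep P ω = upperᵇ P ω ∧ lowerᵇ P ω

    -- ω is a fair sample for the set P: its number of hits is off by a
    -- relative error of 1/8 and an absolute error of k at most.
    record Rep (P : A → Bool) (ω : List A) : Set where
      constructor mkRep
      field
        upper : L * # ω P * 8 ≤ m * # Ω P * 9 + L * k * 8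
        lower : m * # Ω P * 8 ≤ L * (# ω P + k) * 9

    rep-sound : ∀ P ω → T (rep P ω) → Rep P ω
    rep-sound P ω h = mkRep (≤ᵇ⇒≤ _ _ (proj₁ (T-∧⁻ h))) (≤ᵇ⇒≤ _ _ (proj₂ (T-∧⁻ {upperᵇ P ω} h)))

    module _ (P : A → Bool) (0<L : 0 < L) where
      private
        τ co : ℕ
        τ  = # Ω P
        co = # Ω (not ∘ P)

        co+τ : co + τ ≡ L
        co+τ = trans (sym (∑-+ Ω _ _)) (trans (∑-cong Ω λ x → lemma (P x)) (sym (length≡∑ Ω)))
          where
          lemma : ∀ b → 𝟙 (not b) + 𝟙 b ≡ 1
          lemma true  = refl
          lemma false = refl

        -- Integral forms of the exponential moments: `weight⁺` is 8 times the factor of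
        -- `(9/8) ^ X`, and `weight⁻` is 9 times the factor of `(8/9) ^ X`.
        weight⁺ weight⁻ : A → ℕ
        weight⁺ x = 8 + 𝟙 (P x)
        weight⁻ x = 8 + 𝟙 (not (P x))

        ∑-weight⁺ : ∑ Ω weight⁺ ≡ L * 8 + τ
        ∑-weight⁺ = trans (∑-+ Ω (λ _ → 8) _) (cong (_+ τ) (∑-const Ω 8))

        ∑-weight⁻ : ∑ Ω weight⁻ ≡ L * 8 + co
        ∑-weight⁻ = trans (∑-+ Ω (λ _ → 8) _) (cong (_+ co) (∑-const Ω 8))

        ∏-weight⁺ : ∀ ω → ∏ weight⁺ ω * 8 ^ # ω P ≡ 9 ^ # ω P * 8 ^ length ω
        ∏-weight⁺ []      = refl
        ∏-weight⁺ (x ∷ ω) with P x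
        ... | true  = certify-≡ (∏ weight⁺ ω ∷ 8 ^ # ω P ∷ 9 ^ # ω P ∷ 8 ^ length ω ∷ []) (con 9 :* v0 :* (con 8 :* v1)) (con 9 :* v2 :* (con 8 :* v3))
          ((con 72 ×ʰ v0 :* v1 :≤ v2 :* v3 ∶ ≤-reflexive (∏-weight⁺ ω)) ∷ []) ((con 72 ×ʰ v2 :* v3 :≤ v0 :* v1 ∶ ≤-reflexive (sym (∏-weight⁺ ω))) ∷ []) tt tt
        ... | false = certify-≡ (∏ weight⁺ ω ∷ 8 ^ # ω P ∷ 9 ^ # ω P ∷ 8 ^ length ω ∷ []) (con 8 :* v0 :* v1) (v2 :* (con 8 :* v3))
          ((con 8 ×ʰ v0 :* v1 :≤ v2 :* v3 ∶ ≤-reflexive (∏-weight⁺ ω)) ∷ []) ((con 8 ×ʰ v2 :* v3 :≤ v0 :* v1 ∶ ≤-reflexive (sym (∏-weight⁺ ω))) ∷ []) tt tt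

        ∏-weight⁻ : ∀ ω → ∏ weight⁻ ω * 9 ^ # ω P ≡ 8 ^ # ω P * 9 ^ length ω
        ∏-weight⁻ []      = refl
        ∏-weight⁻ (x ∷ ω) with P x
        ... | true  = certify-≡ (∏ weight⁻ ω ∷ 9 ^ # ω P ∷ 8 ^ # ω P ∷ 9 ^ length ω ∷ []) (con 8 :* v0 :* (con 9 :* v1)) (con 8 :* v2 :* (con 9 :* v3))
          ((con 72 ×ʰ v0 :* v1 :≤ v2 :* v3 ∶ ≤-reflexive (∏-weight⁻ ω)) ∷ []) ((con 72 ×ʰ v2 :* v3 :≤ v0 :* v1 ∶ ≤-reflexive (sym (∏-weight⁻ ω))) ∷ []) tt tt
        ... | false = certify-≡ (∏ weight⁻ ω ∷ 9 ^ # ω P ∷ 8 ^ # ω P ∷ 9 ^ length ω ∷ []) (con 9 :* v0 :* v1) (v2 :* (con 9 :* v3))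
          ((con 9 ×ʰ v0 :* v1 :≤ v2 :* v3 ∶ ≤-reflexive (∏-weight⁻ ω)) ∷ []) ((con 9 ×ʰ v2 :* v3 :≤ v0 :* v1 ∶ ≤-reflexive (sym (∏-weight⁻ ω))) ∷ []) tt tt

        1≤W : 1 ≤ L * 8
        1≤W = *-mono-≤ 0<L (s≤s (z≤n {7}))

      -- The mean of `(9/8) ^ X` is at most `(9/8) ^ (9 m τ / (8 L))`. A bad sample has
      -- `X ≥ 9 m τ / (8 L) + k`, which exceeds this by the factor `(9/8) ^ k`.
      upper-tail : Σ^ Ω m (𝟙 ∘ not ∘ upperᵇ P) * 9 ^ k ≤ 8 ^ k * L ^ m
      upper-tail = *-cancelʳ-≤ _ _ (G ^ m) {{m^n≢0 G m {{>-nonZero (≤-trans 1≤W (m≤m+n (L * 8) τ))}}}}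
        (subst₂ _≤_ (sym (*-assoc (Σ^ Ω m (𝟙 ∘ not ∘ upperᵇ P)) (9 ^ k) (G ^ m))) (cong (λ s → 8 ^ k * L ^ m * s ^ m) ∑-weight⁺)
          (markov Ω m (not ∘ upperᵇ P) weight⁺ (9 ^ k * G ^ m) (8 ^ k * L ^ m) pointwise))
        where
        G = L * 8 + τ
        pointwise : ∀ ω → length ω ≡ m → T (not (upperᵇ P ω)) → 9 ^ k * G ^ m ≤ 8 ^ k * L ^ m * ∏ weight⁺ ω
        pointwise ω e bad = *-cancelʳ-≤ _ _ (8 ^ X) {{m^n≢0 8 X}} (≤-trans ratio (≤-reflexive eq))
          where
          X = # ω P
          ratio : 9 ^ k * G ^ m * 8 ^ X ≤ 8 ^ k * (L * 8) ^ m * 9 ^ X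
          ratio = upper-tail-ratio {8} {9} (s≤s z≤n) (n≤1+n 8) e-upper (L * 8) τ m k X 1≤W
            (certify (L ∷ k ∷ τ ∷ m ∷ X ∷ []) (v0 :* con 8 :* v1 :+ v2 :* con 9 :* v3) (v0 :* con 8 :* v4)
              ((v3 :* v2 :* con 9 :+ v0 :* v1 :* con 8 :≤ v0 :* v4 :* con 8 ∶ not-≤ᵇ bad) ∷ []) tt)
          eq : 8 ^ k * (L * 8) ^ m * 9 ^ X ≡ 8 ^ k * L ^ m * ∏ weight⁺ ω * 8 ^ X
          eq = begin
            8 ^ k * (L * 8) ^ m * 9 ^ X           ≡⟨ cong (λ z → 8 ^ k * z * 9 ^ X) (^-distribʳ-* m L 8) ⟩
            8 ^ k * (L ^ m * 8 ^ m) * 9 ^ X       ≡⟨ cong (_* 9 ^ X) (sym (*-assoc (8 ^ k) (L ^ m) (8 ^ m))) ⟩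
            8 ^ k * L ^ m * 8 ^ m * 9 ^ X         ≡⟨ *-assoc (8 ^ k * L ^ m) (8 ^ m) (9 ^ X) ⟩
            8 ^ k * L ^ m * (8 ^ m * 9 ^ X)       ≡⟨ cong (8 ^ k * L ^ m *_) (*-comm (8 ^ m) (9 ^ X)) ⟩
            8 ^ k * L ^ m * (9 ^ X * 8 ^ m)       ≡⟨ cong (λ z → 8 ^ k * L ^ m * (9 ^ X * 8 ^ z)) (sym e) ⟩
            8 ^ k * L ^ m * (9 ^ X * 8 ^ length ω) ≡⟨ cong (8 ^ k * L ^ m *_) (sym (∏-weight⁺ ω)) ⟩
            8 ^ k * L ^ m * (∏ weight⁺ ω * 8 ^ X) ≡⟨ sym (*-assoc (8 ^ k * L ^ m) (∏ weight⁺ ω) (8 ^ X)) ⟩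
            8 ^ k * L ^ m * ∏ weight⁺ ω * 8 ^ X   ∎
            where open ≡-Reasoning

      -- The mean of `(8/9) ^ X` is at most `(8/9) ^ (8 m τ / (9 L))`. A bad sample has
      -- `X + k ≤ 8 m τ / (9 L)`, which exceeds this by the factor `(9/8) ^ k`.
      lower-tail : Σ^ Ω m (𝟙 ∘ not ∘ lowerᵇ P) * 9 ^ k ≤ 8 ^ k * L ^ m
      lower-tail = *-cancelʳ-≤ _ _ (V ^ m) {{m^n≢0 V m {{>-nonZero 1≤V}}}}
        (subst₂ _≤_ (sym (*-assoc (Σ^ Ω m (𝟙 ∘ not ∘ lowerᵇ P)) (9 ^ k) (V ^ m))) (cong (λ s → 8 ^ k * L ^ m * s ^ m) ∑-weight⁻)
          (markov Ω m (not ∘ lowerᵇ P) weight⁻ (9 ^ k * V ^ m) (8 ^ k * L ^ m) pointwise))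
        where
        V = L * 8 + co
        1≤V : 1 ≤ V
        1≤V = ≤-trans 1≤W (m≤m+n (L * 8) co)
        V+τ : V + τ ≡ L * 9
        V+τ = trans (+-assoc (L * 8) co τ) (trans (cong (L * 8 +_) co+τ)
          (trans (+-comm (L * 8) L) (sym (*-suc L 8))))
        pointwise : ∀ ω → length ω ≡ m → T (not (lowerᵇ P ω)) → 9 ^ k * V ^ m ≤ 8 ^ k * L ^ m * ∏ weight⁻ ω
        pointwise ω e bad = *-cancelʳ-≤ _ _ (9 ^ X) {{m^n≢0 9 X}} (subst₂ _≤_ eq₁ eq₂ ratio)
          where
          X = # ω P
          ratio : 9 ^ (k + X) * V ^ m ≤ 8 ^ (k + X) * (V + τ) ^ m
          ratio = lower-tail-ratio {8} {9} (s≤s z≤n) (n≤1+n 8) e-lower V τ m (k + X) 1≤V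
            (subst (λ w → w * (k + X) ≤ τ * 8 * m) (sym V+τ)
              (certify (L ∷ k ∷ τ ∷ m ∷ X ∷ []) (v0 :* con 9 :* (v1 :+ v4)) (v2 :* con 8 :* v3)
                ((v0 :* (v4 :+ v1) :* con 9 :≤ v3 :* v2 :* con 8 ∶ not-≤ᵇ bad) ∷ []) tt))
          open ≡-Reasoning
          eq₁ : 9 ^ (k + X) * V ^ m ≡ 9 ^ k * V ^ m * 9 ^ X
          eq₁ = begin
            9 ^ (k + X) * V ^ m       ≡⟨ cong (_* V ^ m) (^-distribˡ-+-* 9 k X) ⟩
            9 ^ k * 9 ^ X * V ^ m     ≡⟨ *-assoc (9 ^ k) (9 ^ X) (V ^ m) ⟩
            9 ^ k * (9 ^ X * V ^ m)   ≡⟨ cong (9 ^ k *_) (*-comm (9 ^ X) (V ^ m)) ⟩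
            9 ^ k * (V ^ m * 9 ^ X)   ≡⟨ sym (*-assoc (9 ^ k) (V ^ m) (9 ^ X)) ⟩
            9 ^ k * V ^ m * 9 ^ X     ∎
          eq₂ : 8 ^ (k + X) * (V + τ) ^ m ≡ 8 ^ k * L ^ m * ∏ weight⁻ ω * 9 ^ X
          eq₂ = begin
            8 ^ (k + X) * (V + τ) ^ m             ≡⟨ cong₂ (λ a b → a * b ^ m) (^-distribˡ-+-* 8 k X) V+τ ⟩
            8 ^ k * 8 ^ X * (L * 9) ^ m           ≡⟨ cong (8 ^ k * 8 ^ X *_) (^-distribʳ-* m L 9) ⟩
            8 ^ k * 8 ^ X * (L ^ m * 9 ^ m)       ≡⟨ *-interchange (8 ^ k) (8 ^ X) (L ^ m) (9 ^ m) ⟩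
            8 ^ k * L ^ m * (8 ^ X * 9 ^ m)       ≡⟨ cong (λ z → 8 ^ k * L ^ m * (8 ^ X * 9 ^ z)) (sym e) ⟩
            8 ^ k * L ^ m * (8 ^ X * 9 ^ length ω) ≡⟨ cong (8 ^ k * L ^ m *_) (sym (∏-weight⁻ ω)) ⟩
            8 ^ k * L ^ m * (∏ weight⁻ ω * 9 ^ X) ≡⟨ sym (*-assoc (8 ^ k * L ^ m) (∏ weight⁻ ω) (9 ^ X)) ⟩
            8 ^ k * L ^ m * ∏ weight⁻ ω * 9 ^ X   ∎

      rep-fails : Σ^ Ω m (𝟙 ∘ not ∘ rep P) * 9 ^ k ≤ 8 ^ k * L ^ m * 2
      rep-fails = ≤-trans (*-monoˡ-≤ (9 ^ k) union)
        (certify (Σ^ Ω m (𝟙 ∘ not ∘ upperᵇ P) ∷ Σ^ Ω m (𝟙 ∘ not ∘ lowerᵇ P) ∷ 9 ^ k ∷ 8 ^ k * L ^ m ∷ [])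
          ((v0 :+ v1) :* v2) (v3 :* con 2) ((v0 :* v2 :≤ v3 ∶ upper-tail) ∷ (v1 :* v2 :≤ v3 ∶ lower-tail) ∷ []) tt)
        where
        union : Σ^ Ω m (𝟙 ∘ not ∘ rep P) ≤ Σ^ Ω m (𝟙 ∘ not ∘ upperᵇ P) + Σ^ Ω m (𝟙 ∘ not ∘ lowerᵇ P)
        union = ≤-trans (Σ^-mono Ω m λ ω _ → 𝟙-not-∧ (upperᵇ P ω) (lowerᵇ P ω)) (≤-reflexive (Σ^-+ Ω m _ _))

  module _ {A : Set} (Ω : List A) (m k₁ : ℕ) where
    open Sampling Ω m (k₁ * 8)

    -- Since `(9/8) ^ 8 ≥ 2`, an additive error of `8 k₁` makes the failure probability at most
    -- `2 · 2 ^ (−k₁)`.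
    rep-fails-2 : 0 < L → ∀ P → Σ^ Ω m (𝟙 ∘ not ∘ rep P) * 2 ^ k₁ ≤ L ^ m * 2
    rep-fails-2 0<L P = *-cancelʳ-≤ _ _ ((8 ^ 8) ^ k₁) {{m^n≢0 (8 ^ 8) k₁}}
      (≤-trans lhs (≤-trans (rep-fails P 0<L) (≤-reflexive rhs)))
      where
      F = Σ^ Ω m (𝟙 ∘ not ∘ rep P)
      power : ∀ z → z ^ (k₁ * 8) ≡ (z ^ 8) ^ k₁
      power z = trans (cong (z ^_) (*-comm k₁ 8)) (sym (^-*-assoc z 8 k₁))
      lhs : F * 2 ^ k₁ * (8 ^ 8) ^ k₁ ≤ F * 9 ^ (k₁ * 8)
      lhs = ≤-trans (≤-reflexive (trans (*-assoc F _ _) (cong (F *_) (sym (^-distribʳ-* k₁ 2 (8 ^ 8))))))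
        (*-monoʳ-≤ F (≤-trans (^-monoˡ-≤ k₁ (≤ᵇ⇒≤ (2 * 8 ^ 8) (9 ^ 8) tt)) (≤-reflexive (sym (power 9)))))
      rhs : 8 ^ (k₁ * 8) * L ^ m * 2 ≡ L ^ m * 2 * (8 ^ 8) ^ k₁
      rhs = trans (*-assoc (8 ^ (k₁ * 8)) (L ^ m) 2) (trans (*-comm (8 ^ (k₁ * 8)) (L ^ m * 2)) (cong (L ^ m * 2 *_) (power 8)))

    repAll : List (A → Bool) → List A → Bool
    repAll family ω = all (λ P → rep P ω) family

    repAll-fails : 0 < L → ∀ family → Σ^ Ω m (𝟙 ∘ not ∘ repAll family) * 2 ^ k₁ ≤ L ^ m * 2 * length family
    repAll-fails 0<L []           = ≤-trans (*-monoˡ-≤ (2 ^ k₁) (≤-trans (Σ^-mono Ω m λ _ _ → ≤-refl {0}) (≤-reflexive (zero-sum m)))) z≤n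
      where
      zero-sum : ∀ m → Σ^ Ω m (λ _ → 0) ≡ 0
      zero-sum zero    = refl
      zero-sum (suc m) = trans (∑-cong Ω λ _ → zero-sum m) (∑-zero Ω)
    repAll-fails 0<L (P ∷ family) = ≤-trans (*-monoˡ-≤ (2 ^ k₁) union)
      (certify (Σ^ Ω m (𝟙 ∘ not ∘ rep P) ∷ Σ^ Ω m (𝟙 ∘ not ∘ repAll family) ∷ 2 ^ k₁ ∷ L ^ m ∷ length family ∷ [])
        ((v0 :+ v1) :* v2) (v3 :* con 2 :* (con 1 :+ v4))
        ((v0 :* v2 :≤ v3 :* con 2 ∶ rep-fails-2 0<L P) ∷ (v1 :* v2 :≤ v3 :* con 2 :* v4 ∶ repAll-fails 0<L family) ∷ []) tt)
      where
      union : Σ^ Ω m (𝟙 ∘ not ∘ repAll (P ∷ family)) ≤ Σ^ Ω m (𝟙 ∘ not ∘ rep P) + Σ^ Ω m (𝟙 ∘ not ∘ repAll family)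
      union = ≤-trans (Σ^-mono Ω m λ ω _ → 𝟙-not-∧ (rep P ω) (repAll family ω)) (≤-reflexive (Σ^-+ Ω m _ _))

    repAll-sound : ∀ {family ω} → T (repAll family ω) → ∀ {P} → P ∈ˡ family → Rep P ω
    repAll-sound {ω = ω} h {P} P∈ = rep-sound P ω (T-all h P∈)

-- Thresholds and the numerical inequalities relating samples to true sizes

module Arithmetic where

  open Prelude
  open Certificates

  -- X is the number of hits of a set of size t in a sample of size m from a
  -- set of size N.
  record Fair (N m k X t : ℕ) : Set where
    constructor fair
    field
      upper : N * X * 8 ≤ m * t * 9 + N * k * 8
      lower : m * t * 8 ≤ N * (X + k) * 9

  -- The cutoff 1/5 of the cleaning test separates two fractions: 1/8, which Markov's inequality
  -- gives for most points, and 3/10, for which two points still share 2/5 of their partners. The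
  -- hypothesis `N * k * 33 ≤ m * b` makes `k` at most 1/33 of the expected number of hits of the
  -- base.
  clean-sound : ∀ {N m k Xbad bad XB b} → Fair N m k Xbad bad → Fair N m k XB b →
                Xbad * 5 ≤ XB → N * k * 33 ≤ m * b → 1 ≤ m → bad * 10 ≤ b * 3
  clean-sound {N} {m} {k} {Xbad} {bad} {XB} {b} f g h big 1≤m =
    *-cancelˡ-≤ m {{>-nonZero 1≤m}} (*-cancelʳ-≤ _ _ 320
    (certify (N ∷ m ∷ k ∷ Xbad ∷ bad ∷ XB ∷ b ∷ [])
      (v1 :* (v4 :* con 10) :* con 320) (v1 :* (v6 :* con 3) :* con 320)
      ((con 400 ×ʰ v1 :* v4 :* con 8 :≤ v0 :* (v3 :+ v2) :* con 9 ∶ Fair.lower f) ∷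
       (con 90 ×ʰ v0 :* v5 :* con 8 :≤ v1 :* v6 :* con 9 :+ v0 :* v2 :* con 8 ∶ Fair.upper g) ∷
       (con 720 :* v0 ×ʰ v3 :* con 5 :≤ v5 ∶ h) ∷
       (con 135 ×ʰ v0 :* v2 :* con 33 :≤ v1 :* v6 ∶ big) ∷ []) tt))

  clean-complete : ∀ {N m k Xbad bad XB b} → Fair N m k Xbad bad → Fair N m k XB b →
                   bad * 8 ≤ b → N * k * 33 ≤ m * b → 1 ≤ N → Xbad * 5 ≤ XB
  clean-complete {N} {m} {k} {Xbad} {bad} {XB} {b} f g h big 1≤N =
    *-cancelˡ-≤ N {{>-nonZero 1≤N}} (*-cancelʳ-≤ _ _ 576
    (certify (N ∷ m ∷ k ∷ Xbad ∷ bad ∷ XB ∷ b ∷ [])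
      (v0 :* (v3 :* con 5) :* con 576) (v0 :* v5 :* con 576)
      ((con 360 ×ʰ v0 :* v3 :* con 8 :≤ v1 :* v4 :* con 9 :+ v0 :* v2 :* con 8 ∶ Fair.upper f) ∷
       (con 64 ×ʰ v1 :* v6 :* con 8 :≤ v0 :* (v5 :+ v2) :* con 9 ∶ Fair.lower g) ∷
       (con 405 :* v1 ×ʰ v4 :* con 8 :≤ v6 ∶ h) ∷
       (con 107 ×ʰ v0 :* v2 :* con 33 :≤ v1 :* v6 ∶ big) ∷ []) tt))

  module Parameters (B k : ℕ) where

    -- As fractions of `m`: `J` is `1/(64 B²)`, the least popularity threshold of the low branch;
    -- `θ` is `1/(512 B²)`, the popularity asked of sums in a fibre; `H` is `5/(8 B)`, where
    -- popularity is truncated; `D₀` is `3/(4 B)`, the least density of popular pairs; `X₀` is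
    -- `3/(8 B)`, the least sampled size of a cleaned set.
    m J θ H D₀ X₀ : ℕ
    m  = B * B * k * 65536
    J  = k * 1024
    θ  = k * 128
    H  = B * k * 40960
    D₀ = B * k * 49152
    X₀ = B * k * 24576

  module Scale (B k N : ℕ) (1≤B : 1 ≤ B) (1≤k : 1 ≤ k) (1≤N : 1 ≤ N) where

    open Parameters B k

    private
      instance
        B≢0 : NonZero B
        B≢0 = >-nonZero 1≤B
        k≢0 : NonZero k
        k≢0 = >-nonZero 1≤k
        N≢0 : NonZero N
        N≢0 = >-nonZero 1≤N
        m≢0 : NonZero m
        m≢0 = m*n≢0 (B * B * k) 65536 {{m*n≢0 (B * B) k {{m*n≢0 B B}}}}

      B′ k′ N′ m′ : Expr
      B′ = v0
      k′ = v1
      N′ = v2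
      m′ = B′ :* B′ :* k′ :* con 65536

    1≤m : 1 ≤ m
    1≤m = >-nonZero⁻¹ m

    big-base : ∀ {b} → N * 42 ≤ B * b * 128 → N * k * 33 ≤ m * b
    big-base {b} h = certify (B ∷ k ∷ N ∷ b ∷ []) (N′ :* k′ :* con 33) (m′ :* v3)
      ((k′ :* con 512 :* B′ ×ʰ N′ :* con 42 :≤ B′ :* v3 :* con 128 ∶ h) ∷
       (N′ :* k′ :* con 33 ×ʰ con 1 :≤ B′ ∶ 1≤B) ∷ []) tt

    -- The relative error turns `3/(8 B)` into `1/(3 B)`, and the additive error lowers `1/3` to
    -- `42/128`.
    size-from-sample : ∀ {X y} → Fair N m k X y → X₀ ≤ X → N * 42 ≤ B * y * 128
    size-from-sample {X} {y} f h = *-cancelˡ-≤ (B * k * 4608) {{m*n≢0 (B * k) 4608 {{m*n≢0 B k}}}}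
      (certify (B ∷ k ∷ N ∷ X ∷ y ∷ [])
        (B′ :* k′ :* con 4608 :* (N′ :* con 42)) (B′ :* k′ :* con 4608 :* (B′ :* v4 :* con 128))
        ((N′ :* v3 :* con 8 :≤ m′ :* v4 :* con 9 :+ N′ :* k′ :* con 8 ∶ Fair.upper f) ∷
         (N′ :* con 8 ×ʰ B′ :* k′ :* con 24576 :≤ v3 ∶ h) ∷
         (N′ :* k′ :* con 8 ×ʰ con 1 :≤ B′ ∶ 1≤B) ∷ []) tt)

    -- The constants are `8 · 128 − 8` and `9 · 65536`. A sum accepted as popular has of order
    -- `N / B²` representations, so there are `O(B² N)` such sums.
    high-popular : ∀ {X r} → Fair N m k X r → θ ≤ X → N * 1016 ≤ B * B * 589824 * r
    high-popular {X} {r} f h = *-cancelˡ-≤ k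
      (certify (B ∷ k ∷ N ∷ X ∷ r ∷ []) (k′ :* (N′ :* con 1016)) (k′ :* (B′ :* B′ :* con 589824 :* v4))
        ((N′ :* v3 :* con 8 :≤ m′ :* v4 :* con 9 :+ N′ :* k′ :* con 8 ∶ Fair.upper f) ∷
         (N′ :* con 8 ×ʰ k′ :* con 128 :≤ v3 ∶ h) ∷ []) tt)

    private
      1≤size : ∀ {y} → N * 42 ≤ B * y * 128 → NonZero y
      1≤size {suc y} h = _
      1≤size {zero}  h with () ← ≤-trans (≤-trans 1≤N (m≤m*n N 42)) (≤-trans h (≤-reflexive (cong (_* 128) (*-zeroʳ B))))

    -- Here `s ≤ (5/2) z² / b` with `z = O(B² N)` and `N = O(B y)`. Of the power `B⁶`, `z²`
    -- contributes `B⁴` and `N²` contributes `B²`.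
    high-doubling : ∀ {z y b s} → z * (N * 1016) ≤ B * B * 589824 * (N * N) → N * 42 ≤ B * y * 128 → y ≤ b →
                    s * b * 2 ≤ z * z * 5 → s * 9 ≤ B * B * B * B * B * B * y * 134217728
    high-doubling {z} {y} {b} {s} hz hy y≤b hs = *-cancelˡ-≤ y {{1≤size hy}} (*-cancelʳ-≤ _ _ 404635392
      (certify (B ∷ k ∷ N ∷ z ∷ y ∷ b ∷ s ∷ [])
        (v4 :* (v6 :* con 9) :* con 404635392) (v4 :* (B′ :* B′ :* B′ :* B′ :* B′ :* B′ :* v4 :* con 134217728) :* con 404635392)
        ((v6 :* con 3641718528 ×ʰ v4 :≤ v5 ∶ y≤b) ∷
         (con 1820859264 ×ʰ v6 :* v5 :* con 2 :≤ v3 :* v3 :* con 5 ∶ hs) ∷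
         (con 8820 ×ʰ v3 :* con 1016 :* (v3 :* con 1016) :≤ B′ :* B′ :* con 589824 :* N′ :* (B′ :* B′ :* con 589824 :* N′) ∶ *-mono-≤ hz′ hz′) ∷
         (con 5 :* con 347892350976 :* (B′ :* B′ :* B′ :* B′) ×ʰ N′ :* con 42 :* (N′ :* con 42) :≤ B′ :* v4 :* con 128 :* (B′ :* v4 :* con 128) ∶ *-mono-≤ hy hy) ∷ []) tt))
      where
      hz′ : z * 1016 ≤ B * B * 589824 * N
      hz′ = *-cancelˡ-≤ N (certify (B ∷ k ∷ N ∷ z ∷ []) (N′ :* (v3 :* con 1016)) (N′ :* (B′ :* B′ :* con 589824 :* N′))
        ((v3 :* (N′ :* con 1016) :≤ B′ :* B′ :* con 589824 :* (N′ :* N′) ∶ hz) ∷ []) tt)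

    low-popular : ∀ {X r j} → Fair N m k X r → j ≤ X → J ≤ j → N * j * 8184 ≤ m * 9216 * r
    low-popular {X} {r} {j} f h J≤j =
      certify (B ∷ k ∷ N ∷ X ∷ r ∷ j ∷ []) (N′ :* v5 :* con 8184) (m′ :* con 9216 :* v4)
        ((con 1024 ×ʰ N′ :* v3 :* con 8 :≤ m′ :* v4 :* con 9 :+ N′ :* k′ :* con 8 ∶ Fair.upper f) ∷
         (N′ :* con 8192 ×ʰ v5 :≤ v3 ∶ h) ∷
         (N′ :* con 8 ×ʰ k′ :* con 1024 :≤ v5 ∶ J≤j) ∷ []) tt

    -- Each of the `q` differences has at least about `j N / m` representations, and together they
    -- account for the `Δ` popular pairs. The estimate `N² D / m` then replaces `Δ`.
    low-differences : ∀ {q Δ D j} → Fair (N * N) m k D Δ → q * (N * j * 8184) ≤ m * 9216 * Δ → D₀ ≤ D →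
                      q * j * 3 ≤ N * D * 4
    low-differences {q} {Δ} {D} {j} f h D₀≤D = *-cancelˡ-≤ N (*-cancelʳ-≤ _ _ 65472
      (certify (B ∷ k ∷ N ∷ q ∷ Δ ∷ D ∷ j ∷ [])
        (N′ :* (v3 :* v6 :* con 3) :* con 65472) (N′ :* (N′ :* v5 :* con 4) :* con 65472)
        ((con 24 ×ʰ v3 :* (N′ :* v6 :* con 8184) :≤ m′ :* con 9216 :* v4 ∶ h) ∷
         (con 27648 ×ʰ m′ :* v4 :* con 8 :≤ N′ :* N′ :* (v5 :+ k′) :* con 9 ∶ Fair.lower f) ∷
         (N′ :* N′ :* con 6 ×ʰ B′ :* k′ :* con 49152 :≤ v5 ∶ D₀≤D) ∷
         (N′ :* N′ :* k′ :* con 294912 ×ʰ con 1 :≤ B′ ∶ 1≤B) ∷ []) tt))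

    -- With no additive error the factor would be 8. The bound `D ≥ D₀` makes `D² / (1024 m)` at
    -- least `36 k`, and 7 absorbs the loss.
    low-common : ∀ {P p D} → Fair N m k P p → D * D ≤ m * P * 1024 → D₀ ≤ D → N * D * D * 7 ≤ m * m * 9216 * p
    low-common {P} {p} {D} f h D₀≤D = *-cancelʳ-≤ _ _ 16
      (certify (B ∷ k ∷ N ∷ P ∷ p ∷ D ∷ []) (N′ :* v5 :* v5 :* con 7 :* con 16) (m′ :* m′ :* con 9216 :* v4 :* con 16)
        ((m′ :* con 16384 ×ʰ N′ :* v3 :* con 8 :≤ m′ :* v4 :* con 9 :+ N′ :* k′ :* con 8 ∶ Fair.upper f) ∷
         (N′ :* con 128 ×ʰ v5 :* v5 :≤ m′ :* v3 :* con 1024 ∶ h) ∷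
         (N′ :* con 16 ×ʰ B′ :* k′ :* con 49152 :* (B′ :* k′ :* con 49152) :≤ v5 :* v5 ∶ *-mono-≤ D₀≤D D₀≤D) ∷ []) tt)

    low-size : ∀ {X y D} → Fair N m k X y → D ≤ X * 2 → D₀ ≤ D → N * D ≤ m * y * 3
    low-size {X} {y} {D} f h D₀≤D = *-cancelʳ-≤ _ _ 3
      (certify (B ∷ k ∷ N ∷ X ∷ y ∷ D ∷ []) (N′ :* v5 :* con 3) (m′ :* v4 :* con 3 :* con 3)
        ((N′ :* v3 :* con 8 :≤ m′ :* v4 :* con 9 :+ N′ :* k′ :* con 8 ∶ Fair.upper f) ∷
         (N′ :* con 4 ×ʰ v5 :≤ v3 :* con 2 ∶ h) ∷
         (N′ ×ʰ B′ :* k′ :* con 49152 :≤ v5 ∶ D₀≤D) ∷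
         (N′ :* k′ :* con 49152 ×ʰ con 1 :≤ B′ ∶ 1≤B) ∷ []) tt)

    low-enough : ∀ {X D} → D ≤ X * 2 → D₀ ≤ D → X₀ ≤ X
    low-enough {X} {D} h D₀≤D = *-cancelʳ-≤ _ _ 2
      (certify (B ∷ k ∷ N ∷ X ∷ D ∷ []) (B′ :* k′ :* con 24576 :* con 2) (v3 :* con 2)
        ((v4 :≤ v3 :* con 2 ∶ h) ∷ (B′ :* k′ :* con 49152 :≤ v4 ∶ D₀≤D) ∷ []) tt)

    -- Let `δ = D / m` and `τ = j / m`. Then `z = O(N / τ²)`, the level condition gives
    -- `1 / τ² = O(B⁴ δ)`, and `δ N ≤ 3 y`. Hence `z² / y = O(B⁸ δ² N² / y) = O(B⁸ y)`: the density
    -- cancels, and the bound is the same at every level.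
    low-doubling : ∀ {z q y b s D j} → 1 ≤ j → 1 ≤ D →
                   z * (N * D * D * 7) ≤ m * m * 9216 * (q * q) → q * j * 3 ≤ N * D * 4 →
                   m * J * J ≤ D * j * suc j → N * D ≤ m * y * 3 → N * 42 ≤ B * y * 128 → y ≤ b →
                   s * b * 2 ≤ z * z * 5 →
                   s * 9 ≤ B * B * B * B * B * B * B * B * y * 2305843009213693952
    low-doubling {z} {q} {y} {b} {s} {D} {j} 1≤j 1≤D hz hq hj hy hy′ y≤b hs =
      *-cancelˡ-≤ (y * (m * m * J * J * J * J)) {{m*n≢0 y _ {{1≤size hy′}} {{mJ≢0}}}}
        -- As `m / J = 64 B²`, the factor `(m / J) ^ 4` equals `2 ^ 24 B⁸`.
        (≤-trans step₅ (poly-≤ (B ∷ k ∷ N ∷ y ∷ [])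
          (m′ :* m′ :* m′ :* m′ :* m′ :* m′ :* (v3 :* v3) :* con 8879122620)
          (v3 :* (m′ :* m′ :* J′ :* J′ :* J′ :* J′) :* (B′ :* B′ :* B′ :* B′ :* B′ :* B′ :* B′ :* B′ :* v3 :* con 2305843009213693952)) tt))
      where
      J′ = k′ :* con 1024
      J≢0 : NonZero J
      J≢0 = m*n≢0 k 1024
      mJ≢0 : NonZero (m * m * J * J * J * J)
      mJ≢0 = m*n≢0 (m * m * J * J * J) J {{m*n≢0 (m * m * J * J) J {{m*n≢0 (m * m * J) J {{m*n≢0 (m * m) J {{m*n≢0 m m}} {{J≢0}}}} {{J≢0}}}} {{J≢0}}}} {{J≢0}}
      -- The constant rounds up `(16/9) · (9216/7)`.
      step₁ : z * (j * j) ≤ m * m * N * 2341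
      step₁ = *-cancelˡ-≤ (N * D * D) {{m*n≢0 (N * D) D {{m*n≢0 N D {{N≢0}} {{>-nonZero 1≤D}}}} {{>-nonZero 1≤D}}}} (*-cancelʳ-≤ _ _ 63
        (certify (m ∷ N ∷ D ∷ j ∷ z ∷ q ∷ []) (v1 :* v2 :* v2 :* (v4 :* (v3 :* v3)) :* con 63) (v1 :* v2 :* v2 :* (v0 :* v0 :* v1 :* con 2341) :* con 63)
          ((v3 :* v3 :* con 9 ×ʰ v4 :* (v1 :* v2 :* v2 :* con 7) :≤ v0 :* v0 :* con 9216 :* (v5 :* v5) ∶ hz) ∷
           (v0 :* v0 :* con 9216 ×ʰ v5 :* v3 :* con 3 :* (v5 :* v3 :* con 3) :≤ v1 :* v2 :* con 4 :* (v1 :* v2 :* con 4) ∶ *-mono-≤ hq hq) ∷ []) tt))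
      step₂ : m * J * J ≤ D * (j * j) * 2
      step₂ = certify (m ∷ J ∷ D ∷ j ∷ []) (v0 :* v1 :* v1) (v2 :* (v3 :* v3) :* con 2)
        ((v0 :* v1 :* v1 :≤ v2 :* v3 :* (con 1 :+ v3) ∶ hj) ∷ (v2 :* v3 ×ʰ con 1 :≤ v3 ∶ 1≤j) ∷ []) tt
      step₃ : s * y * 2 * (j * j * (j * j)) ≤ m * m * N * 2341 * (m * m * N * 2341) * 5
      step₃ = certify (m ∷ N ∷ s ∷ y ∷ b ∷ j ∷ z ∷ []) (v2 :* v3 :* con 2 :* (v5 :* v5 :* (v5 :* v5))) (v0 :* v0 :* v1 :* con 2341 :* (v0 :* v0 :* v1 :* con 2341) :* con 5)
        ((v2 :* con 2 :* (v5 :* v5 :* (v5 :* v5)) ×ʰ v3 :≤ v4 ∶ y≤b) ∷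
         (v5 :* v5 :* (v5 :* v5) ×ʰ v2 :* v4 :* con 2 :≤ v6 :* v6 :* con 5 ∶ hs) ∷
         (con 5 ×ʰ v6 :* (v5 :* v5) :* (v6 :* (v5 :* v5)) :≤ v0 :* v0 :* v1 :* con 2341 :* (v0 :* v0 :* v1 :* con 2341) ∶ *-mono-≤ step₁ step₁) ∷ []) tt
      step₄ : s * y * 2 * (m * J * J * (m * J * J)) ≤ m * m * m * m * (N * D * (N * D)) * 109606 * 1000
      step₄ = certify (m ∷ N ∷ s ∷ y ∷ D ∷ j ∷ J ∷ []) (v2 :* v3 :* con 2 :* (v0 :* v6 :* v6 :* (v0 :* v6 :* v6))) (v0 :* v0 :* v0 :* v0 :* (v1 :* v4 :* (v1 :* v4)) :* con 109606 :* con 1000)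
        ((v2 :* v3 :* con 2 ×ʰ v0 :* v6 :* v6 :* (v0 :* v6 :* v6) :≤ v4 :* (v5 :* v5) :* con 2 :* (v4 :* (v5 :* v5) :* con 2) ∶ *-mono-≤ step₂ step₂) ∷
         (v4 :* v4 :* con 4 ×ʰ v2 :* v3 :* con 2 :* (v5 :* v5 :* (v5 :* v5)) :≤ v0 :* v0 :* v1 :* con 2341 :* (v0 :* v0 :* v1 :* con 2341) :* con 5 ∶ step₃) ∷ []) tt
      step₅ : y * (m * m * J * J * J * J) * (s * 9) ≤ m * m * m * m * m * m * (y * y) * 8879122620
      step₅ = certify (m ∷ N ∷ s ∷ y ∷ D ∷ J ∷ []) (v3 :* (v0 :* v0 :* v5 :* v5 :* v5 :* v5) :* (v2 :* con 9)) (v0 :* v0 :* v0 :* v0 :* v0 :* v0 :* (v3 :* v3) :* con 8879122620)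
        ((con 5 ×ʰ v2 :* v3 :* con 2 :* (v0 :* v5 :* v5 :* (v0 :* v5 :* v5)) :≤ v0 :* v0 :* v0 :* v0 :* (v1 :* v4 :* (v1 :* v4)) :* con 109606 :* con 1000 ∶ step₄) ∷
         (v0 :* v0 :* v0 :* v0 :* con 548030000 ×ʰ v1 :* v4 :* (v1 :* v4) :≤ v0 :* v3 :* con 3 :* (v0 :* v3 :* con 3) ∶ *-mono-≤ hy hy) ∷ []) tt

    -- `ρ` stands for the sampled representation counts summed over all pairs of points of the set.
    -- The constant is `65536 · 15/16 · 8/9 − 1`, rounded down.
    energy-total : ∀ {E ρ} → N * N * N * 15 ≤ B * B * E * 16 → m * E * 8 ≤ N * (ρ + N * N * k) * 9 →
                   N * N * k * 54612 ≤ ρ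
    energy-total {E} {ρ} hE hρ = *-cancelˡ-≤ N (*-cancelʳ-≤ _ _ 9
      (certify (B ∷ k ∷ N ∷ E ∷ ρ ∷ []) (N′ :* (N′ :* N′ :* k′ :* con 54612) :* con 9) (N′ :* v4 :* con 9)
        ((m′ :* v3 :* con 8 :≤ N′ :* (v4 :+ N′ :* N′ :* k′) :* con 9 ∶ hρ) ∷
         (k′ :* con 32768 ×ʰ N′ :* N′ :* N′ :* con 15 :≤ B′ :* B′ :* v3 :* con 16 ∶ hE) ∷ []) tt))

    -- Per pair, the truncated part is at most `(17/8) J + (9/8) H (D₀ + k) / m`, which is less than
    -- `36737 k`. More than `17000 k` of the total `54612 k` remains.
    excess : ∀ {μ ξ} → N * N * k * 54612 ≤ μ + ξ → m * μ * 8 ≤ N * N * (m * J * 17 + H * (D₀ + k) * 9) →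
             N * N * k * 17000 ≤ ξ
    excess {μ} {ξ} h hμ = *-cancelˡ-≤ (B * B * k * 524288) {{m*n≢0 (B * B * k) 524288 {{m*n≢0 (B * B) k {{m*n≢0 B B}}}}}}
      (certify (B ∷ k ∷ N ∷ μ ∷ ξ ∷ []) (m₈ :* (N′ :* N′ :* k′ :* con 17000)) (m₈ :* v4)
        ((m₈ ×ʰ N′ :* N′ :* k′ :* con 54612 :≤ v3 :+ v4 ∶ h) ∷
         (m′ :* v3 :* con 8 :≤ N′ :* N′ :* (m′ :* (k′ :* con 1024) :* con 17 :+ B′ :* k′ :* con 40960 :* (B′ :* k′ :* con 49152 :+ k′) :* con 9) ∶ hμ) ∷
         (N′ :* N′ :* B′ :* k′ :* k′ :* con 368640 ×ʰ con 1 :≤ B′ ∶ 1≤B) ∷ []) tt)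
      where m₈ = B′ :* B′ :* k′ :* con 524288

    private
      positive : ∀ {a b} X → 1 ≤ a → a ≤ b * X → 1 ≤ X
      positive             (suc X) _   _ = s≤s z≤n
      positive {a} {b} zero    1≤a h with () ← ≤-trans 1≤a (≤-trans h (≤-reflexive (*-zeroʳ b)))

      k≤H : k ≤ H
      k≤H = certify (B ∷ k ∷ []) v1 (v0 :* v1 :* con 40960) ((v1 ×ʰ con 1 :≤ v0 ∶ 1≤B) ∷ []) tt

    -- Since `k ≤ H`, the excess of `R` over `H` is at most `9 m r / (8 N)`. Many bad pairs mean
    -- `r² ≤ 64 bad`, and `576 = 9 · 64`.
    high-bad-weight : ∀ {R r bad} → Fair N m k R r → r * r ≤ bad * 64 → r * (R ∸ H) * (N * 8) ≤ m * bad * 576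
    high-bad-weight {R} {r} {bad} f h with H ≤? R
    ... | no H≰R rewrite m≤n⇒m∸n≡0 (<⇒≤ (≰⇒> H≰R)) | *-zeroʳ r = z≤n
    ... | yes H≤R = certify (B ∷ k ∷ N ∷ R ∷ r ∷ bad ∷ R ∸ H ∷ H ∷ []) (v4 :* v6 :* (N′ :* con 8)) (m′ :* v5 :* con 576)
        ((v4 ×ʰ N′ :* v3 :* con 8 :≤ m′ :* v4 :* con 9 :+ N′ :* k′ :* con 8 ∶ Fair.upper f) ∷
         (m′ :* con 9 ×ʰ v4 :* v4 :≤ v5 :* con 64 ∶ h) ∷
         (v4 :* N′ :* con 8 ×ʰ v6 :+ v7 :≤ v3 ∶ ≤-reflexive (m∸n+n≡m H≤R)) ∷
         (v4 :* N′ :* con 8 ×ʰ k′ :≤ v7 ∶ k≤H) ∷ []) tt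

    -- Differences with many bad pairs take at most `72 · (9/8) · 129 = 10449` of the excess 17000,
    -- in units of `k N²`. Each pair with a worthy difference accounts for at most `m` of the rest,
    -- so there are enough such pairs for a fair sample to contain one.
    high-hit : ∀ {γ χ β G X} → N * N * k * 17000 ≤ γ + χ → χ * (N * 8) ≤ m * β * 576 →
               m * β * 8 ≤ N * N * (N * (θ + k) * 9) → γ ≤ G * m → Fair (N * N) m k X G → 1 ≤ X
    high-hit {γ} {χ} {β} {G} {X} h hχ hβ hγ f = positive {b = N * (N * N) * 72} X (>-nonZero⁻¹ _ {{m*n≢0 N (N * N * k) {{N≢0}} {{m*n≢0 (N * N) k {{m*n≢0 N N}}}}}})
      (certify (B ∷ k ∷ N ∷ γ ∷ χ ∷ β ∷ G ∷ X ∷ []) (N′ :* (N′ :* N′ :* k′)) (N′ :* (N′ :* N′) :* con 72 :* v7)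
        ((N′ :* con 64 ×ʰ N′ :* N′ :* k′ :* con 17000 :≤ v3 :+ v4 ∶ h) ∷
         (con 8 ×ʰ v4 :* (N′ :* con 8) :≤ m′ :* v5 :* con 576 ∶ hχ) ∷
         (con 576 ×ʰ m′ :* v5 :* con 8 :≤ N′ :* N′ :* (N′ :* (k′ :* con 128 :+ k′) :* con 9) ∶ hβ) ∷
         (N′ :* con 64 ×ʰ v3 :≤ v6 :* m′ ∶ hγ) ∷
         (N′ :* con 8 ×ʰ m′ :* v6 :* con 8 :≤ N′ :* N′ :* (v7 :+ k′) :* con 9 ∶ Fair.lower f) ∷ []) tt)

    high-big : ∀ {R r} → Fair N m k R r → H ≤ R → N * k * 33 ≤ m * r
    high-big {R} {r} f H≤R = *-cancelʳ-≤ _ _ 9 (certify (B ∷ k ∷ N ∷ R ∷ r ∷ []) (N′ :* k′ :* con 33 :* con 9) (m′ :* v4 :* con 9)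
        ((N′ :* v3 :* con 8 :≤ m′ :* v4 :* con 9 :+ N′ :* k′ :* con 8 ∶ Fair.upper f) ∷
         (N′ :* con 8 ×ʰ B′ :* k′ :* con 40960 :≤ v3 ∶ H≤R) ∷
         (N′ :* k′ :* con 327680 ×ʰ con 1 :≤ B′ ∶ 1≤B) ∷ []) tt)

    -- The margin comes from `(7/8) · (8/9) · (5/8) = 35/72`, which exceeds `(9/8) · (3/8) = 27/64`;
    -- the fractions `5/8` and `3/8` are those of `H` and `X₀`.
    high-size : ∀ {R r y} → Fair N m k R r → H ≤ R → r * 7 ≤ y * 8 → N * (X₀ + k) * 9 ≤ m * y * 8
    high-size {R} {r} {y} f H≤R h = *-cancelʳ-≤ _ _ 9
      (certify (B ∷ k ∷ N ∷ R ∷ r ∷ y ∷ []) (N′ :* (B′ :* k′ :* con 24576 :+ k′) :* con 9 :* con 9) (m′ :* v5 :* con 8 :* con 9)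
        ((con 7 ×ʰ N′ :* v3 :* con 8 :≤ m′ :* v4 :* con 9 :+ N′ :* k′ :* con 8 ∶ Fair.upper f) ∷
         (m′ :* con 9 ×ʰ v4 :* con 7 :≤ v5 :* con 8 ∶ h) ∷
         (N′ :* con 56 ×ʰ B′ :* k′ :* con 40960 :≤ v3 ∶ H≤R) ∷
         (N′ :* k′ :* con 200 ×ʰ con 1 :≤ B′ ∶ 1≤B) ∷ []) tt)

    high-accept : ∀ {X y} → N * (X₀ + k) * 9 ≤ m * y * 8 → Fair N m k X y → X₀ ≤ X
    high-accept {X} {y} h f = +-cancelʳ-≤ k _ _ (*-cancelˡ-≤ N (*-cancelʳ-≤ _ _ 9 (≤-trans h (Fair.lower f))))

    module _ {D : ℕ} (D₀≤D : D₀ ≤ D) where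
      private
        u : ℕ
        u = D ∸ k
        k≤D₀ : k * 49152 ≤ D
        k≤D₀ = certify (B ∷ k ∷ D ∷ []) (v1 :* con 49152) v2
          ((v0 :* v1 :* con 49152 :≤ v2 ∶ D₀≤D) ∷ (v1 :* con 49152 ×ʰ con 1 :≤ v0 ∶ 1≤B) ∷ []) tt
        D≡ : D ≡ u + k
        D≡ = sym (m∸n+n≡m (≤-trans (m≤m*n k 49152) k≤D₀))
        D≤u+k : D ≤ u + k
        D≤u+k = ≤-reflexive D≡

      -- The mean of the degrees deg(a) = |{x ∈ S : a + x ∈ Q}| over a ∈ S is at
      -- least target / (9 m).
      target : ℕ
      target = N * (D ∸ k) * 8

      low-mean : ∀ {Δ} → Fair (N * N) m k D Δ → N * target ≤ m * Δ * 9
      low-mean {Δ} f = certify (B ∷ k ∷ N ∷ D ∷ Δ ∷ D ∸ k ∷ []) (N′ :* (N′ :* v5 :* con 8)) (m′ :* v4 :* con 9)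
        ((N′ :* N′ :* v3 :* con 8 :≤ m′ :* v4 :* con 9 :+ N′ :* N′ :* k′ :* con 8 ∶ Fair.upper f) ∷
         (N′ :* N′ :* con 8 ×ʰ v5 :+ k′ :≤ v3 ∶ ≤-reflexive (sym D≡)) ∷ []) tt

      -- In units of `N³ D²` and up to lower order terms, the gain is `15 · 64 = 960` and the loss
      -- through bad pairs is `331776 · 9 / 8192 = 364.5`. The remainder forces many worthy centres,
      -- since each contributes at most `(9 m N)²`.
      low-hit : ∀ {β g G X} → N * target * target * 15 ≤ g * 64 + m * m * β * 331776 →
                m * m * β * 8192 ≤ N * N * (N * (D * D + m * k * 1024) * 9) →
                g ≤ G * (m * N * 9 * (m * N * 9)) → Fair N m k X G → 1 ≤ X
      low-hit {β} {g} {G} {X} h hβ hg f = positive {b = m * N * N * N * 373248} X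
        (>-nonZero⁻¹ _ {{m*n≢0 (m * N * N * N) k {{m*n≢0 (m * N * N) N {{m*n≢0 (m * N) N {{m*n≢0 m N}}}}}}}})
        (certify (B ∷ k ∷ N ∷ D ∷ β ∷ g ∷ G ∷ X ∷ D ∸ k ∷ []) (m′ :* N′ :* N′ :* N′ :* k′) (m′ :* N′ :* N′ :* N′ :* con 373248 :* v7)
          ((con 8 ×ʰ N′ :* (N′ :* v8 :* con 8) :* (N′ :* v8 :* con 8) :* con 15 :≤ v5 :* con 64 :+ m′ :* m′ :* v4 :* con 331776 ∶ h) ∷
           (con 324 ×ʰ m′ :* m′ :* v4 :* con 8192 :≤ N′ :* N′ :* (N′ :* (v3 :* v3 :+ m′ :* k′ :* con 1024) :* con 9) ∶ hβ) ∷
           (con 512 ×ʰ v5 :≤ v6 :* (m′ :* N′ :* con 9 :* (m′ :* N′ :* con 9)) ∶ hg) ∷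
           (m′ :* N′ :* N′ :* con 5184 ×ʰ m′ :* v6 :* con 8 :≤ N′ :* (v7 :+ k′) :* con 9 ∶ Fair.lower f) ∷
           (N′ :* N′ :* N′ :* con 7680 ×ʰ v3 :* v3 :≤ (v8 :+ k′) :* (v8 :+ k′) ∶ *-mono-≤ D≤u+k D≤u+k) ∷
           (N′ :* N′ :* N′ :* k′ ×ʰ v8 :* con 15360 :≤ v3 :* con 15360 ∶ *-monoˡ-≤ 15360 (m∸n≤m D k)) ∷
           (N′ :* N′ :* N′ :* v3 ×ʰ k′ :* con 49152 :≤ v3 ∶ k≤D₀) ∷
           (N′ :* N′ :* N′ :* k′ ×ʰ k′ :* con 49152 :≤ v3 ∶ k≤D₀) ∷
           (N′ :* N′ :* N′ :* con 4000 ×ʰ B′ :* k′ :* con 49152 :* (B′ :* k′ :* con 49152) :≤ v3 :* v3 ∶ *-mono-≤ D₀≤D D₀≤D) ∷ []) tt)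

      low-big : ∀ {b} → target * 7 ≤ m * b * 9 * 8 → N * k * 33 ≤ m * b
      low-big {b} h = *-cancelʳ-≤ _ _ 72 (certify (B ∷ k ∷ N ∷ D ∷ b ∷ D ∸ k ∷ []) (N′ :* k′ :* con 33 :* con 72) (m′ :* v4 :* con 72)
        ((N′ :* v5 :* con 8 :* con 7 :≤ m′ :* v4 :* con 9 :* con 8 ∶ h) ∷
         (N′ :* con 56 ×ʰ v3 :≤ v5 :+ k′ ∶ D≤u+k) ∷
         (N′ :* con 56 ×ʰ k′ :* con 49152 :≤ v3 ∶ k≤D₀) ∷ []) tt)

      -- The margin comes from `(7/8)² · (8/9) = 49/72`, which exceeds `9/16`.
      low-size′ : ∀ {b y} → target * 7 ≤ m * b * 9 * 8 → b * 7 ≤ y * 8 → N * (D + k * 2) * 9 ≤ m * y * 16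
      low-size′ {b} {y} h hy = *-cancelʳ-≤ _ _ 72 (certify (B ∷ k ∷ N ∷ D ∷ b ∷ D ∸ k ∷ y ∷ []) (N′ :* (v3 :+ k′ :* con 2) :* con 9 :* con 72) (m′ :* v6 :* con 16 :* con 72)
        ((con 14 ×ʰ N′ :* v5 :* con 8 :* con 7 :≤ m′ :* v4 :* con 9 :* con 8 ∶ h) ∷
         (m′ :* con 144 ×ʰ v4 :* con 7 :≤ v6 :* con 8 ∶ hy) ∷
         (N′ :* con 784 ×ʰ v3 :≤ v5 :+ k′ ∶ D≤u+k) ∷
         (N′ ×ʰ k′ :* con 49152 :≤ v3 ∶ k≤D₀) ∷ []) tt)

    low-accept : ∀ {X y D} → N * (D + k * 2) * 9 ≤ m * y * 16 → Fair N m k X y → D ≤ X * 2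
    low-accept {X} {y} {D} h f = *-cancelˡ-≤ N (*-cancelʳ-≤ _ _ 9 (certify (B ∷ k ∷ N ∷ X ∷ y ∷ D ∷ []) (N′ :* v5 :* con 9) (N′ :* (v3 :* con 2) :* con 9)
        ((N′ :* (v5 :+ k′ :* con 2) :* con 9 :≤ m′ :* v4 :* con 16 ∶ h) ∷
         (con 2 ×ʰ m′ :* v4 :* con 8 :≤ N′ :* (v3 :+ k′) :* con 9 ∶ Fair.lower f) ∷ []) tt))

-- Popular sums, cleaned sets and additive energy

module Combinatorics where

  open Prelude
  open import Defs using (𝔽₂^; _⊞_; _≟_; points; Subset; elements; card; energy; _⊕_)
  open Certificates
  open Counting

  length-filter? : ∀ {A : Set} {P : A → Set} (P? : ∀ x → Dec (P x)) xs → length (filter P? xs) ≡ # xs (does ∘ P?)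
  length-filter? P? []       = refl
  length-filter? P? (x ∷ xs) with does (P? x)
  ... | true  = cong suc (length-filter? P? xs)
  ... | false = length-filter? P? xs

  module _ {n : ℕ} where

    shifts : Subset n → 𝔽₂^ n → ℕ
    shifts A w = # (points n) λ z → A z ∧ A (w ⊞ z)

    -- The representation counts `shifts A w` sum to `|A|²` over all `w`.
    popular-few : ∀ (A W : Subset n) t s → (∀ w → T (W w) → t ≤ s * shifts A w) →
                  card W * t ≤ s * (card A * card A)
    popular-few A W t s h = begin
      card W * t                                                        ≡⟨ cong (_* t) (card≡# W) ⟩
      # (points n) W * t                                                ≡⟨ sym (∑-*ʳ (points n) (𝟙 ∘ W) t) ⟩
      ∑ (points n) (λ w → 𝟙 (W w) * t)                                  ≤⟨ ∑-mono (points n) (λ w → pointwise (W w) (h w)) ⟩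
      ∑ (points n) (λ w → s * shifts A w)                              ≡⟨ ∑-*ˡ (points n) (shifts A) s ⟩
      s * ∑ (points n) (shifts A)                                      ≡⟨ cong (s *_) total ⟩
      s * (card A * card A)                                             ∎
      where
      open ≤-Reasoning
      pointwise : ∀ b {y} → (T b → t ≤ y) → 𝟙 b * t ≤ y
      pointwise true  h = ≤-trans (≤-reflexive (*-identityˡ t)) (h tt)
      pointwise false h = z≤n
      total : ∑ (points n) (shifts A) ≡ card A * card A
      total = trans (∑-swap (points n) (points n) _) (trans (∑-cong (points n) λ z →
          trans (∑-cong (points n) λ w → 𝟙-∧ (A z) (A (w ⊞ z)))
            (trans (∑-*ˡ (points n) _ (𝟙 (A z))) (cong (𝟙 (A z) *_)
              (trans (∑-cong (points n) λ w → cong (𝟙 ∘ A) (⊞-comm w z)) (∑-shift z (𝟙 ∘ A))))))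
        (trans (∑-*ʳ (points n) (𝟙 ∘ A) (# (points n) A)) (cong₂ _*_ (sym (card≡# A)) (sym (card≡# A)))))

    ∈-⊕ : ∀ (A B : Subset n) w → T ((A ⊕ B) w) → ∃[ s ] ∃[ t ] T (A s) × T (B t) × s ⊞ t ≡ w
    ∈-⊕ A B w h with any? (λ s → any? (λ t → (s ⊞ t) ≟ w) (elements B)) (elements A)
    ... | yes p with find p
    ... | s , s∈ , q with find q
    ... | t , t∈ , e = s , t , ∈-elements A s s∈ , ∈-elements B t t∈ , e

    -- Two points of Y have common good partners y in B; each yields a
    -- representation (x + y) + (y + x′) of their sum by elements of Z.
    cleaned-sumset : ∀ (Y B Z : Subset n) →
      (∀ x → T (Y x) → # (points n) (λ y → B y ∧ not (Z (x ⊞ y))) * 10 ≤ card B * 3) →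
      card (Y ⊕ Y) * card B * 2 ≤ card Z * card Z * 5
    cleaned-sumset Y B Z h =
      certify (card (Y ⊕ Y) ∷ card B ∷ card Z ∷ []) (v0 :* v1 :* con 2) (v2 :* v2 :* con 5)
        ((v0 :* (v1 :* con 2) :≤ con 5 :* (v2 :* v2) ∶ popular-few Z (Y ⊕ Y) (card B * 2) 5 representations) ∷ []) tt
      where
      representations : ∀ w → T ((Y ⊕ Y) w) → card B * 2 ≤ 5 * shifts Z w
      representations w w∈ with ∈-⊕ Y Y w w∈
      ... | s , t , Ys , Yt , refl =
        *-cancelʳ-≤ _ _ 2 (certify (card B ∷ shifts Z (s ⊞ t) ∷ # (points n) (misses s) ∷ # (points n) (misses t) ∷ # (points n) both ∷ []) (v0 :* con 2 :* con 2) (con 5 :* v1 :* con 2)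
          ((con 10 ×ʰ v0 :≤ v4 :+ v2 :+ v3 ∶ cover) ∷ (con 10 ×ʰ v4 :≤ v1 ∶ shifted) ∷
           (v2 :* con 10 :≤ v0 :* con 3 ∶ h s Ys) ∷ (v3 :* con 10 :≤ v0 :* con 3 ∶ h t Yt) ∷ []) tt)
        where
        misses : 𝔽₂^ n → Subset n
        misses x y = B y ∧ not (Z (x ⊞ y))
        both : Subset n
        both y = Z (s ⊞ y) ∧ Z (t ⊞ y)
        cover : card B ≤ # (points n) both + # (points n) (misses s) + # (points n) (misses t)
        cover = ≤-trans (≤-reflexive (card≡# B)) (≤-trans (∑-mono (points n) λ y → lemma (B y) (Z (s ⊞ y)) (Z (t ⊞ y)))
          (≤-reflexive (trans (∑-+ (points n) _ _) (cong (_+ # (points n) (misses t)) (∑-+ (points n) _ _)))))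
          where
          lemma : ∀ b y z → 𝟙 b ≤ 𝟙 (y ∧ z) + 𝟙 (b ∧ not y) + 𝟙 (b ∧ not z)
          lemma false y     z     = z≤n
          lemma true  true  true  = ≤-refl
          lemma true  true  false = ≤-refl
          lemma true  false z     = s≤s z≤n
        -- Substitute `z = s + y`; then `(s + t) + z = t + y`.
        shifted : # (points n) both ≤ shifts Z (s ⊞ t)
        shifted = ≤-reflexive (trans
          (∑-cong (points n) λ y → cong (λ v → 𝟙 (Z (s ⊞ y) ∧ Z v)) (sym (trans (cong (_⊞ (s ⊞ y)) refl) (⊞-triangle s t y))))
          (∑-shift s (λ z → 𝟙 (Z z ∧ Z (s ⊞ t ⊞ z)))))

    badTotal : Subset n → (𝔽₂^ n → 𝔽₂^ n → Bool) → ℕ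
    badTotal B g = ∑ (points n) λ x → 𝟙 (B x) * # (points n) (λ y → B y ∧ not (g x y))

    -- By Markov's inequality at most 1/8 of the points of `B` have more than `|B| / 8` bad
    -- partners, as there are at most `|B|² / 64` bad pairs in all.
    cleaning-keeps-most : ∀ (Y B : Subset n) g → badTotal B g * 64 ≤ card B * card B →
      (∀ x → T (B x) → # (points n) (λ y → B y ∧ not (g x y)) * 8 ≤ card B → T (Y x)) →
      card B * 7 ≤ card Y * 8
    cleaning-keeps-most Y B g few h with card B in e
    ... | zero  = z≤n
    ... | suc _ = certify (b ∷ card Y ∷ # (points n) rejected ∷ []) (v0 :* con 7) (v1 :* con 8)
        ((con 8 ×ʰ v0 :≤ v1 :+ v2 ∶ cover) ∷ (v2 :* con 8 :≤ v0 ∶ rejected-few) ∷ []) tt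
      where
      b = suc _
      bad : 𝔽₂^ n → ℕ
      bad x = # (points n) λ y → B y ∧ not (g x y)
      rejected : Subset n
      rejected x = B x ∧ not (bad x * 8 ≤ᵇ b)
      cover : b ≤ card Y + # (points n) rejected
      cover = ≤-trans (≤-reflexive (trans (sym e) (card≡# B)))
        (≤-trans (∑-mono (points n) λ x → lemma (B x) (bad x * 8 ≤ᵇ b) λ Bx ok → h x Bx (≤ᵇ⇒≤ (bad x * 8) b ok))
          (≤-reflexive (trans (∑-+ (points n) _ _) (cong (_+ # (points n) rejected) (sym (card≡# Y))))))
        where
        lemma : ∀ p q {y} → (T p → T q → T y) → 𝟙 p ≤ 𝟙 y + 𝟙 (p ∧ not q)
        lemma false q     f = z≤n
        lemma true  false f = m≤n+m 1 _
        lemma true  true  f = ≤-trans (≤-reflexive (sym (𝟙-T (f tt tt)))) (m≤m+n _ _)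
      weighted : # (points n) rejected * b ≤ badTotal B g * 8
      weighted = ≤-trans (≤-reflexive (sym (∑-*ʳ (points n) _ b)))
        (≤-trans (∑-mono (points n) λ x → lemma (B x) (bad x))
          (≤-reflexive (∑-*ʳ (points n) _ 8)))
        where
        lemma : ∀ p c → 𝟙 (p ∧ not (c * 8 ≤ᵇ b)) * b ≤ 𝟙 p * c * 8
        lemma false c = z≤n
        lemma true  c with c * 8 ≤ᵇ b in q
        ... | true  = z≤n
        ... | false = ≤-trans (≤-reflexive (+-identityʳ b)) (≤-trans (<⇒≤ (≰⇒> λ le → subst T q (≤⇒≤ᵇ le)))
                        (≤-reflexive (cong (_* 8) (sym (+-identityʳ c)))))
      rejected-few : # (points n) rejected * 8 ≤ b
      rejected-few = *-cancelʳ-≤ _ _ b (*-cancelʳ-≤ _ _ 8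
        (certify (b ∷ # (points n) rejected ∷ badTotal B g ∷ []) (v1 :* con 8 :* v0 :* con 8) (v0 :* v0 :* con 8)
          ((con 64 ×ʰ v1 :* v0 :≤ v2 :* con 8 ∶ weighted) ∷ (con 8 ×ʰ v2 :* con 64 :≤ v0 :* v0 ∶ few) ∷ []) tt))

    module _ (S : Subset n) where
      private
        E : List (𝔽₂^ n)
        E = elements S

      reps : 𝔽₂^ n → ℕ
      reps d = # E λ s → S (d ⊞ s)

      reps≡shifts : ∀ d → reps d ≡ shifts S d
      reps≡shifts d = #-elements S _

      #-⊆ : ∀ p → (∀ x → T (p x) → T (S x)) → # E p ≡ card p
      #-⊆ p h = trans (#-elements S p) (trans (#-cong (points n) λ x → lemma (S x) (p x) (h x)) (sym (card≡# p)))
        where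
        lemma : ∀ a b → (T b → T a) → a ∧ b ≡ b
        lemma true  b     h = refl
        lemma false true  h = ⊥-elim (h tt)
        lemma false false h = refl

      -- A difference `d` comes from `reps d` pairs. This weighting links counts of sampled pairs
      -- with counts of differences.
      ∑-pairs : ∀ (g : 𝔽₂^ n → ℕ) → ∑ E (λ s → ∑ E λ t → g (s ⊞ t)) ≡ ∑ (points n) (λ d → reps d * g d)
      ∑-pairs g = begin
        ∑ E (λ s → ∑ E λ t → g (s ⊞ t))                          ≡⟨ ∑-cong E inner ⟩
        ∑ E (λ s → ∑ (points n) λ d → 𝟙 (S (s ⊞ d)) * g d)       ≡⟨ ∑-swap E (points n) (λ s d → 𝟙 (S (s ⊞ d)) * g d) ⟩
        ∑ (points n) (λ d → ∑ E λ s → 𝟙 (S (s ⊞ d)) * g d)       ≡⟨ ∑-cong (points n) (λ d → ∑-*ʳ E (λ s → 𝟙 (S (s ⊞ d))) (g d)) ⟩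
        ∑ (points n) (λ d → ∑ E (λ s → 𝟙 (S (s ⊞ d))) * g d)     ≡⟨ ∑-cong (points n) (λ d → cong (_* g d) (#-cong E λ s → cong S (⊞-comm s d))) ⟩
        ∑ (points n) (λ d → reps d * g d)                        ∎
        where
        open ≡-Reasoning
        inner : ∀ s → ∑ E (λ t → g (s ⊞ t)) ≡ ∑ (points n) (λ d → 𝟙 (S (s ⊞ d)) * g d)
        inner s = trans (∑-elements S (λ t → g (s ⊞ t)))
          (trans (∑-cong (points n) λ t → cong (λ v → 𝟙 (S v) * g (s ⊞ t)) (sym (⊞-cancel s t)))
            (∑-shift s (λ d → 𝟙 (S (s ⊞ d)) * g d)))

      -- Three coordinates of an additive quadruple determine the fourth, and the condition left is
      -- that it lies in `S`.
      energy≡∑reps : energy S ≡ ∑ E λ s → ∑ E λ t → reps (s ⊞ t)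
      energy≡∑reps = trans (length-filter? _ (cartesianProduct pairs pairs))
        (trans (∑-cartesianProduct pairs pairs _) (trans (∑-cartesianProduct E E _)
          (∑-cong E λ s → ∑-cong E λ t → trans (∑-cartesianProduct E E _) (∑-cong E λ u → fourth (s ⊞ t) u))))
        where
        pairs = cartesianProduct E E
        fourth : ∀ d u → # E (λ v → does (d ≟ u ⊞ v)) ≡ 𝟙 (S (d ⊞ u))
        fourth d u = begin
          # E (λ v → does (d ≟ u ⊞ v))                              ≡⟨ ∑-elements S (λ v → 𝟙 (does (d ≟ u ⊞ v))) ⟩
          ∑ (points n) (λ v → 𝟙 (S v) * 𝟙 (does (d ≟ u ⊞ v)))       ≡⟨ ∑-cong (points n) (λ v → *-comm (𝟙 (S v)) (𝟙 (does (d ≟ u ⊞ v)))) ⟩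
          ∑ (points n) (λ v → 𝟙 (does (d ≟ u ⊞ v)) * 𝟙 (S v))       ≡⟨ ∑-cong (points n) (λ v → cong (λ b → 𝟙 b * 𝟙 (S v)) (flip-sides v)) ⟩
          ∑ (points n) (λ v → 𝟙 (does (d ⊞ u ≟ v)) * 𝟙 (S v))       ≡⟨ ∑-delta (d ⊞ u) (𝟙 ∘ S) ⟩
          𝟙 (S (d ⊞ u))                                             ∎
          where
          open ≡-Reasoning
          flip-sides : ∀ v → does (d ≟ u ⊞ v) ≡ does (d ⊞ u ≟ v)
          flip-sides v = does-≟-⇔ {a = d} {u ⊞ v} {d ⊞ u} {v}
            (λ e → trans (⊞-comm d u) (trans (cong (u ⊞_) e) (⊞-cancel u v)))
            (λ e → trans (sym (⊞-cancel u d)) (cong (u ⊞_) (trans (⊞-comm u d) e)))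

-- The cleaned sets and the search, relative to an oracle

module Algorithms where

  open Prelude
  open import Defs using (𝔽₂^; _⊞_; Subset)
  open Counting using (#)
  open Arithmetic using (module Parameters)

  -- The centre d or a of a branch with its thresholds: θ for the number of
  -- representations, respectively j for the popularity of a difference and D
  -- for the number of sampled pairs with a popular difference.
  data Candidate (n : ℕ) : Set where
    high : (d : 𝔽₂^ n) (θ : ℕ) → Candidate n
    low  : (a : 𝔽₂^ n) (j D : ℕ) → Candidate n

  -- `O` is an arbitrary indicator, so the same predicates can be evaluated on `S` in the analysis
  -- and on a table of answered queries in the algorithm.
  module Membership {n : ℕ} (O : Subset n) (w₁ w₂ w₃ : List (𝔽₂^ n)) where

    hits : 𝔽₂^ n → ℕ
    hits e = # w₁ λ s → O (e ⊞ s)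

    popular : ℕ → 𝔽₂^ n → Bool
    popular j e = j ≤ᵇ hits e

    common : ℕ → 𝔽₂^ n → 𝔽₂^ n → ℕ
    common j x y = # w₂ λ l → popular j (x ⊞ l) ∧ popular j (y ⊞ l)

    base : Candidate n → Subset n
    base (high d θ)  x = O x ∧ O (d ⊞ x)
    base (low a j D) x = O x ∧ popular j (a ⊞ x)

    good : Candidate n → 𝔽₂^ n → 𝔽₂^ n → Bool
    good (high d θ)  x y = popular θ (x ⊞ y)
    -- The sampled density of common neighbours is at least `δ² / 1024`, where `δ` is the sampled
    -- density `D / length w₂`.
    good (low a j D) x y = D * D ≤ᵇ length w₂ * common j x y * 1024

    clean : Candidate n → Subset n
    clean c x = base c x ∧ (# w₃ (λ y → base c y ∧ not (good c x y)) * 5 ≤ᵇ # w₃ (base c))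

  module Search {n : ℕ} (O : Subset n) (B k : ℕ) (ω₁ ω₂ ω₃ ω₄ : List (𝔽₂^ n × 𝔽₂^ n)) where

    w₁ w₂ w₃ w₄ : List (𝔽₂^ n)
    w₁ = map proj₁ ω₁
    w₂ = map proj₁ ω₂
    w₃ = map proj₁ ω₃
    w₄ = map proj₁ ω₄

    open Membership O w₁ w₂ w₃ public
    open Parameters B k

    popularPairs : ℕ → ℕ
    popularPairs j = # ω₂ λ (s , t) → popular j (s ⊞ t)

    accept : Candidate n → Bool
    accept c@(high d θ)  = X₀ ≤ᵇ # w₄ (clean c)
    -- The third condition says `δ ≥ (J / m)² / τ²`, with `j (j + 1)` instead of `j²` so that the
    -- opposite inequality can be summed over the levels by telescoping.
    accept c@(low a j D) = (J ≤ᵇ j) ∧ (D₀ ≤ᵇ D) ∧ (m * J * J ≤ᵇ D * j * suc j) ∧ (D ≤ᵇ # w₄ (clean c) * 2)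

    candidates : List (Candidate n)
    candidates = map (λ (s , t) → high (s ⊞ t) θ) ω₄
      ++ concatMap (λ j → let D = popularPairs j in map (λ a → low a j D) w₄) (upTo (suc m))

    accepted : List (Candidate n)
    accepted = filterᵇ accept candidates

-- Accepted candidates are sound when all samples are fair

module Soundness where

  open Prelude
  open import Defs using (𝔽₂^; _⊞_; points; Subset; elements; card; _⊕_)
  open Counting
  open Arithmetic
  open Combinatorics
  open TailBounds using (T-∧⁻)
  open Algorithms

  not-T : ∀ {a b} → (T a → T b) → T (not b) → T (not a)
  not-T {false}         f h = tt
  not-T {true}  {false} f h = ⊥-elim (f tt)

  ∧-mapʳ : ∀ a {b c} → (T b → T c) → T (a ∧ b) → T (a ∧ c)
  ∧-mapʳ true f h = f h

  module Trial {n : ℕ} (S : Subset n) (B k : ℕ) (ω₁ ω₂ ω₃ ω₄ : List (𝔽₂^ n × 𝔽₂^ n)) where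

    open Parameters B k public
    open Search S B k ω₁ ω₂ ω₃ ω₄ public

    E : List (𝔽₂^ n)
    E = elements S

    N : ℕ
    N = card S

    -- Every candidate that some fourth sample could propose. The first two samples determine this
    -- collection, so the last two can be tested against all of it.
    data Admissible : Candidate n → Set where
      high : ∀ d → Admissible (high d θ)
      low  : ∀ a {j} → j ≤ m → Admissible (low a j (popularPairs j))

    -- By the margin in worthy, every fair sample shows that clean c is large enough.
    worthy : Candidate n → Bool
    worthy c@(high d θ)  = N * (X₀ + k) * 9 ≤ᵇ m * card (clean c) * 8
    worthy c@(low a j D) = N * (D + k * 2) * 9 ≤ᵇ m * card (clean c) * 16

    record AllFair : Set where
      field
        length₁ : length w₁ ≡ m
        length₂ : length w₂ ≡ m
        fair-hits    : ∀ e → Fair N m k (hits e) (reps S e)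
        fair-common  : ∀ {j} → j ≤ m → ∀ x y → Fair N m k (common j x y) (# E λ l → popular j (x ⊞ l) ∧ popular j (y ⊞ l))
        fair-pairs   : ∀ {j} → j ≤ m → Fair (N * N) m k (popularPairs j) (∑ E λ s → ∑ E λ t → 𝟙 (popular j (s ⊞ t)))
        fair-base    : ∀ {c} → Admissible c → Fair N m k (# w₃ (base c)) (# E (base c))
        fair-bad     : ∀ {c} → Admissible c → ∀ x →
                       Fair N m k (# w₃ λ y → base c y ∧ not (good c x y)) (# E λ y → base c y ∧ not (good c x y))
        fair-clean   : ∀ {c} → Admissible c → Fair N m k (# w₄ (clean c)) (# E (clean c))
        fair-high    : Fair (N * N) m k (# ω₄ λ (s , t) → worthy (high (s ⊞ t) θ)) (∑ E λ s → ∑ E λ t → 𝟙 (worthy (high (s ⊞ t) θ)))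
        fair-low     : ∀ {j} → j ≤ m → Fair N m k (# w₄ λ a → worthy (low a j (popularPairs j))) (# E λ a → worthy (low a j (popularPairs j)))

    base⊆S : ∀ c x → T (base c x) → T (S x)
    base⊆S (high d θ)  x h = proj₁ (T-∧⁻ {S x} h)
    base⊆S (low a j D) x h = proj₁ (T-∧⁻ {S x} h)

    clean⊆base : ∀ c x → T (clean c x) → T (base c x)
    clean⊆base c x h = proj₁ (T-∧⁻ {base c x} h)

    module _ (1≤B : 1 ≤ B) (1≤k : 1 ≤ k) (1≤N : 1 ≤ N) (fairness : AllFair) where
      open AllFair fairness
      open Scale B k N 1≤B 1≤k 1≤N

      fair-card : ∀ {c} → Admissible c → Fair N m k (# w₄ (clean c)) (card (clean c))
      fair-card {c} adm = subst (Fair N m k _) (#-⊆ S (clean c) λ x h → base⊆S c x (clean⊆base c x h)) (fair-clean adm)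

      bad≡ : ∀ c x → # E (λ y → base c y ∧ not (good c x y)) ≡ # (points n) (λ y → base c y ∧ not (good c x y))
      bad≡ c x = trans (#-⊆ S _ λ y h → base⊆S c y (proj₁ (T-∧⁻ {base c y} h))) (card≡# {n} _)

      fair-base′ : ∀ {c} → Admissible c → Fair N m k (# w₃ (base c)) (card (base c))
      fair-base′ {c} adm = subst (Fair N m k _) (#-⊆ S (base c) (base⊆S c)) (fair-base adm)

      fair-bad′ : ∀ {c} → Admissible c → ∀ x →
        Fair N m k (# w₃ λ y → base c y ∧ not (good c x y)) (# (points n) λ y → base c y ∧ not (good c x y))
      fair-bad′ {c} adm x = subst (Fair N m k _) (bad≡ c x) (fair-bad adm x)

      -- A cleaned point has passed the sampled test, so `clean-sound` bounds its true number of bad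
      -- partners. The base is large enough for that lemma because it contains the cleaned set.
      sumset : ∀ {c} → Admissible c → (Z : Subset n) → (∀ x y → T (good c x y) → T (Z (x ⊞ y))) →
               N * 42 ≤ B * card (clean c) * 128 →
               card (clean c ⊕ clean c) * card (base c) * 2 ≤ card Z * card Z * 5
      sumset {c} adm Z good⇒Z size = cleaned-sumset (clean c) (base c) Z λ x h →
        ≤-trans (*-monoˡ-≤ 10 (#-mono (points n) λ y → ∧-mapʳ (base c y) (not-T (good⇒Z x y))))
          (clean-sound (fair-bad′ adm x) (fair-base′ adm) (≤ᵇ⇒≤ _ _ (proj₂ (T-∧⁻ {base c x} h)))
            (big-base (≤-trans size (*-monoˡ-≤ 128 (*-monoʳ-≤ B (card-mono (clean c) (base c) (clean⊆base c))))))
            1≤m)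

      high-sound : ∀ d → let Y = clean (high d θ) in X₀ ≤ # w₄ Y →
        N * 42 ≤ B * card Y * 128 × card (Y ⊕ Y) * 9 ≤ B * B * B * B * B * B * card Y * 134217728
      high-sound d h = size , high-doubling {z = card Z} {b = card (base c)} {s = card (Y ⊕ Y)}
          (popular-few S Z (N * 1016) (B * B * 589824) λ w pw →
            subst (λ r → N * 1016 ≤ B * B * 589824 * r) (reps≡shifts S w) (high-popular (fair-hits w) (≤ᵇ⇒≤ _ _ pw)))
          size (card-mono Y (base c) (clean⊆base c)) (sumset (high d) Z (λ _ _ g → g) size)
        where
        c = high d θ
        Y = clean c
        Z = popular θ
        size = size-from-sample (fair-card (high d)) h

      low-sound : ∀ a {j} → j ≤ m → let D = popularPairs j ; Y = clean (low a j D) in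
        J ≤ j → D₀ ≤ D → m * J * J ≤ D * j * suc j → D ≤ # w₄ Y * 2 →
        N * 42 ≤ B * card Y * 128 × card (Y ⊕ Y) * 9 ≤ B * B * B * B * B * B * B * B * card Y * 2305843009213693952
      low-sound a {j} j≤m J≤j D₀≤D level D≤2X = size , low-doubling {z = card Z} {q = card Q} {b = card (base c)} {s = card (Y ⊕ Y)} {j = j} 1≤j 1≤D
          (popular-few Q Z (N * D * D * 7) (m * m * 9216) λ w zw → ≤ᵇ⇒≤ _ _ zw)
          (low-differences {q = card Q} {j = j} (fair-pairs j≤m) few D₀≤D)
          level (low-size (fair-card adm) D≤2X D₀≤D) size (card-mono Y (base c) (clean⊆base c))
          (sumset adm Z good⇒Z size)
        where
        D = popularPairs j
        c = low a j D
        adm = low a j≤m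
        Y = clean c
        Q = popular j
        -- The elements with many representations as a sum of two members of `Q`. A good pair yields
        -- them through its common neighbours: `x + y = (x + l) + (l + y)`.
        Z : Subset n
        Z w = N * D * D * 7 ≤ᵇ m * m * 9216 * shifts Q w
        1≤j : 1 ≤ j
        1≤j = ≤-trans (≤-trans 1≤k (m≤m*n k 1024)) J≤j
        1≤D : 1 ≤ D
        1≤D = ≤-trans (*-mono-≤ (*-mono-≤ 1≤B 1≤k) (s≤s {n = 49151} z≤n)) D₀≤D
        size : N * 42 ≤ B * card Y * 128
        size = size-from-sample (fair-card adm) (low-enough D≤2X D₀≤D)
        few : card Q * (N * j * 8184) ≤ m * 9216 * ∑ E (λ s → ∑ E λ t → 𝟙 (Q (s ⊞ t)))
        few = begin
          card Q * (N * j * 8184)                                  ≡⟨ cong (_* (N * j * 8184)) (card≡# Q) ⟩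
          # (points n) Q * (N * j * 8184)                          ≡⟨ sym (∑-*ʳ (points n) (𝟙 ∘ Q) (N * j * 8184)) ⟩
          ∑ (points n) (λ e → 𝟙 (Q e) * (N * j * 8184))            ≤⟨ ∑-mono (points n) (λ e → 𝟙-*-mono (Q e) λ Qe →
                                                                        low-popular (fair-hits e) (≤ᵇ⇒≤ _ _ Qe) J≤j) ⟩
          ∑ (points n) (λ e → 𝟙 (Q e) * (m * 9216 * reps S e))     ≡⟨ ∑-cong (points n) (λ e → rearrange (𝟙 (Q e)) (m * 9216) (reps S e)) ⟩
          ∑ (points n) (λ e → m * 9216 * (reps S e * 𝟙 (Q e)))     ≡⟨ ∑-*ˡ (points n) (λ e → reps S e * 𝟙 (Q e)) (m * 9216) ⟩
          m * 9216 * ∑ (points n) (λ e → reps S e * 𝟙 (Q e))       ≡⟨ cong (m * 9216 *_) (sym (∑-pairs S (𝟙 ∘ Q))) ⟩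
          m * 9216 * ∑ E (λ s → ∑ E λ t → 𝟙 (Q (s ⊞ t)))           ∎
          where
          open ≤-Reasoning
          rearrange : ∀ a b c → a * (b * c) ≡ b * (c * a)
          rearrange a b c = trans (*-comm a (b * c)) (*-assoc b c a)
        good⇒Z : ∀ x y → T (good c x y) → T (Z (x ⊞ y))
        good⇒Z x y g = ≤⇒≤ᵇ (≤-trans (low-common (fair-common j≤m x y) (subst (λ l → D * D ≤ l * common j x y * 1024) length₂ (≤ᵇ⇒≤ _ _ g)) D₀≤D)
          (*-monoʳ-≤ (m * m * 9216) (≤-trans (≤-trans (≤-reflexive (#-elements S _)) (#-mono (points n) λ l → proj₂ ∘ T-∧⁻ {S l}))
            (≤-reflexive translate))))
          where
          translate : # (points n) (λ l → Q (x ⊞ l) ∧ Q (y ⊞ l)) ≡ shifts Q (x ⊞ y)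
          translate = trans (#-cong (points n) λ l → cong (λ v → Q (x ⊞ l) ∧ Q v) (sym (⊞-triangle x y l)))
            (∑-shift x (λ z → 𝟙 (Q z ∧ Q (x ⊞ y ⊞ z))))

-- A worthy centre exists at every dense level

module LowBranch where

  open Prelude
  open import Defs using (𝔽₂^; _⊞_; points; Subset; elements; card)
  open Certificates
  open Counting
  open Arithmetic
  open Combinatorics
  open TailBounds using (T-∧⁻; T-∧⁺; not-≤ᵇ)
  open Algorithms
  open Soundness

  ∑< : ℕ → (ℕ → ℕ) → ℕ
  ∑< zero    f = 0
  ∑< (suc h) f = ∑< h f + f h

  ∑<-swap : ∀ {A : Set} (xs : List A) h (f : A → ℕ → ℕ) → ∑ xs (λ x → ∑< h (f x)) ≡ ∑< h (λ i → ∑ xs λ x → f x i)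
  ∑<-swap xs zero    f = ∑-zero xs
  ∑<-swap xs (suc h) f = trans (∑-+ xs _ _) (cong (_+ ∑ xs (λ x → f x h)) (∑<-swap xs h f))

  layer-cake : ∀ h x → h ⊓ x ≡ ∑< h (λ i → 𝟙 (suc i ≤ᵇ x))
  layer-cake zero    x = refl
  layer-cake (suc h) x with suc h ≤? x
  ... | yes p = trans (m≤n⇒m⊓n≡m p) (trans (sym (+-comm h 1))
    (cong₂ _+_ (trans (sym (m≤n⇒m⊓n≡m (<⇒≤ p))) (layer-cake h x)) (sym (𝟙-T (≤⇒≤ᵇ p)))))
  ... | no ¬p = trans (m≥n⇒m⊓n≡n (<⇒≤ (≰⇒> ¬p))) (trans (sym (+-identityʳ x))
    (cong₂ _+_ (trans (sym (m≥n⇒m⊓n≡n (≤-pred (≰⇒> ¬p)))) (layer-cake h x)) (zero-term (suc h ≤ᵇ x) (¬p ∘ ≤ᵇ⇒≤ (suc h) x))))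
    where
    zero-term : ∀ b → ¬ T b → 0 ≡ 𝟙 b
    zero-term true  f = ⊥-elim (f tt)
    zero-term false f = refl

  am-gm : ∀ a b → a * b * 2 ≤ a * a + b * b
  am-gm a b with ≤-total a b
  ... | inj₁ a≤b with m≤n⇒∃[o]m+o≡n a≤b
  ...   | d , refl = poly-≤ (a ∷ d ∷ []) (v0 :* (v0 :+ v1) :* con 2) (v0 :* v0 :+ (v0 :+ v1) :* (v0 :+ v1)) tt
  am-gm a b | inj₂ b≤a with m≤n⇒∃[o]m+o≡n b≤a
  ...   | d , refl = poly-≤ (b ∷ d ∷ []) ((v0 :+ v1) :* v0 :* con 2) ((v0 :+ v1) :* (v0 :+ v1) :+ v0 :* v0) tt

  module _ {n : ℕ} (S : Subset n) where
    private
      E : List (𝔽₂^ n)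
      E = elements S

    ∑∑ : (𝔽₂^ n → 𝔽₂^ n → ℕ) → ℕ
    ∑∑ f = ∑ E λ s → ∑ E λ t → f s t

    ∑∑-mono : ∀ {f g} → (∀ s t → f s t ≤ g s t) → ∑∑ f ≤ ∑∑ g
    ∑∑-mono h = ∑-mono E λ s → ∑-mono E (h s)

    ∑∑-+ : ∀ f g → ∑∑ (λ s t → f s t + g s t) ≡ ∑∑ f + ∑∑ g
    ∑∑-+ f g = trans (∑-cong E λ s → ∑-+ E (f s) (g s)) (∑-+ E _ _)

    ∑∑-*ʳ : ∀ f c → ∑∑ (λ s t → f s t * c) ≡ ∑∑ f * c
    ∑∑-*ʳ f c = trans (∑-cong E λ s → ∑-*ʳ E (f s) c) (∑-*ʳ E _ c)

    ∑∑-*ˡ : ∀ f c → ∑∑ (λ s t → c * f s t) ≡ c * ∑∑ f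
    ∑∑-*ˡ f c = trans (∑-cong E λ s → ∑-*ˡ E (f s) c) (∑-*ˡ E _ c)

    ∑∑-const : ∀ c → ∑∑ (λ _ _ → c) ≡ card S * card S * c
    ∑∑-const c = trans (∑-cong E λ s → ∑-const E c) (trans (∑-const E (card S * c)) (sym (*-assoc (card S) (card S) c)))

    -- Double counting: a bad pair is counted once for each set that contains both points. For
    -- neighbourhoods this number counts common neighbours, for fibres it is the representation
    -- count of `x + y`.
    ∑-badTotal : ∀ {I : Set} (is : List I) (q : I → Subset n) g →
      ∑ is (λ i → badTotal (λ x → S x ∧ q i x) g) ≡ ∑∑ λ x y → 𝟙 (not (g x y)) * # is (λ i → q i x ∧ q i y)
    ∑-badTotal is q g = begin
      ∑ is (λ i → badTotal (λ x → S x ∧ q i x) g)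
        ≡⟨ ∑-cong is unfold ⟩
      ∑ is (λ i → ∑∑ λ x y → 𝟙 (not (g x y)) * 𝟙 (q i x ∧ q i y))
        ≡⟨ ∑-swap is E _ ⟩
      ∑ E (λ x → ∑ is λ i → ∑ E λ y → 𝟙 (not (g x y)) * 𝟙 (q i x ∧ q i y))
        ≡⟨ ∑-cong E (λ x → ∑-swap is E _) ⟩
      ∑∑ (λ x y → ∑ is λ i → 𝟙 (not (g x y)) * 𝟙 (q i x ∧ q i y))
        ≡⟨ ∑-cong E (λ x → ∑-cong E λ y → ∑-*ˡ is (λ i → 𝟙 (q i x ∧ q i y)) (𝟙 (not (g x y)))) ⟩
      ∑∑ (λ x y → 𝟙 (not (g x y)) * # is (λ i → q i x ∧ q i y)) ∎
      where
      open ≡-Reasoning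
      boolean : ∀ s q r g → 𝟙 q * 𝟙 ((s ∧ r) ∧ not g) ≡ 𝟙 s * (𝟙 (not g) * 𝟙 (q ∧ r))
      boolean false false r     g     = refl
      boolean false true  r     g     = refl
      boolean true  false r     true  = refl
      boolean true  false r     false = refl
      boolean true  true  true  true  = refl
      boolean true  true  true  false = refl
      boolean true  true  false true  = refl
      boolean true  true  false false = refl
      unfold : ∀ i → badTotal (λ x → S x ∧ q i x) g ≡ ∑∑ λ x y → 𝟙 (not (g x y)) * 𝟙 (q i x ∧ q i y)
      unfold i = trans (∑-cong (points n) λ x → trans (cong (_* inner x) (𝟙-∧ (S x) (q i x))) (*-assoc (𝟙 (S x)) (𝟙 (q i x)) (inner x)))
        (trans (sym (∑-elements S (λ x → 𝟙 (q i x) * inner x))) (∑-cong E λ x →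
          trans (sym (∑-*ˡ (points n) _ (𝟙 (q i x)))) (trans (∑-cong (points n) λ y → boolean (S y) (q i x) (q i y) (g x y))
            (sym (∑-elements S _)))))
        where
        inner : 𝔽₂^ n → ℕ
        inner x = # (points n) λ y → (S y ∧ q i y) ∧ not (g x y)

  module _ {n : ℕ} (S : Subset n) (B k : ℕ) (ω₁ ω₂ ω₃ ω₄ : List (𝔽₂^ n × 𝔽₂^ n)) where
    open Trial S B k ω₁ ω₂ ω₃ ω₄

    module _ (1≤B : 1 ≤ B) (1≤k : 1 ≤ k) (1≤N : 1 ≤ N) (fairness : AllFair) where
      open AllFair fairness
      open Scale B k N 1≤B 1≤k 1≤N

      private
        fair-card′ : ∀ {c} → Admissible c → Fair N m k (# w₄ (clean c)) (card (clean c))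
        fair-card′ = fair-card 1≤B 1≤k 1≤N fairness

      keeps-most : ∀ {c} → Admissible c → badTotal (base c) (good c) * 64 ≤ card (base c) * card (base c) →
                   N * k * 33 ≤ m * card (base c) → card (base c) * 7 ≤ card (clean c) * 8
      keeps-most {c} adm few big = cleaning-keeps-most (clean c) (base c) (good c) few λ x Bx ok →
        T-∧⁺ Bx (≤⇒≤ᵇ (clean-complete (fair-bad′ 1≤B 1≤k 1≤N fairness adm x) (fair-base′ 1≤B 1≤k 1≤N fairness adm) ok big 1≤N))

      module _ {j} (j≤m : j ≤ m) (D₀≤D : D₀ ≤ popularPairs j) where
        private
          D : ℕ
          D = popularPairs j
          Q : Subset n
          Q = popular j
          c : 𝔽₂^ n → Candidate n
          c a = low a j D
          deg f bad : 𝔽₂^ n → ℕ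
          deg a = card (base (c a))
          f a   = m * deg a * 9
          bad a = badTotal (base (c a)) (good (c a))
          t Δ β : ℕ
          t = target D₀≤D
          Δ = ∑ E λ s → ∑ E λ t → 𝟙 (popular j (s ⊞ t))
          β = ∑ E bad
          nice : Subset n
          nice a = (t * 7 ≤ᵇ f a * 8) ∧ (bad a * 64 ≤ᵇ deg a * deg a)

          deg≡ : ∀ a → deg a ≡ # E λ x → Q (a ⊞ x)
          deg≡ a = trans (card≡# (base (c a))) (sym (#-elements S _))

          ∑f : ∑ E f ≡ m * Δ * 9
          ∑f = trans (∑-*ʳ E _ 9) (cong (_* 9) (trans (∑-*ˡ E deg m) (cong (m *_) (∑-cong E deg≡))))

          -- Cauchy-Schwarz in the form `2 t f ≤ f² + t²`, summed over the centres; the mean of `f`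
          -- is at least `t`.
          second-moment : N * t * t ≤ ∑ E λ a → f a * f a
          second-moment = certify (N ∷ t ∷ ∑ E f ∷ ∑ E (λ a → f a * f a) ∷ []) (v0 :* v1 :* v1) v3
            ((v1 :* v2 :* con 2 :≤ v3 :+ v0 :* (v1 :* v1) ∶ summed) ∷
             (v1 :* con 2 ×ʰ v0 :* v1 :≤ v2 ∶ ≤-trans (low-mean D₀≤D (fair-pairs j≤m)) (≤-reflexive (sym ∑f))) ∷ []) tt
            where
            summed : t * ∑ E f * 2 ≤ ∑ E (λ a → f a * f a) + N * (t * t)
            summed = begin
              t * ∑ E f * 2                       ≡⟨ cong (_* 2) (sym (∑-*ˡ E f t)) ⟩
              ∑ E (λ a → t * f a) * 2             ≡⟨ sym (∑-*ʳ E (λ a → t * f a) 2) ⟩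
              ∑ E (λ a → t * f a * 2)             ≤⟨ ∑-mono E (λ a → ≤-trans (am-gm t (f a)) (≤-reflexive (+-comm (t * t) _))) ⟩
              ∑ E (λ a → f a * f a + t * t)       ≡⟨ ∑-+ E _ _ ⟩
              ∑ E (λ a → f a * f a) + ∑ E (λ _ → t * t) ≡⟨ cong (∑ E (λ a → f a * f a) +_) (∑-const E (t * t)) ⟩
              ∑ E (λ a → f a * f a) + N * (t * t) ∎
              where open ≤-Reasoning

          nice⇒worthy : ∀ a → T (nice a) → T (worthy (c a))
          nice⇒worthy a h = ≤⇒≤ᵇ (low-size′ D₀≤D large (keeps-most (low a j≤m) few (low-big D₀≤D large)))
            where
            large : t * 7 ≤ m * deg a * 9 * 8
            large = ≤ᵇ⇒≤ _ _ (proj₁ (T-∧⁻ {t * 7 ≤ᵇ f a * 8} h))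
            few : bad a * 64 ≤ deg a * deg a
            few = ≤ᵇ⇒≤ _ _ (proj₂ (T-∧⁻ {t * 7 ≤ᵇ f a * 8} h))

          g : ℕ
          g = ∑ E λ a → 𝟙 (nice a) * (f a * f a)

          -- A centre that is not nice either has small degree, so that `64 f² ≤ 49 t²`, or has many
          -- bad pairs, so that `64 f² ≤ 81 · 4096 m² bad`. The 15 is `64 − 49`.
          split : N * t * t * 15 ≤ g * 64 + m * m * β * 331776
          split = certify (N * t * t ∷ ∑ E (λ a → f a * f a) ∷ g ∷ m * m * β ∷ []) (v0 :* con 15) (v2 :* con 64 :+ v3 :* con 331776)
            ((con 64 ×ʰ v0 :≤ v1 ∶ second-moment) ∷ (v1 :* con 64 :≤ v2 :* con 64 :+ v0 :* con 49 :+ v3 :* con 331776 ∶ summed) ∷ []) tt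
            where
            termwise : ∀ a → f a * f a * 64 ≤ 𝟙 (nice a) * (f a * f a) * 64 + t * t * 49 + m * m * bad a * 331776
            termwise a with t * 7 ≤ᵇ f a * 8 in p | bad a * 64 ≤ᵇ deg a * deg a in q
            ... | true  | true  = ≤-trans (≤-reflexive (cong (_* 64) (sym (+-identityʳ (f a * f a))))) (≤-trans (m≤m+n _ _) (m≤m+n _ _))
            ... | false | _     = ≤-trans (certify (f a ∷ t ∷ []) (v0 :* v0 :* con 64) (v1 :* v1 :* con 49)
                  (((v0 :* con 8) :* (v0 :* con 8) :≤ (v1 :* con 7) :* (v1 :* con 7) ∶ *-mono-≤ small small) ∷ []) tt) (m≤m+n _ _)
              where small = not-≤ᵇ {t * 7} {f a * 8} (subst (T ∘ not) (sym p) tt)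
            ... | true  | false = ≤-trans (certify (m ∷ deg a ∷ bad a ∷ []) (v0 :* v1 :* con 9 :* (v0 :* v1 :* con 9) :* con 64) (v0 :* v0 :* v2 :* con 331776)
                  ((con 5184 :* v0 :* v0 ×ʰ v1 :* v1 :≤ v2 :* con 64 ∶ not-≤ᵇ {bad a * 64} (subst (T ∘ not) (sym q) tt)) ∷ []) tt) (m≤n+m _ _)
            summed : ∑ E (λ a → f a * f a) * 64 ≤ g * 64 + N * t * t * 49 + m * m * β * 331776
            summed = begin
              ∑ E (λ a → f a * f a) * 64   ≡⟨ sym (∑-*ʳ E _ 64) ⟩
              ∑ E (λ a → f a * f a * 64)   ≤⟨ ∑-mono E termwise ⟩
              ∑ E (λ a → 𝟙 (nice a) * (f a * f a) * 64 + t * t * 49 + m * m * bad a * 331776)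
                ≡⟨ trans (∑-+ E _ _) (cong (_+ ∑ E (λ a → m * m * bad a * 331776)) (∑-+ E _ _)) ⟩
              ∑ E (λ a → 𝟙 (nice a) * (f a * f a) * 64) + ∑ E (λ _ → t * t * 49) + ∑ E (λ a → m * m * bad a * 331776)
                ≡⟨ cong₂ _+_ (cong₂ _+_ (∑-*ʳ E _ 64) (trans (∑-const E (t * t * 49)) eq))
                             (trans (∑-*ʳ E _ 331776) (cong (_* 331776) (∑-*ˡ E bad (m * m)))) ⟩
              g * 64 + N * t * t * 49 + m * m * β * 331776 ∎
              where
              open ≤-Reasoning
              eq : N * (t * t * 49) ≡ N * t * t * 49
              eq = trans (sym (*-assoc N (t * t) 49)) (cong (_* 49) (sym (*-assoc N t t)))

          -- A pair that is not good has few sampled common neighbours, hence few centres whose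
          -- neighbourhood contains both of its points.
          β-bound : m * m * β * 8192 ≤ N * N * (N * (D * D + m * k * 1024) * 9)
          β-bound = begin
            m * m * β * 8192                 ≡⟨ cong (λ b → m * m * b * 8192) (∑-badTotal S E (λ a x → Q (a ⊞ x)) (λ x y → good (c x) x y)) ⟩
            m * m * ∑∑ S F * 8192            ≡⟨ cong (_* 8192) (sym (∑∑-*ˡ S F (m * m))) ⟩
            ∑∑ S (λ x y → m * m * F x y) * 8192 ≡⟨ sym (∑∑-*ʳ S (λ x y → m * m * F x y) 8192) ⟩
            ∑∑ S (λ x y → m * m * F x y * 8192) ≤⟨ ∑∑-mono S termwise ⟩
            ∑∑ S (λ _ _ → N * (D * D + m * k * 1024) * 9) ≡⟨ ∑∑-const S _ ⟩
            N * N * (N * (D * D + m * k * 1024) * 9) ∎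
            where
            open ≤-Reasoning
            F : 𝔽₂^ n → 𝔽₂^ n → ℕ
            F x y = 𝟙 (not (good (c x) x y)) * # E (λ a → Q (a ⊞ x) ∧ Q (a ⊞ y))
            termwise : ∀ x y → m * m * F x y * 8192 ≤ N * (D * D + m * k * 1024) * 9
            termwise x y with good (c x) x y in p
            ... | true  = ≤-trans (≤-reflexive (cong (_* 8192) (*-zeroʳ (m * m)))) z≤n
            ... | false = ≤-trans (≤-reflexive (cong (λ z → m * m * z * 8192) (+-identityʳ P))) (certify (m ∷ P ∷ N ∷ D ∷ k ∷ common j x y ∷ []) (v0 :* v0 :* v1 :* con 8192) (v2 :* (v3 :* v3 :+ v0 :* v4 :* con 1024) :* con 9)
                ((v0 :* con 1024 ×ʰ v0 :* v1 :* con 8 :≤ v2 :* (v5 :+ v4) :* con 9 ∶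
                   subst (λ p → m * p * 8 ≤ N * (common j x y + k) * 9) (#-cong E λ a → cong₂ (λ u v → Q u ∧ Q v) (⊞-comm x a) (⊞-comm y a)) (Fair.lower (fair-common j≤m x y))) ∷
                 (v2 :* con 9 ×ʰ v0 :* v5 :* con 1024 :≤ v3 :* v3 ∶
                   subst (λ l → l * common j x y * 1024 ≤ D * D) length₂ (not-≤ᵇ {D * D} (subst (T ∘ not) (sym p) tt))) ∷ []) tt)
              where P = # E (λ a → Q (a ⊞ x) ∧ Q (a ⊞ y))

          g-bound : g ≤ # E (worthy ∘ c) * (m * N * 9 * (m * N * 9))
          g-bound = ≤-trans (∑-mono E λ a → *-mono-≤ (𝟙-mono (nice⇒worthy a)) (*-mono-≤ (f≤ a) (f≤ a)))
            (≤-reflexive (∑-*ʳ E _ (m * N * 9 * (m * N * 9))))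
            where
            f≤ : ∀ a → f a ≤ m * N * 9
            f≤ a = *-monoˡ-≤ 9 (*-monoʳ-≤ m (card-mono (base (c a)) S (base⊆S (c a))))

        worthy-centre : 1 ≤ # w₄ (λ a → worthy (low a j D))
        worthy-centre = low-hit D₀≤D split β-bound g-bound (fair-low j≤m)

      worthy-low⇒accepted : ∀ a {j} → j ≤ m → let D = popularPairs j in J ≤ j → D₀ ≤ D → m * J * J ≤ D * j * suc j →
                            T (worthy (low a j D)) → T (accept (low a j D))
      worthy-low⇒accepted a {j} j≤m J≤j D₀≤D level h =
        T-∧⁺ (≤⇒≤ᵇ J≤j) (T-∧⁺ (≤⇒≤ᵇ D₀≤D) (T-∧⁺ (≤⇒≤ᵇ level)
          (≤⇒≤ᵇ (low-accept {y = card (clean (low a j (popularPairs j)))} (≤ᵇ⇒≤ _ _ h) (fair-card′ (low a j≤m))))))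

      worthy-high⇒accepted : ∀ d → T (worthy (high d θ)) → T (accept (high d θ))
      worthy-high⇒accepted d h = ≤⇒≤ᵇ (high-accept {y = card (clean (high d θ))} (≤ᵇ⇒≤ _ _ h) (fair-card′ (high d)))

-- When all levels are poor, very popular differences carry the energy

module HighBranch where

  open Prelude
  open import Defs using (𝔽₂^; _⊞_; points; Subset; elements; card; energy)
  open Certificates
  open Counting
  open Arithmetic
  open Combinatorics
  open TailBounds using (not-≤ᵇ)
  open Algorithms
  open Soundness
  open LowBranch

  -- Telescoping 1/(i (i + 1)) = 1/i − 1/(i + 1).
  level-sum : ∀ (δ : ℕ → ℕ) {M m J c₀ A₀} → 1 ≤ J → (∀ i → δ i ≤ M) → ∀ h →
    (∀ i → J ≤ i → i < h + J → ∃[ a ] (m * δ i * 8 ≤ c₀ + a × a * i * suc i ≤ A₀)) →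
    ∃[ A ] (m * ∑< (h + J) δ * 8 ≤ m * J * M * 8 + h * c₀ + A × A * J * (h + J) ≤ A₀ * h)
  level-sum δ {M} {m} {J} {c₀} {A₀} 1≤J small zero H = 0 ,
    ≤-trans (certify (m ∷ ∑< J δ ∷ J ∷ M ∷ []) (v0 :* v1 :* con 8) (v0 :* v2 :* v3 :* con 8)
              ((v0 :* con 8 ×ʰ v1 :≤ v2 :* v3 ∶ total J) ∷ []) tt)
      (≤-trans (m≤m+n _ 0) (m≤m+n _ 0)) , z≤n
    where
    total : ∀ j → ∑< j δ ≤ j * M
    total zero    = z≤n
    total (suc j) = ≤-trans (+-mono-≤ (total j) (small j)) (≤-reflexive (+-comm (j * M) M))
  level-sum δ {M} {m} {J} {c₀} {A₀} 1≤J small (suc h) H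
    with level-sum δ {M} {m} {J} {c₀} {A₀} 1≤J small h (λ i J≤i i<h → H i J≤i (m≤n⇒m≤1+n i<h)) | H (h + J) (m≤n+m J h) ≤-refl
  ... | A , bound , tele | a , new , inv = A + a ,
    certify (m ∷ ∑< (h + J) δ ∷ δ (h + J) ∷ J ∷ M ∷ h ∷ c₀ ∷ A ∷ a ∷ [])
      (v0 :* (v1 :+ v2) :* con 8) (v0 :* v3 :* v4 :* con 8 :+ (con 1 :+ v5) :* v6 :+ (v7 :+ v8))
      ((v0 :* v1 :* con 8 :≤ v0 :* v3 :* v4 :* con 8 :+ v5 :* v6 :+ v7 ∶ bound) ∷ (v0 :* v2 :* con 8 :≤ v6 :+ v8 ∶ new) ∷ []) tt ,
    *-cancelʳ-≤ _ _ (h + J) {{>-nonZero (≤-trans 1≤J (m≤n+m J h))}}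
      (certify (A ∷ a ∷ J ∷ h ∷ A₀ ∷ [])
        ((v0 :+ v1) :* v2 :* (con 1 :+ (v3 :+ v2)) :* (v3 :+ v2)) (v4 :* (con 1 :+ v3) :* (v3 :+ v2))
        ((con 1 :+ (v3 :+ v2) ×ʰ v0 :* v2 :* (v3 :+ v2) :≤ v4 :* v3 ∶ tele) ∷
         (v2 ×ʰ v1 :* (v3 :+ v2) :* (con 1 :+ (v3 :+ v2)) :≤ v4 ∶ inv) ∷ []) tt)

  module _ {n : ℕ} (S : Subset n) (B k : ℕ) (ω₁ ω₂ ω₃ ω₄ : List (𝔽₂^ n × 𝔽₂^ n)) where
    open Trial S B k ω₁ ω₂ ω₃ ω₄

    module _ (1≤B : 1 ≤ B) (1≤k : 1 ≤ k) (1≤N : 1 ≤ N) (fairness : AllFair) where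
      open AllFair fairness
      open Scale B k N 1≤B 1≤k 1≤N

      H≤m : H ≤ m
      H≤m = certify (B ∷ k ∷ []) (v0 :* v1 :* con 40960) (v0 :* v0 :* v1 :* con 65536)
        ((v0 :* v1 :* con 40960 ×ʰ con 1 :≤ v0 ∶ 1≤B) ∷ []) tt

      J≤H : J ≤ H
      J≤H = certify (B ∷ k ∷ []) (v1 :* con 1024) (v0 :* v1 :* con 40960) ((v1 :* con 1024 ×ʰ con 1 :≤ v0 ∶ 1≤B) ∷ []) tt

      private
        Δ : ℕ → ℕ
        Δ j = ∑∑ S λ s t → 𝟙 (popular j (s ⊞ t))

        μ ξ : ℕ
        μ = ∑∑ S λ s t → H ⊓ hits (s ⊞ t)
        ξ = ∑∑ S λ s t → hits (s ⊞ t) ∸ H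

      Poor : ℕ → Set
      Poor j = popularPairs j < D₀ ⊎ popularPairs j * j * suc j < m * J * J

      -- `17 = 8 + 9`: the layers below `J` are bounded trivially, and the terms of order `1 / i²`
      -- telescope to `9 m J`. Sparse layers contribute `9 (D₀ + k)` each, and there are at most `H`
      -- of them.
      low-levels : (∀ j → J ≤ j → j ≤ m → Poor j) → m * μ * 8 ≤ N * N * (m * J * 17 + H * (D₀ + k) * 9)
      low-levels poor = combine (level-sum (Δ ∘ suc) {N * N} {m} {J} {N * N * (D₀ + k) * 9} {N * N * (m * J * J) * 9} 1≤J Δ≤ (H ∸ J) step)
        where
        1≤J : 1 ≤ J
        1≤J = ≤-trans 1≤k (m≤m*n k 1024)
        Δ≤ : ∀ i → Δ (suc i) ≤ N * N
        Δ≤ i = ≤-trans (∑∑-mono S λ s t → 𝟙-≤1 (popular (suc i) (s ⊞ t))) (≤-reflexive (trans (∑∑-const S 1) (*-identityʳ (N * N))))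
        Step : ℕ → Set
        Step i = ∃[ a ] (m * Δ (suc i) * 8 ≤ N * N * (D₀ + k) * 9 + a × a * i * suc i ≤ N * N * (m * J * J) * 9)
        step : ∀ i → J ≤ i → i < (H ∸ J) + J → Step i
        -- Layer `i` counts the pairs with more than `i` hits, so poverty is used at level `i + 1`.
        -- The bound with `(i + 1)(i + 2)` implies the one with `i (i + 1)` that telescopes.
        step i J≤i i<H = go (poor (suc i) (m≤n⇒m≤1+n J≤i) i<m)
          where
          i<m : suc i ≤ m
          i<m = ≤-trans (≤-trans i<H (≤-reflexive (m∸n+n≡m J≤H))) H≤m
          D = popularPairs (suc i)
          upper : m * Δ (suc i) * 8 ≤ N * N * (D + k) * 9
          upper = Fair.lower (fair-pairs i<m)
          go : Poor (suc i) → Step i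
          go (inj₁ D<D₀) = 0 ,
            ≤-trans upper (≤-trans (*-monoˡ-≤ 9 (*-monoʳ-≤ (N * N) (+-monoˡ-≤ k (<⇒≤ D<D₀)))) (m≤m+n _ 0)) , z≤n
          go (inj₂ flat) = N * N * D * 9 ,
            certify (m * Δ (suc i) * 8 ∷ N ∷ D ∷ k ∷ D₀ ∷ []) v0 (v1 :* v1 :* (v4 :+ v3) :* con 9 :+ v1 :* v1 :* v2 :* con 9)
              ((v0 :≤ v1 :* v1 :* (v2 :+ v3) :* con 9 ∶ upper) ∷ []) tt ,
            certify (N ∷ D ∷ i ∷ m * J * J ∷ []) (v0 :* v0 :* v1 :* con 9 :* v2 :* (con 1 :+ v2)) (v0 :* v0 :* v3 :* con 9)
              ((v0 :* v0 :* con 9 ×ʰ v1 :* (con 1 :+ v2) :* (con 2 :+ v2) :≤ v3 ∶ <⇒≤ flat) ∷ []) tt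
        μ≡ : μ ≡ ∑< (H ∸ J + J) (Δ ∘ suc)
        μ≡ = trans (trans (∑-cong (elements S) λ s → trans (∑-cong (elements S) λ t → layer-cake H (hits (s ⊞ t)))
                (∑<-swap (elements S) H λ t i → 𝟙 (popular (suc i) (s ⊞ t))))
              (∑<-swap (elements S) H λ s i → ∑ (elements S) λ t → 𝟙 (popular (suc i) (s ⊞ t))))
            (cong (λ h → ∑< h (Δ ∘ suc)) (sym (m∸n+n≡m J≤H)))
        combine : ∃[ A ] (m * ∑< (H ∸ J + J) (Δ ∘ suc) * 8 ≤ m * J * (N * N) * 8 + (H ∸ J) * (N * N * (D₀ + k) * 9) + A ×
                          A * J * (H ∸ J + J) ≤ N * N * (m * J * J) * 9 * (H ∸ J)) →
                  m * μ * 8 ≤ N * N * (m * J * 17 + H * (D₀ + k) * 9)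
        combine (A , bound , tele) = certify (m ∷ μ ∷ N ∷ J ∷ H ∷ D₀ + k ∷ A ∷ H ∸ J ∷ [])
          (v0 :* v1 :* con 8) (v2 :* v2 :* (v0 :* v3 :* con 17 :+ v4 :* v5 :* con 9))
          ((v0 :* v1 :* con 8 :≤ v0 :* v3 :* (v2 :* v2) :* con 8 :+ v7 :* (v2 :* v2 :* v5 :* con 9) :+ v6 ∶
              ≤-trans (≤-reflexive (cong (λ x → m * x * 8) μ≡)) bound) ∷
           (v6 :≤ v2 :* v2 :* v0 :* v3 :* con 9 ∶ A≤) ∷
           (v2 :* v2 :* v5 :* con 9 ×ʰ v7 :≤ v4 ∶ m∸n≤m H J) ∷ []) tt
          where
          A≤ : A ≤ N * N * m * J * 9
          A≤ = *-cancelʳ-≤ _ _ J {{>-nonZero 1≤J}} (*-cancelʳ-≤ _ _ (H ∸ J + J) {{>-nonZero (≤-trans 1≤J (m≤n+m J (H ∸ J)))}}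
            (certify (A ∷ J ∷ H ∸ J ∷ N ∷ m ∷ []) (v0 :* v1 :* (v2 :+ v1)) (v3 :* v3 :* v4 :* v1 :* con 9 :* v1 :* (v2 :+ v1))
              ((v0 :* v1 :* (v2 :+ v1) :≤ v3 :* v3 :* (v4 :* v1 :* v1) :* con 9 :* v2 ∶ tele) ∷ []) tt))

      module _ (energetic : N * N * N * 15 ≤ B * B * energy S * 16) (poor : ∀ j → J ≤ j → j ≤ m → Poor j) where

        -- The energy bounds the sum of all hits from below, and poor levels bound its part
        -- truncated at `H` from above.
        large-excess : N * N * k * 17000 ≤ ξ
        large-excess = excess {μ} (subst (N * N * k * 54612 ≤_) ρ≡ (energy-total energetic ρ-bound)) (low-levels poor)
          where
          ρ = ∑∑ S λ s t → hits (s ⊞ t)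
          ρ≡ : ρ ≡ μ + ξ
          ρ≡ = trans (∑-cong (elements S) λ s → ∑-cong (elements S) λ t → sym (m⊓n+n∸m≡n H (hits (s ⊞ t)))) (∑∑-+ S _ _)
          ρ-bound : m * energy S * 8 ≤ N * (ρ + N * N * k) * 9
          ρ-bound = begin
            m * energy S * 8                                ≡⟨ cong (λ e → m * e * 8) (energy≡∑reps S) ⟩
            m * ∑∑ S (λ s t → reps S (s ⊞ t)) * 8           ≡⟨ cong (_* 8) (sym (∑∑-*ˡ S _ m)) ⟩
            ∑∑ S (λ s t → m * reps S (s ⊞ t)) * 8           ≡⟨ sym (∑∑-*ʳ S _ 8) ⟩
            ∑∑ S (λ s t → m * reps S (s ⊞ t) * 8)           ≤⟨ ∑∑-mono S (λ s t → Fair.lower (fair-hits (s ⊞ t))) ⟩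
            ∑∑ S (λ s t → N * (hits (s ⊞ t) + k) * 9)       ≡⟨ ∑∑-*ʳ S _ 9 ⟩
            ∑∑ S (λ s t → N * (hits (s ⊞ t) + k)) * 9       ≡⟨ cong (_* 9) (∑∑-*ˡ S _ N) ⟩
            N * ∑∑ S (λ s t → hits (s ⊞ t) + k) * 9         ≡⟨ cong (λ z → N * z * 9) (trans (∑∑-+ S _ _) (cong (ρ +_) (∑∑-const S k))) ⟩
            N * (ρ + N * N * k) * 9                         ∎
            where open ≤-Reasoning

        private
          c : 𝔽₂^ n → Candidate n
          c d = high d θ
          bad : 𝔽₂^ n → ℕ
          bad d = badTotal (base (c d)) (good (c d))
          nice : Subset n
          nice d = bad d * 64 ≤ᵇ reps S d * reps S d
          γ χ β G : ℕ
          γ = ∑∑ S λ s t → 𝟙 (nice (s ⊞ t)) * (hits (s ⊞ t) ∸ H)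
          χ = ∑∑ S λ s t → 𝟙 (not (nice (s ⊞ t))) * (hits (s ⊞ t) ∸ H)
          β = ∑ (points n) bad
          G = ∑∑ S λ s t → 𝟙 (worthy (c (s ⊞ t)))

          card-base : ∀ d → card (base (c d)) ≡ reps S d
          card-base d = trans (card≡# (base (c d))) (sym (reps≡shifts S d))

          ξ≡ : ξ ≡ γ + χ
          ξ≡ = trans (∑-cong (elements S) λ s → ∑-cong (elements S) λ t → split (nice (s ⊞ t)) _) (∑∑-+ S _ _)
            where
            split : ∀ b x → x ≡ 𝟙 b * x + 𝟙 (not b) * x
            split true  x = sym (trans (+-identityʳ _) (+-identityʳ x))
            split false x = sym (+-identityʳ x)

          χ-bound : χ * (N * 8) ≤ m * β * 576
          χ-bound = begin
            χ * (N * 8)                                   ≡⟨ cong (_* (N * 8)) (∑-pairs S (λ d → 𝟙 (not (nice d)) * (hits d ∸ H))) ⟩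
            ∑ (points n) (λ d → reps S d * (𝟙 (not (nice d)) * (hits d ∸ H))) * (N * 8) ≡⟨ sym (∑-*ʳ (points n) _ (N * 8)) ⟩
            ∑ (points n) (λ d → reps S d * (𝟙 (not (nice d)) * (hits d ∸ H)) * (N * 8)) ≤⟨ ∑-mono (points n) termwise ⟩
            ∑ (points n) (λ d → m * bad d * 576)          ≡⟨ ∑-*ʳ (points n) _ 576 ⟩
            ∑ (points n) (λ d → m * bad d) * 576          ≡⟨ cong (_* 576) (∑-*ˡ (points n) bad m) ⟩
            m * β * 576                                   ∎
            where
            open ≤-Reasoning
            termwise : ∀ d → reps S d * (𝟙 (not (nice d)) * (hits d ∸ H)) * (N * 8) ≤ m * bad d * 576
            termwise d with nice d in p
            ... | true  = ≤-trans (≤-reflexive (cong (_* (N * 8)) (*-zeroʳ (reps S d)))) z≤n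
            ... | false = ≤-trans (≤-reflexive (cong (λ z → reps S d * z * (N * 8)) (+-identityʳ (hits d ∸ H))))
                  (high-bad-weight {hits d} {reps S d} {bad d} (fair-hits d) (not-≤ᵇ {bad d * 64} (subst (T ∘ not) (sym p) tt)))

          -- A bad pair `x`, `y` lies in exactly `reps S (x ⊞ y)` of the fibres, and its sum is
          -- unpopular.
          β-bound : m * β * 8 ≤ N * N * (N * (θ + k) * 9)
          β-bound = begin
            m * β * 8                     ≡⟨ cong (λ b → m * b * 8) (∑-badTotal S (points n) (λ d x → S (d ⊞ x)) (λ x y → popular θ (x ⊞ y))) ⟩
            m * ∑∑ S F * 8                ≡⟨ cong (_* 8) (sym (∑∑-*ˡ S F m)) ⟩
            ∑∑ S (λ x y → m * F x y) * 8  ≡⟨ sym (∑∑-*ʳ S (λ x y → m * F x y) 8) ⟩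
            ∑∑ S (λ x y → m * F x y * 8)  ≤⟨ ∑∑-mono S termwise ⟩
            ∑∑ S (λ _ _ → N * (θ + k) * 9) ≡⟨ ∑∑-const S _ ⟩
            N * N * (N * (θ + k) * 9)     ∎
            where
            open ≤-Reasoning
            F : 𝔽₂^ n → 𝔽₂^ n → ℕ
            F x y = 𝟙 (not (popular θ (x ⊞ y))) * # (points n) (λ d → S (d ⊞ x) ∧ S (d ⊞ y))
            fibre : ∀ x y → # (points n) (λ d → S (d ⊞ x) ∧ S (d ⊞ y)) ≡ reps S (x ⊞ y)
            fibre x y = trans (#-cong (points n) λ d → cong₂ (λ u v → S u ∧ S v) (⊞-comm d x)
                (sym (trans (cong (_⊞ (x ⊞ d)) (⊞-comm x y)) (trans (⊞-assoc y x (x ⊞ d)) (trans (cong (y ⊞_) (⊞-cancel x d)) (⊞-comm y d))))))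
              (trans (∑-shift x (λ z → 𝟙 (S z ∧ S (x ⊞ y ⊞ z)))) (sym (reps≡shifts S (x ⊞ y))))
            termwise : ∀ x y → m * F x y * 8 ≤ N * (θ + k) * 9
            termwise x y with popular θ (x ⊞ y) in p
            ... | true  = ≤-trans (≤-reflexive (cong (_* 8) (*-zeroʳ m))) z≤n
            ... | false = ≤-trans (≤-reflexive (cong (λ z → m * z * 8) (trans (+-identityʳ _) (fibre x y))))
                  (≤-trans (Fair.lower (fair-hits (x ⊞ y))) (*-monoˡ-≤ 9 (*-monoʳ-≤ N (+-monoˡ-≤ k
                    (not-≤ᵇ {θ} (subst (T ∘ not) (sym p) tt))))))

          nice⇒worthy : ∀ d → T (nice d) → H ≤ hits d → T (worthy (c d))
          nice⇒worthy d h H≤ = ≤⇒≤ᵇ (high-size (fair-hits d) H≤ (subst (λ b → b * 7 ≤ card (clean (c d)) * 8) (card-base d)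
            (keeps-most S B k ω₁ ω₂ ω₃ ω₄ 1≤B 1≤k 1≤N fairness (high d)
              (subst (λ b → bad d * 64 ≤ b * b) (sym (card-base d)) (≤ᵇ⇒≤ (bad d * 64) _ h))
              (subst (λ b → N * k * 33 ≤ m * b) (sym (card-base d)) (high-big (fair-hits d) H≤)))))

          γ-bound : γ ≤ G * m
          γ-bound = ≤-trans (∑∑-mono S λ s t → termwise (s ⊞ t)) (≤-reflexive (∑∑-*ʳ S _ m))
            where
            hits≤m : ∀ d → hits d ∸ H ≤ m
            hits≤m d = ≤-trans (m∸n≤m (hits d) H) (≤-trans (#-≤-length w₁ _) (≤-reflexive length₁))
            termwise : ∀ d → 𝟙 (nice d) * (hits d ∸ H) ≤ 𝟙 (worthy (c d)) * m
            termwise d with H ≤? hits d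
            ... | yes p = *-mono-≤ (𝟙-mono λ h → nice⇒worthy d h p) (hits≤m d)
            ... | no ¬p rewrite m≤n⇒m∸n≡0 (<⇒≤ (≰⇒> ¬p)) | *-zeroʳ (𝟙 (nice d)) = z≤n

        worthy-difference : 1 ≤ # ω₄ (λ (s , t) → worthy (high (s ⊞ t) θ))
        worthy-difference = high-hit {γ} {χ} {β} {G} (subst (N * N * k * 17000 ≤_) ξ≡ large-excess) χ-bound β-bound γ-bound fair-high

-- Fractions of natural numbers

module Rationals where

  open Prelude
  open import Data.Integer.Base as ℤ using (+_)
  import Data.Integer.Properties as ℤ
  open import Data.Nat.Base as ℕ using (ℕ; suc; NonZero)
  import Data.Nat.Properties as ℕ
  open import Data.Rational.Base as ℚ using (ℚ; 0ℚ)
  import Data.Rational.Properties as ℚ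
  open import Data.Rational.Unnormalised.Base as ℚᵘ using (mkℚᵘ; *≤*; *<*)
  import Data.Rational.Unnormalised.Properties as ℚᵘ

  infixl 7 _÷_

  _÷_ : (a b : ℕ) .{{_ : NonZero b}} → ℚ
  a ÷ b = + a ℚ./ b

  ↑ : ℕ → ℚ
  ↑ a = a ÷ 1

  private
    pos-*-suc : ∀ a d → + a ℤ.* + suc d ≡ + (a ℕ.* suc d)
    pos-*-suc a d = sym (ℤ.pos-* a (suc d))

  ÷-≤ : ∀ {a b c d} .{{_ : NonZero b}} .{{_ : NonZero d}} → a ℕ.* d ℕ.≤ c ℕ.* b → a ÷ b ℚ.≤ c ÷ d
  ÷-≤ {a} {suc b} {c} {suc d} h = ℚ.toℚᵘ-cancel-≤
    (ℚᵘ.≤-respˡ-≃ (ℚᵘ.≃-sym (ℚ.toℚᵘ-fromℚᵘ (mkℚᵘ (+ a) b)))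
      (ℚᵘ.≤-respʳ-≃ (ℚᵘ.≃-sym (ℚ.toℚᵘ-fromℚᵘ (mkℚᵘ (+ c) d)))
        (*≤* (subst₂ ℤ._≤_ (sym (pos-*-suc a d)) (sym (pos-*-suc c b)) (ℤ.+≤+ h)))))

  ÷-< : ∀ {a b c d} .{{_ : NonZero b}} .{{_ : NonZero d}} → a ℕ.* d ℕ.< c ℕ.* b → a ÷ b ℚ.< c ÷ d
  ÷-< {a} {suc b} {c} {suc d} h = ℚ.toℚᵘ-cancel-<
    (ℚᵘ.<-respˡ-≃ (ℚᵘ.≃-sym (ℚ.toℚᵘ-fromℚᵘ (mkℚᵘ (+ a) b)))
      (ℚᵘ.<-respʳ-≃ (ℚᵘ.≃-sym (ℚ.toℚᵘ-fromℚᵘ (mkℚᵘ (+ c) d)))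
        (*<* (subst₂ ℤ._<_ (sym (pos-*-suc a d)) (sym (pos-*-suc c b)) (ℤ.+<+ h)))))

  ÷-≤⁻ : ∀ {a b c d} .{{_ : NonZero b}} .{{_ : NonZero d}} → a ÷ b ℚ.≤ c ÷ d → a ℕ.* d ℕ.≤ c ℕ.* b
  ÷-≤⁻ {a} {b} {c} {d} h with a ℕ.* d ℕ.≤? c ℕ.* b
  ... | yes p = p
  ... | no ¬p = ⊥-elim (ℚ.<-irrefl refl (ℚ.<-≤-trans (÷-< {c} {d} {a} {b} (ℕ.≰⇒> ¬p)) h))

  ÷-* : ∀ a b c d .{{_ : NonZero b}} .{{_ : NonZero d}} .{{_ : NonZero (b ℕ.* d)}} → (a ÷ b) ℚ.* (c ÷ d) ≡ (a ℕ.* c) ÷ (b ℕ.* d)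
  ÷-* a (suc b) c (suc d) = ℚ.toℚᵘ-injective (ℚᵘ.≃-trans (ℚ.toℚᵘ-homo-* (a ÷ suc b) (c ÷ suc d))
    (ℚᵘ.≃-trans (ℚᵘ.*-cong (ℚ.toℚᵘ-fromℚᵘ (mkℚᵘ (+ a) b)) (ℚ.toℚᵘ-fromℚᵘ (mkℚᵘ (+ c) d)))
      (ℚᵘ.≃-trans (ℚᵘ.≃-reflexive (cong (λ z → mkℚᵘ z (d ℕ.+ b ℕ.* suc d)) (sym (ℤ.pos-* a c))))
        (ℚᵘ.≃-sym (ℚ.toℚᵘ-fromℚᵘ (mkℚᵘ (+ (a ℕ.* c)) (d ℕ.+ b ℕ.* suc d)))))))

  ÷-+ : ∀ a b c d .{{_ : NonZero b}} .{{_ : NonZero d}} .{{_ : NonZero (b ℕ.* d)}} → (a ÷ b) ℚ.+ (c ÷ d) ≡ (a ℕ.* d ℕ.+ c ℕ.* b) ÷ (b ℕ.* d)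
  ÷-+ a (suc b) c (suc d) = ℚ.toℚᵘ-injective (ℚᵘ.≃-trans (ℚ.toℚᵘ-homo-+ (a ÷ suc b) (c ÷ suc d))
    (ℚᵘ.≃-trans (ℚᵘ.+-cong (ℚ.toℚᵘ-fromℚᵘ (mkℚᵘ (+ a) b)) (ℚ.toℚᵘ-fromℚᵘ (mkℚᵘ (+ c) d)))
      (ℚᵘ.≃-trans (ℚᵘ.≃-reflexive (cong (λ z → mkℚᵘ z (d ℕ.+ b ℕ.* suc d)) eq))
        (ℚᵘ.≃-sym (ℚ.toℚᵘ-fromℚᵘ (mkℚᵘ (+ (a ℕ.* suc d ℕ.+ c ℕ.* suc b)) (d ℕ.+ b ℕ.* suc d)))))))
    where
    eq : + a ℤ.* + suc d ℤ.+ + c ℤ.* + suc b ≡ + (a ℕ.* suc d ℕ.+ c ℕ.* suc b)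
    eq = trans (cong₂ ℤ._+_ (pos-*-suc a d) (pos-*-suc c b)) (sym (ℤ.pos-+ (a ℕ.* suc d) _))

  ÷-≡ : ∀ {a b c d} .{{_ : NonZero b}} .{{_ : NonZero d}} → a ℕ.* d ≡ c ℕ.* b → a ÷ b ≡ c ÷ d
  ÷-≡ {a} {b} {c} {d} e = ℚ.≤-antisym (÷-≤ {a} {b} {c} {d} (ℕ.≤-reflexive e)) (÷-≤ {c} {d} {a} {b} (ℕ.≤-reflexive (sym e)))

  ↑-* : ∀ a b → ↑ a ℚ.* ↑ b ≡ ↑ (a ℕ.* b)
  ↑-* a b = ÷-* a 1 b 1

  ↑-+ : ∀ a b → ↑ a ℚ.+ ↑ b ≡ ↑ (a ℕ.+ b)
  ↑-+ a b = trans (÷-+ a 1 b 1) (cong₂ (λ x y → ↑ (x ℕ.+ y)) (ℕ.*-identityʳ a) (ℕ.*-identityʳ b))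

  0≤÷ : ∀ a b .{{_ : NonZero b}} → 0ℚ ℚ.≤ a ÷ b
  0≤÷ a b = ÷-≤ {0} {1} {a} {b} ℕ.z≤n

  0<÷ : ∀ a b .{{_ : NonZero a}} .{{_ : NonZero b}} → 0ℚ ℚ.< a ÷ b
  0<÷ (suc a) b = ÷-< {0} {1} {suc a} {b} (ℕ.s≤s ℕ.z≤n)

-- Probabilities and runs of staged sampling

module Probability where

  open Prelude
  open import Data.Nat.Base as ℕ using (ℕ; zero; suc)
  import Data.Nat.Properties as ℕ
  open import Data.Rational.Base as ℚ using (ℚ; 0ℚ; 1ℚ; ½)
  import Data.Rational.Properties as ℚ
  open import Defs using (𝔽₂^; Subset; elements; card; Query; answer; ask; Randomized; return; draw; flip; Pr; mean; #queries; _⊢_⇓_⟨_,_⟩; _∈_) renaming (⟦_⟧ to ⟦_⟧q)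
  open _⊢_⇓_⟨_,_⟩
  open Counting
  open TailBounds
  open Rationals

  private variable
    n : ℕ
    A C : Set

  length-cartesianProduct : ∀ (xs : List A) (ys : List C) → length (cartesianProduct xs ys) ≡ length xs ℕ.* length ys
  length-cartesianProduct xs ys = trans (length≡∑ (cartesianProduct xs ys)) (trans (∑-cartesianProduct xs ys _)
    (trans (∑-cong xs λ _ → sym (length≡∑ ys)) (∑-const xs (length ys))))

  drawPairs : ℕ → (List (𝔽₂^ n × 𝔽₂^ n) → Randomized n A) → Randomized n A
  drawPairs zero    κ = κ []
  drawPairs (suc m) κ = draw λ s → draw λ t → drawPairs m λ ω → κ ((s , t) ∷ ω)

  embed : Query n A → (A → Randomized n C) → Randomized n C
  embed (answer a) κ = κ a
  embed (ask x q)  κ = ask x λ b → embed (q b) κ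

  Pr-embed : ∀ (S : Subset n) (q : Query n A) (κ : A → Randomized n C) E → Pr S (embed q κ) E ≡ Pr S (κ (⟦ q ⟧q S)) E
  Pr-embed S (answer a) κ E = refl
  Pr-embed S (ask x q)  κ E = Pr-embed S (q (S x)) κ E

  mean-*-length : ∀ (xs : List A) f → 1 ℕ.≤ length xs → mean (map f xs) ℚ.* ↑ (length xs) ≡ foldr ℚ._+_ 0ℚ (map f xs)
  mean-*-length (x ∷ xs) f _ = begin
    total ℚ.* (1 ÷ suc (length (map f xs))) ℚ.* ↑ (suc (length xs))
      ≡⟨ cong (λ l → total ℚ.* (1 ÷ suc l) ℚ.* ↑ (suc (length xs))) (length-map f xs) ⟩
    total ℚ.* (1 ÷ suc (length xs)) ℚ.* ↑ (suc (length xs))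
      ≡⟨ ℚ.*-assoc total _ _ ⟩
    total ℚ.* ((1 ÷ suc (length xs)) ℚ.* ↑ (suc (length xs)))
      ≡⟨ cong (total ℚ.*_) (trans (÷-* 1 (suc (length xs)) (suc (length xs)) 1)
           (÷-≡ {1 ℕ.* suc (length xs)} {suc (length xs) ℕ.* 1} {1} {1} (lemma (suc (length xs))))) ⟩
    total ℚ.* 1ℚ
      ≡⟨ ℚ.*-identityʳ total ⟩
    total ∎
    where
    open ≡-Reasoning
    total = foldr ℚ._+_ 0ℚ (map f (x ∷ xs))
    lemma : ∀ l → 1 ℕ.* l ℕ.* 1 ≡ 1 ℕ.* (l ℕ.* 1)
    lemma l = ℕ.*-assoc 1 l 1

  -- Probabilities are kept multiplied by the number of outcomes, so that a bound of the form count
  -- plus `p` passes through one uniform draw.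
  mean-≤ : ∀ (xs : List A) f (c : A → ℕ) D p → 1 ℕ.≤ length xs → (∀ x → f x ℚ.* ↑ D ℚ.≤ ↑ (c x) ℚ.+ p ℚ.* ↑ D) →
           mean (map f xs) ℚ.* ↑ (length xs ℕ.* D) ℚ.≤ ↑ (∑ xs c) ℚ.+ p ℚ.* ↑ (length xs ℕ.* D)
  mean-≤ xs f c D p 1≤l h = begin
    mean (map f xs) ℚ.* ↑ (length xs ℕ.* D)              ≡⟨ cong (mean (map f xs) ℚ.*_) (sym (↑-* (length xs) D)) ⟩
    mean (map f xs) ℚ.* (↑ (length xs) ℚ.* ↑ D)          ≡⟨ sym (ℚ.*-assoc (mean (map f xs)) (↑ (length xs)) (↑ D)) ⟩
    mean (map f xs) ℚ.* ↑ (length xs) ℚ.* ↑ D            ≡⟨ cong (ℚ._* ↑ D) (mean-*-length xs f 1≤l) ⟩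
    foldr ℚ._+_ 0ℚ (map f xs) ℚ.* ↑ D                    ≤⟨ go xs ⟩
    ↑ (∑ xs c) ℚ.+ p ℚ.* ↑ (length xs ℕ.* D)             ∎
    where
    open ℚ.≤-Reasoning
    interchange : ∀ a b c d → (a ℚ.+ b) ℚ.+ (c ℚ.+ d) ≡ (a ℚ.+ c) ℚ.+ (b ℚ.+ d)
    interchange a b c d = trans (ℚ.+-assoc a b _) (trans (cong (a ℚ.+_) (trans (sym (ℚ.+-assoc b c d))
      (trans (cong (ℚ._+ d) (ℚ.+-comm b c)) (ℚ.+-assoc c b d)))) (sym (ℚ.+-assoc a c _)))
    go : ∀ xs → foldr ℚ._+_ 0ℚ (map f xs) ℚ.* ↑ D ℚ.≤ ↑ (∑ xs c) ℚ.+ p ℚ.* ↑ (length xs ℕ.* D)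
    go []       = ℚ.≤-reflexive (trans (ℚ.*-zeroˡ (↑ D)) (sym (trans (ℚ.+-identityˡ _) (ℚ.*-zeroʳ p))))
    go (x ∷ xs) = begin
      (f x ℚ.+ foldr ℚ._+_ 0ℚ (map f xs)) ℚ.* ↑ D                 ≡⟨ ℚ.*-distribʳ-+ (↑ D) (f x) _ ⟩
      f x ℚ.* ↑ D ℚ.+ foldr ℚ._+_ 0ℚ (map f xs) ℚ.* ↑ D           ≤⟨ ℚ.+-mono-≤ (h x) (go xs) ⟩
      (↑ (c x) ℚ.+ p ℚ.* ↑ D) ℚ.+ (↑ (∑ xs c) ℚ.+ p ℚ.* ↑ (length xs ℕ.* D)) ≡⟨ interchange (↑ (c x)) _ _ _ ⟩
      (↑ (c x) ℚ.+ ↑ (∑ xs c)) ℚ.+ (p ℚ.* ↑ D ℚ.+ p ℚ.* ↑ (length xs ℕ.* D)) ≡⟨ cong₂ ℚ._+_ (↑-+ (c x) (∑ xs c))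
           (trans (sym (ℚ.*-distribˡ-+ p (↑ D) _)) (cong (p ℚ.*_) (↑-+ D _))) ⟩
      ↑ (c x ℕ.+ ∑ xs c) ℚ.+ p ℚ.* ↑ (D ℕ.+ length xs ℕ.* D)      ∎

  ↑-cancel-≤ : ∀ {p q} D → 1 ℕ.≤ D → p ℚ.* ↑ D ℚ.≤ q ℚ.* ↑ D → p ℚ.≤ q
  ↑-cancel-≤ (suc D) _ = ℚ.*-cancelʳ-≤-pos (↑ (suc D)) {{ℚ.positive (0<÷ (suc D) 1)}}

  module _ (S : Subset n) (1≤N : 1 ℕ.≤ card S) (E : A → Bool) where

    private
      Ω : List (𝔽₂^ n × 𝔽₂^ n)
      Ω = cartesianProduct (elements S) (elements S)
      N : ℕ
      N = card S

    Pr≤1 : ∀ t → Pr S t E ℚ.≤ 1ℚ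
    Pr≤1 (return a) with E a
    ... | true  = ℚ.≤-refl
    ... | false = 0≤÷ 1 1
    Pr≤1 (ask x κ)  = Pr≤1 (κ (S x))
    Pr≤1 (draw κ)   = ↑-cancel-≤ (N ℕ.* 1) (ℕ.*-mono-≤ 1≤N ℕ.≤-refl)
      (ℚ.≤-trans (mean-≤ (elements S) (λ x → Pr S (κ x) E) (λ _ → 0) 1 1ℚ 1≤N λ x →
          ℚ.≤-trans (ℚ.≤-reflexive (ℚ.*-identityʳ (Pr S (κ x) E))) (Pr≤1 (κ x)))
        (ℚ.≤-reflexive (trans (cong (λ c → ↑ c ℚ.+ 1ℚ ℚ.* ↑ (N ℕ.* 1)) (∑-zero (elements S))) (ℚ.+-identityˡ _))))
    Pr≤1 (flip κ)   = ℚ.*-monoˡ-≤-nonNeg ½ (ℚ.+-mono-≤ (Pr≤1 (κ false)) (Pr≤1 (κ true)))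

    Pr-drawPairs : ∀ m κ (c : List (𝔽₂^ n × 𝔽₂^ n) → ℕ) v → (∀ ω → length ω ≡ m → Pr S (κ ω) E ℚ.≤ ↑ (c ω) ℚ.+ v) →
      Pr S (drawPairs m κ) E ℚ.* ↑ (length Ω ℕ.^ m) ℚ.≤ ↑ (Σ^ Ω m c) ℚ.+ v ℚ.* ↑ (length Ω ℕ.^ m)
    Pr-drawPairs zero    κ c v h = ℚ.≤-trans (ℚ.≤-reflexive (ℚ.*-identityʳ _)) (ℚ.≤-trans (h [] refl)
      (ℚ.≤-reflexive (cong (↑ (c []) ℚ.+_) (sym (ℚ.*-identityʳ v)))))
    Pr-drawPairs (suc m) κ c v h = subst₂ (λ l s → Pr S (drawPairs (suc m) κ) E ℚ.* ↑ l ℚ.≤ ↑ s ℚ.+ v ℚ.* ↑ l) size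
      (sym (∑-cartesianProduct (elements S) (elements S) _))
      (mean-≤ (elements S) _ _ (N ℕ.* length Ω ℕ.^ m) v 1≤N λ s →
        mean-≤ (elements S) _ _ (length Ω ℕ.^ m) v 1≤N λ t →
          Pr-drawPairs m (λ ω → κ ((s , t) ∷ ω)) (λ ω → c ((s , t) ∷ ω)) v λ ω e → h ((s , t) ∷ ω) (cong suc e))
      where
      size : N ℕ.* (N ℕ.* length Ω ℕ.^ m) ≡ length Ω ℕ.* length Ω ℕ.^ m
      size = trans (sym (ℕ.*-assoc N N _)) (cong (ℕ._* length Ω ℕ.^ m) (sym (length-cartesianProduct (elements S) (elements S))))

    1≤L : 1 ℕ.≤ length Ω
    1≤L = ℕ.≤-trans (ℕ.*-mono-≤ 1≤N 1≤N) (ℕ.≤-reflexive (sym (length-cartesianProduct (elements S) (elements S))))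

    -- The sample just drawn fails its test with probability at most `2 ^ (−K)`, and otherwise the
    -- continuation is bounded by `v`. The union bound is taken one stage at a time because the
    -- later tests depend on this sample.
    Pr-stage : ∀ m κ (ok : List (𝔽₂^ n × 𝔽₂^ n) → Bool) K v → 0ℚ ℚ.≤ v →
      Σ^ Ω m (𝟙 ∘ not ∘ ok) ℕ.* 2 ℕ.^ K ℕ.≤ length Ω ℕ.^ m →
      (∀ ω → length ω ≡ m → T (ok ω) → Pr S (κ ω) E ℚ.≤ v) →
      Pr S (drawPairs m κ) E ℚ.≤ _÷_ 1 (2 ℕ.^ K) {{ℕ.m^n≢0 2 K}} ℚ.+ v
    Pr-stage m κ ok K v 0≤v few h = ↑-cancel-≤ (length Ω ℕ.^ m) (ℕ.m^n>0 (length Ω) {{ℕ.>-nonZero 1≤L}} m)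
      (ℚ.≤-trans (Pr-drawPairs m κ (𝟙 ∘ not ∘ ok) v pointwise)
        (ℚ.≤-trans (ℚ.+-monoˡ-≤ (v ℚ.* ↑ Lᵐ) failures) (ℚ.≤-reflexive (sym (ℚ.*-distribʳ-+ (↑ Lᵐ) ε v)))))
      where
      instance _ = ℕ.m^n≢0 2 K
      Lᵐ = length Ω ℕ.^ m
      ε = 1 ÷ 2 ℕ.^ K
      failures : ↑ (Σ^ Ω m (𝟙 ∘ not ∘ ok)) ℚ.≤ ε ℚ.* ↑ Lᵐ
      failures = ℚ.≤-trans (÷-≤ {Σ^ Ω m (𝟙 ∘ not ∘ ok)} {1} {1 ℕ.* Lᵐ} {2 ℕ.^ K ℕ.* 1} {{_}} {{ℕ.m*n≢0 (2 ℕ.^ K) 1}} (ℕ.≤-trans (ℕ.≤-reflexive (cong (Σ^ Ω m (𝟙 ∘ not ∘ ok) ℕ.*_) (ℕ.*-identityʳ (2 ℕ.^ K))))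
          (ℕ.≤-trans few (ℕ.≤-reflexive (sym (trans (ℕ.*-identityʳ (1 ℕ.* Lᵐ)) (ℕ.*-identityˡ Lᵐ)))))))
        (ℚ.≤-reflexive (sym (÷-* 1 (2 ℕ.^ K) Lᵐ 1 {{ℕ.m^n≢0 2 K}} {{_}} {{ℕ.m*n≢0 (2 ℕ.^ K) 1}})))
      pointwise : ∀ ω → length ω ≡ m → Pr S (κ ω) E ℚ.≤ ↑ (𝟙 (not (ok ω))) ℚ.+ v
      pointwise ω e with ok ω in eq
      ... | true  = ℚ.≤-trans (h ω e (subst T (sym eq) tt)) (ℚ.≤-reflexive (sym (ℚ.+-identityˡ v)))
      ... | false = ℚ.≤-trans (Pr≤1 (κ ω)) (ℚ.≤-trans (ℚ.≤-reflexive (sym (ℚ.+-identityʳ 1ℚ))) (ℚ.+-monoʳ-≤ 1ℚ 0≤v))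

  run-drawPairs : ∀ {S : Subset n} m {κ : List (𝔽₂^ n × 𝔽₂^ n) → Randomized n A} {a s q} → S ⊢ drawPairs m κ ⇓ a ⟨ s , q ⟩ →
    ∃[ ω ] ∃[ s′ ] length ω ≡ m × All (λ (x , y) → x ∈ S × y ∈ S) ω × s ≡ m ℕ.+ m ℕ.+ s′ × S ⊢ κ ω ⇓ a ⟨ s′ , q ⟩
  run-drawPairs zero    r = [] , _ , refl , [] , refl , r
  run-drawPairs (suc m) (draw x x∈ (draw y y∈ r)) =
    let ω , s′ , e , all , e′ , r′ = run-drawPairs m r
    in (x , y) ∷ ω , s′ , cong suc e , (x∈ , y∈) ∷ all , cong suc (trans (cong suc e′) (cong (ℕ._+ s′) (sym (ℕ.+-suc m m)))) , r′

  run-embed : ∀ {S : Subset n} (p : Query n A) {κ : A → Randomized n C} {c s q} → S ⊢ embed p κ ⇓ c ⟨ s , q ⟩ →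
    ∃[ q′ ] q ≡ #queries p S ℕ.+ q′ × S ⊢ κ (⟦ p ⟧q S) ⇓ c ⟨ s , q′ ⟩
  run-embed (answer a) r       = _ , refl , r
  run-embed {S = S} (ask x p) (ask r) =
    let q′ , e , r′ = run-embed (p (S x)) r in q′ , cong suc e , r′

-- The families of sets against which the four samples are tested

module Stages where

  open Prelude
  open import Defs using (𝔽₂^; _⊞_; points; Subset; elements; card)
  open Certificates
  open Counting
  open Arithmetic
  open TailBounds
  open Algorithms
  open Soundness
  open Probability using (length-cartesianProduct)

  ∈-concatMap : ∀ {A C : Set} (f : A → List C) {xs x y} → x ∈ˡ xs → y ∈ˡ f x → y ∈ˡ concatMap f xs
  ∈-concatMap f x∈ y∈ = ∈-concatMap⁺ f (lose x∈ y∈)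

  length-concatMap : ∀ {A C : Set} (f : A → List C) c xs → (∀ x → length (f x) ≡ c) → length (concatMap f xs) ≡ length xs * c
  length-concatMap f c []       h = refl
  length-concatMap f c (x ∷ xs) h = trans (length-++ (f x)) (cong₂ _+_ (h x) (length-concatMap f c xs h))

  -- Each family uses the earlier samples only. The later ones are filled with `[]`; its sets do not
  -- consult them and so unfold to the sets of the complete trial.
  module Families {n : ℕ} (S : Subset n) (B k : ℕ) where

    open Parameters B k

    private
      Pair : Set
      Pair = 𝔽₂^ n × 𝔽₂^ n
      Sets : Set
      Sets = List (Pair → Bool)

    Ω : List Pair
    Ω = cartesianProduct (elements S) (elements S)

    family₁ : Sets
    family₁ = map (λ e (s , _) → S (e ⊞ s)) (points n)

    module _ (ω₁ : List Pair) where
      open Search S B k ω₁ [] [] []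

      commonSets : ℕ → 𝔽₂^ n → Sets
      commonSets j x = map (λ y (l , _) → popular j (x ⊞ l) ∧ popular j (y ⊞ l)) (points n)

      popularSets : ℕ → Sets
      popularSets j = (λ (s , t) → popular j (s ⊞ t)) ∷ concatMap (commonSets j) (points n)

      family₂ : Sets
      family₂ = concatMap popularSets (upTo (suc m))

    module _ (ω₁ ω₂ : List Pair) where
      open Search S B k ω₁ ω₂ [] []

      centred : ℕ → List (Candidate n)
      centred j = map (λ a → low a j (popularPairs j)) (points n)

      admissible : List (Candidate n)
      admissible = map (λ d → high d θ) (points n) ++ concatMap centred (upTo (suc m))

      cleaningSets : Candidate n → Sets
      cleaningSets c = (base c ∘ proj₁) ∷ map (λ x (y , _) → base c y ∧ not (good c x y)) (points n)

      family₃ : Sets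
      family₃ = concatMap cleaningSets admissible

    module _ (ω₁ ω₂ ω₃ : List Pair) where
      open Trial S B k ω₁ ω₂ ω₃ [] hiding (m; J; θ; H; D₀; X₀)

      family₄ : Sets
      family₄ = (λ (s , t) → worthy (high (s ⊞ t) θ)) ∷ map (λ c → clean c ∘ proj₁) (admissible ω₁ ω₂)
             ++ map (λ j (a , _) → worthy (low a j (popularPairs j))) (upTo (suc m))

    -- A common bound: the largest families are indexed by a level and two points, and the factor 2
    -- covers lower order terms such as `1 + p² ≤ 2 p²`.
    size : ℕ
    size = (m + 2) * (2 ^ n * 2 ^ n) * 2

    private
      p M : ℕ
      p = 2 ^ n
      M = suc m
      1≤p : 1 ≤ p
      1≤p = m^n>0 2 n
      1≤pp : 1 ≤ p * p
      1≤pp = *-mono-≤ 1≤p 1≤p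

    length₁≤ : length family₁ ≤ size
    length₁≤ = ≤-trans (≤-reflexive (trans (length-map _ (points n)) (length-points n)))
      (certify (m ∷ p ∷ []) v1 ((v0 :+ con 2) :* (v1 :* v1) :* con 2) ((v1 ×ʰ con 1 :≤ v1 ∶ 1≤p) ∷ []) tt)

    length₂≤ : ∀ ω₁ → length (family₂ ω₁) ≤ size
    length₂≤ ω₁ = ≤-trans (≤-reflexive eq)
      (certify (m ∷ p ∷ []) ((con 1 :+ v0) :* (con 1 :+ v1 :* v1)) ((v0 :+ con 2) :* (v1 :* v1) :* con 2) ((con 1 :+ v0 ×ʰ con 1 :≤ v1 :* v1 ∶ 1≤pp) ∷ []) tt)
      where
      eq : length (family₂ ω₁) ≡ M * (1 + p * p)
      eq = trans (length-concatMap (popularSets ω₁) (1 + p * p) (upTo M) λ j → cong suc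
          (trans (length-concatMap (commonSets ω₁ j) p (points n) λ x → trans (length-map _ (points n)) (length-points n))
            (cong (_* p) (length-points n))))
        (cong (_* (1 + p * p)) (length-upTo M))

    length-admissible : ∀ ω₁ ω₂ → length (admissible ω₁ ω₂) ≡ p + M * p
    length-admissible ω₁ ω₂ = trans (length-++ (map (λ d → high d θ) (points n))) (cong₂ _+_ (trans (length-map _ (points n)) (length-points n))
      (trans (length-concatMap (centred ω₁ ω₂) p (upTo M) λ j → trans (length-map _ (points n)) (length-points n)) (cong (_* p) (length-upTo M))))

    length₃≤ : ∀ ω₁ ω₂ → length (family₃ ω₁ ω₂) ≤ size
    length₃≤ ω₁ ω₂ = ≤-trans (≤-reflexive eq)
      (certify (m ∷ p ∷ []) ((v1 :+ (con 1 :+ v0) :* v1) :* (con 1 :+ v1)) ((v0 :+ con 2) :* (v1 :* v1) :* con 2)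
        (((v0 :+ con 2) :* v1 ×ʰ con 1 :≤ v1 ∶ 1≤p) ∷ []) tt)
      where
      eq : length (family₃ ω₁ ω₂) ≡ (p + M * p) * (1 + p)
      eq = trans (length-concatMap (cleaningSets ω₁ ω₂) (1 + p) (admissible ω₁ ω₂) λ c → cong suc (trans (length-map _ (points n)) (length-points n)))
        (cong (_* (1 + p)) (length-admissible ω₁ ω₂))

    length₄≤ : ∀ ω₁ ω₂ ω₃ → length (family₄ ω₁ ω₂ ω₃) ≤ size
    length₄≤ ω₁ ω₂ ω₃ = ≤-trans (≤-reflexive eq)
      (certify (m ∷ p ∷ []) (con 1 :+ ((v1 :+ (con 1 :+ v0) :* v1) :+ (con 1 :+ v0))) ((v0 :+ con 2) :* (v1 :* v1) :* con 2)
        (((v0 :+ con 2) :* v1 ×ʰ con 1 :≤ v1 ∶ 1≤p) ∷ (v0 :+ con 2 ×ʰ con 1 :≤ v1 :* v1 ∶ 1≤pp) ∷ []) tt)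
      where
      eq : length (family₄ ω₁ ω₂ ω₃) ≡ 1 + ((p + M * p) + M)
      eq = cong suc (trans (length-++ (map _ (admissible ω₁ ω₂))) (cong₂ _+_
        (trans (length-map _ (admissible ω₁ ω₂)) (length-admissible ω₁ ω₂)) (trans (length-map _ (upTo M)) (length-upTo M))))

    module _ (1≤N : 1 ≤ card S) where

      private
        N = card S
        L≡ : length Ω ≡ N * N
        L≡ = length-cartesianProduct (elements S) (elements S)
        open Sampling Ω m k using (Rep; mkRep)

      pair-fair : ∀ Q {ω} → Rep Q ω → Fair (N * N) m k (# ω Q) (∑ (elements S) λ s → ∑ (elements S) λ t → 𝟙 (Q (s , t)))
      pair-fair Q {ω} (mkRep u l) = subst₂ (λ L τ → Fair L m k (# ω Q) τ) L≡ (∑-cartesianProduct (elements S) (elements S) _) (fair u l)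

      -- A condition on the first coordinate holds for `N` pairs per point, so one factor `N`
      -- cancels.
      single-fair : ∀ Q {ω} → Rep (Q ∘ proj₁) ω → Fair N m k (# (map proj₁ ω) Q) (# (elements S) Q)
      single-fair Q {ω} r = subst (λ X → Fair N m k X τ) (sym (∑-map proj₁ ω _)) (fair
          (*-cancelˡ-≤ N {{>-nonZero 1≤N}} (certify (N ∷ X ∷ τ ∷ m ∷ k ∷ []) (v0 :* (v0 :* v1 :* con 8)) (v0 :* (v3 :* v2 :* con 9 :+ v0 :* v4 :* con 8))
            ((v0 :* v0 :* v1 :* con 8 :≤ v3 :* (v0 :* v2) :* con 9 :+ v0 :* v0 :* v4 :* con 8 ∶ Fair.upper r′) ∷ []) tt))
          (*-cancelˡ-≤ N {{>-nonZero 1≤N}} (certify (N ∷ X ∷ τ ∷ m ∷ k ∷ []) (v0 :* (v3 :* v2 :* con 8)) (v0 :* (v0 :* (v1 :+ v4) :* con 9))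
            ((v3 :* (v0 :* v2) :* con 8 :≤ v0 :* v0 :* (v1 :+ v4) :* con 9 ∶ Fair.lower r′) ∷ []) tt)))
        where
        X = # ω (Q ∘ proj₁)
        τ = # (elements S) Q
        eq : ∑ (elements S) (λ s → ∑ (elements S) λ _ → 𝟙 (Q s)) ≡ N * τ
        eq = trans (∑-cong (elements S) λ s → ∑-const (elements S) (𝟙 (Q s))) (∑-*ˡ (elements S) _ N)
        r′ : Fair (N * N) m k X (N * τ)
        r′ = subst (Fair (N * N) m k X) eq (pair-fair (Q ∘ proj₁) r)

      module _ {ω₁ ω₂ ω₃ ω₄ : List Pair} (l₁ : length ω₁ ≡ m) (l₂ : length ω₂ ≡ m)
               (rep₁ : ∀ {Q} → Q ∈ˡ family₁ → Rep Q ω₁) (rep₂ : ∀ {Q} → Q ∈ˡ family₂ ω₁ → Rep Q ω₂)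
               (rep₃ : ∀ {Q} → Q ∈ˡ family₃ ω₁ ω₂ → Rep Q ω₃) (rep₄ : ∀ {Q} → Q ∈ˡ family₄ ω₁ ω₂ ω₃ → Rep Q ω₄) where

        open Trial S B k ω₁ ω₂ ω₃ ω₄ hiding (m; J; θ; H; D₀; X₀; N)

        private
          j∈ : ∀ {j} → j ≤ m → j ∈ˡ upTo M
          j∈ j≤m = ∈-upTo⁺ (s≤s j≤m)

          adm∈ : ∀ {c} → Admissible c → c ∈ˡ admissible ω₁ ω₂
          adm∈ (high d)    = ∈-++⁺ˡ (∈-map⁺ (λ d → high d θ) (∈-points d))
          adm∈ (low a j≤m) = ∈-++⁺ʳ (map (λ d → high d θ) (points n))
            (∈-concatMap (centred ω₁ ω₂) (j∈ j≤m) (∈-map⁺ (λ a → low a _ _) (∈-points a)))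

          cleaning∈ : ∀ {c} → Admissible c → ∀ {Q} → Q ∈ˡ cleaningSets ω₁ ω₂ c → Q ∈ˡ family₃ ω₁ ω₂
          cleaning∈ adm Q∈ = ∈-concatMap (cleaningSets ω₁ ω₂) (adm∈ adm) Q∈

        allFair : AllFair
        allFair = record
          { length₁     = trans (length-map proj₁ ω₁) l₁
          ; length₂     = trans (length-map proj₁ ω₂) l₂
          ; fair-hits   = λ e → single-fair (λ s → S (e ⊞ s)) (rep₁ (∈-map⁺ _ (∈-points e)))
          ; fair-common = λ {j} j≤m x y → single-fair _ (rep₂ (∈-concatMap (popularSets ω₁) (j∈ j≤m)
              (there (∈-concatMap (commonSets ω₁ j) (∈-points x) (∈-map⁺ _ (∈-points y))))))
          ; fair-pairs  = λ j≤m → pair-fair _ (rep₂ (∈-concatMap (popularSets ω₁) (j∈ j≤m) (here refl)))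
          ; fair-base   = fairBase
          ; fair-bad    = fairBad
          ; fair-clean  = fairClean
          ; fair-high   = pair-fair _ (rep₄ (here refl))
          ; fair-low    = λ j≤m → single-fair _ (rep₄ (there (∈-++⁺ʳ (map _ (admissible ω₁ ω₂)) (∈-map⁺ _ (j∈ j≤m)))))
          }
          where
          fairBase : ∀ {c} → Admissible c → Fair N m k (# w₃ (base c)) (# (elements S) (base c))
          -- Matching on the branch lets `base c` unfold; its version with an empty third sample and
          -- the actual one then agree by computation.
          fairBase adm@(high d)  = single-fair _ (rep₃ (cleaning∈ adm (here refl)))
          fairBase adm@(low a _) = single-fair _ (rep₃ (cleaning∈ adm (here refl)))
          fairBad : ∀ {c} → Admissible c → ∀ x →
            Fair N m k (# w₃ λ y → base c y ∧ not (good c x y)) (# (elements S) λ y → base c y ∧ not (good c x y))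
          fairBad adm@(high d)  x = single-fair _ (rep₃ (cleaning∈ adm (there (∈-map⁺ _ (∈-points x)))))
          fairBad adm@(low a _) x = single-fair _ (rep₃ (cleaning∈ adm (there (∈-map⁺ _ (∈-points x)))))
          fairClean : ∀ {c} → Admissible c → Fair N m k (# w₄ (clean c)) (# (elements S) (clean c))
          fairClean adm@(high d)  = single-fair _ (rep₄ (there (∈-++⁺ˡ (∈-map⁺ _ (adm∈ adm)))))
          fairClean adm@(low a _) = single-fair _ (rep₄ (there (∈-++⁺ˡ (∈-map⁺ _ (adm∈ adm)))))

-- The search finds sound candidates, and finds one when the energy is large

module Outcomes where

  open Prelude
  open import Relation.Nullary.Decidable using (T?)
  open import Defs using (𝔽₂^; _⊞_; Subset; card; energy; _⊕_)
  open Certificates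
  open Counting
  open Arithmetic
  open TailBounds using (T-∧⁻)
  open Algorithms
  open Soundness
  open LowBranch
  open HighBranch
  open Stages using (∈-concatMap)

  -- The soundness estimates with `B` in place of `1 / √α`. The constants are `2 ^ 61` and `2 ^ 27`.
  record Guarantee {n} (S : Subset n) (B : ℕ) (Y : Subset n) (isHigh : Set) : Set where
    field
      size          : card S * 42 ≤ B * card Y * 128
      doubling      : card (Y ⊕ Y) * 9 ≤ B * B * B * B * B * B * B * B * card Y * 2305843009213693952
      high-doubling : isHigh → card (Y ⊕ Y) * 9 ≤ B * B * B * B * B * B * card Y * 134217728

  data FromFibre {n} : Candidate n → Set where
    high : ∀ {d θ} → FromFibre (high d θ)

  module _ {n : ℕ} (S : Subset n) (B k : ℕ) (ω₁ ω₂ ω₃ ω₄ : List (𝔽₂^ n × 𝔽₂^ n)) where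
    open Trial S B k ω₁ ω₂ ω₃ ω₄

    data Provenance : Candidate n → Set where
      high : ∀ {s t} → (s , t) ∈ˡ ω₄ → Provenance (high (s ⊞ t) θ)
      low  : ∀ {a j} → a ∈ˡ w₄ → j ≤ m → Provenance (low a j (popularPairs j))

    provenance : ∀ {c} → c ∈ˡ candidates → Provenance c
    provenance {c} c∈ with ∈-++⁻ (map (λ (s , t) → high (s ⊞ t) θ) ω₄) c∈
    ... | inj₁ c∈₁ with ∈-map⁻ (λ (s , t) → high (s ⊞ t) θ) c∈₁
    ...   | _ , st∈ , refl = high st∈
    provenance {c} c∈ | inj₂ c∈₂ with find (∈-concatMap⁻ (λ j → map (λ a → low a j (popularPairs j)) w₄) {xs = upTo (suc m)} c∈₂)
    ...   | j , j∈ , c∈j with ∈-map⁻ (λ a → low a j (popularPairs j)) c∈j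
    ...     | _ , a∈ , refl = low a∈ (s≤s⁻¹ (∈-upTo⁻ j∈))

    accepted⁻ : ∀ {c} → c ∈ˡ accepted → Provenance c × T (accept c)
    accepted⁻ c∈ = let c∈′ , ok = ∈-filter⁻ (T? ∘ accept) c∈ in provenance c∈′ , ok

    high∈ : ∀ {s t} → (s , t) ∈ˡ ω₄ → high (s ⊞ t) θ ∈ˡ candidates
    high∈ st∈ = ∈-++⁺ˡ (∈-map⁺ (λ (s , t) → high (s ⊞ t) θ) st∈)

    low∈ : ∀ {a j} → a ∈ˡ w₄ → j ≤ m → low a j (popularPairs j) ∈ˡ candidates
    low∈ {a} {j} a∈ j≤m = ∈-++⁺ʳ (map (λ (s , t) → high (s ⊞ t) θ) ω₄)
      (∈-concatMap (λ j → map (λ a → low a j (popularPairs j)) w₄) (∈-upTo⁺ (s≤s j≤m)) (∈-map⁺ (λ a → low a j (popularPairs j)) a∈))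

    module _ (1≤B : 1 ≤ B) (1≤k : 1 ≤ k) (1≤N : 1 ≤ N) (fairness : AllFair) where

      accepted-sound : ∀ {c} → c ∈ˡ accepted → Guarantee S B (clean c) (FromFibre c)
      accepted-sound c∈ = go (accepted⁻ c∈)
        where
        go : ∀ {c} → Provenance c × T (accept c) → Guarantee S B (clean c) (FromFibre c)
        go (high {s} {t} _ , ok) =
          let size , doubling = high-sound 1≤B 1≤k 1≤N fairness (s ⊞ t) (≤ᵇ⇒≤ _ _ ok)
              y = card (clean (high (s ⊞ t) θ))
              sums = card (clean (high (s ⊞ t) θ) ⊕ clean (high (s ⊞ t) θ))
          in record
          { size = size
          ; doubling = ≤-trans doubling (certify (B ∷ y ∷ []) (v0 :* v0 :* v0 :* v0 :* v0 :* v0 :* v1 :* con 134217728)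
              (v0 :* v0 :* v0 :* v0 :* v0 :* v0 :* v0 :* v0 :* v1 :* con 2305843009213693952)
              ((v0 :* v0 :* v0 :* v0 :* v0 :* v0 :* v1 :* con 134217728 ×ʰ con 1 :≤ v0 :* v0 ∶ *-mono-≤ 1≤B 1≤B) ∷ []) tt)
          ; high-doubling = λ _ → doubling }
        go (low {a} {j} _ j≤m , ok) =
          let J≤j , ok₁    = T-∧⁻ {J ≤ᵇ j} ok
              D₀≤D , ok₂   = T-∧⁻ {D₀ ≤ᵇ popularPairs j} ok₁
              level , D≤2X = T-∧⁻ {m * J * J ≤ᵇ popularPairs j * j * suc j} ok₂
              size , doubling = low-sound 1≤B 1≤k 1≤N fairness a j≤m (≤ᵇ⇒≤ _ _ J≤j) (≤ᵇ⇒≤ _ _ D₀≤D) (≤ᵇ⇒≤ _ _ level) (≤ᵇ⇒≤ _ _ D≤2X)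
          in record { size = size ; doubling = doubling ; high-doubling = λ () }

      -- If nothing is accepted, every level is poor, since at any other level a worthy centre is
      -- sampled and would be accepted. Poor levels and large energy put a worthy difference into
      -- the sample, and its fibre would be accepted.
      accepted-complete : N * N * N * 15 ≤ B * B * energy S * 16 → accepted ≢ []
      accepted-complete energetic none = no-high (worthy-difference S B k ω₁ ω₂ ω₃ ω₄ 1≤B 1≤k 1≤N fairness energetic poor)
        where
        rejected : ∀ {c} → c ∈ˡ candidates → ¬ T (accept c)
        rejected {c} c∈ ok with () ← subst (c ∈ˡ_) none (∈-filter⁺ (T? ∘ accept) c∈ ok)
        no-high : ¬ (1 ≤ # ω₄ (λ (s , t) → worthy (high (s ⊞ t) θ)))
        no-high h = let (s , t) , st∈ , w = #-exists ω₄ _ h in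
          rejected (high∈ st∈) (worthy-high⇒accepted S B k ω₁ ω₂ ω₃ ω₄ 1≤B 1≤k 1≤N fairness (s ⊞ t) w)
        poor : ∀ j → J ≤ j → j ≤ m → Poor S B k ω₁ ω₂ ω₃ ω₄ 1≤B 1≤k 1≤N fairness j
        poor j J≤j j≤m with D₀ ≤? popularPairs j | m * J * J ≤? popularPairs j * j * suc j
        ... | no ¬p | _     = inj₁ (≰⇒> ¬p)
        ... | yes _ | no ¬q = inj₂ (≰⇒> ¬q)
        ... | yes p | yes q =
          let a , a∈ , w = #-exists w₄ _ (worthy-centre S B k ω₁ ω₂ ω₃ ω₄ 1≤B 1≤k 1≤N fairness j≤m p) in
          ⊥-elim (rejected (low∈ a∈ j≤m) (worthy-low⇒accepted S B k ω₁ ω₂ ω₃ ω₄ 1≤B 1≤k 1≤N fairness a j≤m J≤j p q w))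

-- Evaluation from a table of answered queries

module Oracles where

  open Prelude
  open import Defs using (𝔽₂^; _⊞_; _≟_; Subset; Query; answer; ask; ⟦_⟧; #queries)
  open Counting
  open Arithmetic using (module Parameters)
  open Algorithms
  open Stages using (∈-concatMap; length-concatMap)
  open Outcomes

  module _ {n : ℕ} where

    extend : 𝔽₂^ n → Bool → Subset n → Subset n
    extend x b O y = if does (y ≟ x) then b else O y

    -- All queries are made in advance on a given list, and `f` is evaluated on the resulting table.
    -- The cost is thus the length of the list whatever the answers are.
    learn : ∀ {A : Set} → List (𝔽₂^ n) → Subset n → (Subset n → A) → Query n A
    learn []       O f = answer (f O)
    learn (x ∷ xs) O f = ask x λ b → learn xs (extend x b O) f

    learned : List (𝔽₂^ n) → Subset n → Subset n → Subset n
    learned []       O S = O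
    learned (x ∷ xs) O S = learned xs (extend x (S x) O) S

    ⟦learn⟧ : ∀ {A : Set} xs O (f : Subset n → A) S → ⟦ learn xs O f ⟧ S ≡ f (learned xs O S)
    ⟦learn⟧ []       O f S = refl
    ⟦learn⟧ (x ∷ xs) O f S = ⟦learn⟧ xs (extend x (S x) O) f S

    #queries-learn : ∀ {A : Set} xs O (f : Subset n → A) S → #queries (learn xs O f) S ≡ length xs
    #queries-learn []       O f S = refl
    #queries-learn (x ∷ xs) O f S = cong suc (#queries-learn xs (extend x (S x) O) f S)

    extend-correct : ∀ x (O S : Subset n) y → (y ≢ x → O y ≡ S y) → extend x (S x) O y ≡ S y
    extend-correct x O S y h with y ≟ x
    ... | yes refl = refl
    ... | no y≢x   = h y≢x

    learned-keeps : ∀ xs O S y → O y ≡ S y → learned xs O S y ≡ S y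
    learned-keeps []       O S y e = e
    learned-keeps (x ∷ xs) O S y e = learned-keeps xs _ S y (extend-correct x O S y λ _ → e)

    learned-correct : ∀ {xs y} O S → y ∈ˡ xs → learned xs O S y ≡ S y
    learned-correct {x ∷ xs} {y} O S (here refl) =
      learned-keeps xs _ S y (extend-correct x O S y λ y≢y → ⊥-elim (y≢y refl))
    learned-correct {x ∷ xs} O S (there y∈) = learned-correct _ S y∈

    -- Every point at which the predicates consult the oracle is `p`, `p + q` or `p + q + s`, with
    -- `p` and `q` in `V` and `s` in the first sample. This is the source of the cubic query count.
    sums : List (𝔽₂^ n) → List (𝔽₂^ n) → List (𝔽₂^ n)
    sums w V = V ++ concatMap (λ p → map (p ⊞_) V) V ++ concatMap (λ p → concatMap (λ q → map (p ⊞ q ⊞_) w) V) V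

    length-sums : ∀ w V → let v = length V in length (sums w V) ≡ v + (v * v + v * (v * length w))
    length-sums w V = trans (length-++ V) (cong (length V +_) (trans (length-++ (concatMap (λ p → map (p ⊞_) V) V)) (cong₂ _+_
      (length-concatMap (λ p → map (p ⊞_) V) (length V) V λ p → length-map (p ⊞_) V)
      (length-concatMap _ (length V * length w) V λ p → length-concatMap _ (length w) V λ q → length-map (p ⊞ q ⊞_) w))))

    module Agreement {O S : Subset n} {w V : List (𝔽₂^ n)} (agree : ∀ {y} → y ∈ˡ sums w V → O y ≡ S y) where

      agree₁ : ∀ {p} → p ∈ˡ V → O p ≡ S p
      agree₁ p∈ = agree (∈-++⁺ˡ p∈)

      agree₂ : ∀ {p q} → p ∈ˡ V → q ∈ˡ V → O (p ⊞ q) ≡ S (p ⊞ q)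
      agree₂ {p} p∈ q∈ = agree (∈-++⁺ʳ V (∈-++⁺ˡ (∈-concatMap (λ p → map (p ⊞_) V) p∈ (∈-map⁺ (p ⊞_) q∈))))

      agree₃ : ∀ {p q s} → p ∈ˡ V → q ∈ˡ V → s ∈ˡ w → O (p ⊞ q ⊞ s) ≡ S (p ⊞ q ⊞ s)
      agree₃ {p} {q} p∈ q∈ s∈ = agree (∈-++⁺ʳ V (∈-++⁺ʳ (concatMap (λ p → map (p ⊞_) V) V)
        (∈-concatMap (λ p → concatMap (λ q → map (p ⊞ q ⊞_) w) V) p∈ (∈-concatMap (λ q → map (p ⊞ q ⊞_) w) q∈ (∈-map⁺ (p ⊞ q ⊞_) s∈)))))

    #-cong-∈ : ∀ {A : Set} (xs : List A) {f g : A → Bool} → (∀ x → x ∈ˡ xs → f x ≡ g x) → # xs f ≡ # xs g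
    #-cong-∈ xs h = ∑-cong-∈ xs λ x x∈ → cong 𝟙 (h x x∈)

    centre : Candidate n → 𝔽₂^ n
    centre (high d θ)  = d
    centre (low a j D) = a

    module _ {O S : Subset n} {w₁ w₂ w₃ V : List (𝔽₂^ n)} (agree : ∀ {y} → y ∈ˡ sums w₁ V → O y ≡ S y)
             (w₂⊆V : ∀ {y} → y ∈ˡ w₂ → y ∈ˡ V) (w₃⊆V : ∀ {y} → y ∈ˡ w₃ → y ∈ˡ V) where
      open Agreement {O} {S} {w₁} {V} agree
      private
        module MO = Membership O w₁ w₂ w₃
        module MS = Membership S w₁ w₂ w₃

      hits-agree : ∀ {p q} → p ∈ˡ V → q ∈ˡ V → MO.hits (p ⊞ q) ≡ MS.hits (p ⊞ q)
      hits-agree p∈ q∈ = #-cong-∈ w₁ λ s s∈ → agree₃ p∈ q∈ s∈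

      popular-agree : ∀ j {p q} → p ∈ˡ V → q ∈ˡ V → MO.popular j (p ⊞ q) ≡ MS.popular j (p ⊞ q)
      popular-agree j p∈ q∈ = cong (j ≤ᵇ_) (hits-agree p∈ q∈)

      common-agree : ∀ j {x y} → x ∈ˡ V → y ∈ˡ V → MO.common j x y ≡ MS.common j x y
      common-agree j x∈ y∈ = #-cong-∈ w₂ λ l l∈ → cong₂ _∧_ (popular-agree j x∈ (w₂⊆V l∈)) (popular-agree j y∈ (w₂⊆V l∈))

      base-agree : ∀ c → centre c ∈ˡ V → ∀ {x} → x ∈ˡ V → MO.base c x ≡ MS.base c x
      base-agree (high d θ)  d∈ x∈ = cong₂ _∧_ (agree₁ x∈) (agree₂ d∈ x∈)
      base-agree (low a j D) a∈ x∈ = cong₂ _∧_ (agree₁ x∈) (popular-agree j a∈ x∈)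

      good-agree : ∀ c {x y} → x ∈ˡ V → y ∈ˡ V → MO.good c x y ≡ MS.good c x y
      good-agree (high d θ)  x∈ y∈ = popular-agree θ x∈ y∈
      good-agree (low a j D) x∈ y∈ = cong (λ p → D * D ≤ᵇ length w₂ * p * 1024) (common-agree j x∈ y∈)

      clean-agree : ∀ c → centre c ∈ˡ V → ∀ {x} → x ∈ˡ V → MO.clean c x ≡ MS.clean c x
      clean-agree c c∈ x∈ = cong₂ _∧_ (base-agree c c∈ x∈) (cong₂ (λ a b → a * 5 ≤ᵇ b)
        (#-cong-∈ w₃ λ y y∈ → cong₂ (λ a b → a ∧ not b) (base-agree c c∈ (w₃⊆V y∈)) (good-agree c x∈ (w₃⊆V y∈)))
        (#-cong-∈ w₃ λ y y∈ → base-agree c c∈ (w₃⊆V y∈)))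

    filterᵇ-cong-∈ : ∀ {A : Set} (xs : List A) {p q : A → Bool} → (∀ x → x ∈ˡ xs → p x ≡ q x) → filterᵇ p xs ≡ filterᵇ q xs
    filterᵇ-cong-∈ []       h = refl
    filterᵇ-cong-∈ (x ∷ xs) {p} {q} h with p x | q x | h x (here refl)
    ... | true  | _ | refl = cong (x ∷_) (filterᵇ-cong-∈ xs λ y y∈ → h y (there y∈))
    ... | false | _ | refl = filterᵇ-cong-∈ xs λ y y∈ → h y (there y∈)

    -- The second coordinates of `ω₂` enter through `popularPairs`; the pair sums of `ω₄` are the
    -- centres of the candidate fibres.
    searchPoints : (ω₂ ω₃ ω₄ : List (𝔽₂^ n × 𝔽₂^ n)) → List (𝔽₂^ n)
    searchPoints ω₂ ω₃ ω₄ = map proj₁ ω₂ ++ map proj₂ ω₂ ++ map proj₁ ω₃ ++ map proj₁ ω₄ ++ map (λ (s , t) → s ⊞ t) ω₄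

    module _ {O S : Subset n} (B k : ℕ) (ω₁ ω₂ ω₃ ω₄ : List (𝔽₂^ n × 𝔽₂^ n))
             (agree : ∀ {y} → y ∈ˡ sums (map proj₁ ω₁) (searchPoints ω₂ ω₃ ω₄) → O y ≡ S y) where
      private
        V = searchPoints ω₂ ω₃ ω₄
        module SO = Search O B k ω₁ ω₂ ω₃ ω₄
        module SS = Search S B k ω₁ ω₂ ω₃ ω₄
        open Parameters B k

        V₃ V₄ V₅ : List (𝔽₂^ n)
        V₅ = map (λ (s , t) → s ⊞ t) ω₄
        V₄ = map proj₁ ω₄ ++ V₅
        V₃ = map proj₁ ω₃ ++ V₄

        w₂⊆V : ∀ {y} → y ∈ˡ map proj₁ ω₂ → y ∈ˡ V
        w₂⊆V = ∈-++⁺ˡ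
        seconds⊆V : ∀ {y} → y ∈ˡ map proj₂ ω₂ → y ∈ˡ V
        seconds⊆V y∈ = ∈-++⁺ʳ (map proj₁ ω₂) (∈-++⁺ˡ y∈)
        V₃⊆V : ∀ {y} → y ∈ˡ V₃ → y ∈ˡ V
        V₃⊆V y∈ = ∈-++⁺ʳ (map proj₁ ω₂) (∈-++⁺ʳ (map proj₂ ω₂) y∈)
        w₃⊆V : ∀ {y} → y ∈ˡ map proj₁ ω₃ → y ∈ˡ V
        w₃⊆V y∈ = V₃⊆V (∈-++⁺ˡ y∈)
        w₄⊆V : ∀ {y} → y ∈ˡ map proj₁ ω₄ → y ∈ˡ V
        w₄⊆V y∈ = V₃⊆V (∈-++⁺ʳ (map proj₁ ω₃) (∈-++⁺ˡ y∈))
        V₅⊆V : ∀ {y} → y ∈ˡ V₅ → y ∈ˡ V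
        V₅⊆V y∈ = V₃⊆V (∈-++⁺ʳ (map proj₁ ω₃) (∈-++⁺ʳ (map proj₁ ω₄) y∈))

      popularPairs-agree : ∀ j → SO.popularPairs j ≡ SS.popularPairs j
      popularPairs-agree j = #-cong-∈ ω₂ λ (s , t) st∈ →
        popular-agree {w₂ = SO.w₂} {SO.w₃} agree w₂⊆V w₃⊆V j (w₂⊆V (∈-map⁺ proj₁ st∈)) (seconds⊆V (∈-map⁺ proj₂ st∈))

      candidates-agree : SO.candidates ≡ SS.candidates
      candidates-agree = cong (map (λ (s , t) → high (s ⊞ t) θ) ω₄ ++_) (concatMap-cong (upTo (suc m)))
        where
        concatMap-cong : ∀ js → concatMap (λ j → map (λ a → low a j (SO.popularPairs j)) SO.w₄) js ≡
                                concatMap (λ j → map (λ a → low a j (SS.popularPairs j)) SO.w₄) js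
        concatMap-cong []       = refl
        concatMap-cong (j ∷ js) = cong₂ (λ D rest → map (λ a → low a j D) SO.w₄ ++ rest) (popularPairs-agree j) (concatMap-cong js)

      centre∈ : ∀ {c} → Provenance S B k ω₁ ω₂ ω₃ ω₄ c → centre c ∈ˡ V
      centre∈ (high st∈)  = V₅⊆V (∈-map⁺ (λ (s , t) → s ⊞ t) st∈)
      centre∈ (low a∈ _)  = w₄⊆V a∈

      accept-agree : ∀ c → centre c ∈ˡ V → SO.accept c ≡ SS.accept c
      accept-agree c@(high d _)  c∈ = cong (X₀ ≤ᵇ_) (#-cong-∈ SO.w₄ λ y y∈ → clean-agree agree w₂⊆V w₃⊆V c c∈ (w₄⊆V y∈))
      accept-agree c@(low a j D) c∈ = cong (λ X → (J ≤ᵇ j) ∧ (D₀ ≤ᵇ D) ∧ (m * J * J ≤ᵇ D * j * suc j) ∧ (D ≤ᵇ X * 2))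
        (#-cong-∈ SO.w₄ λ y y∈ → clean-agree agree w₂⊆V w₃⊆V c c∈ (w₄⊆V y∈))

      accepted-agree : SO.accepted ≡ SS.accepted
      accepted-agree = trans (cong (filterᵇ SO.accept) candidates-agree)
        (filterᵇ-cong-∈ SS.candidates λ c c∈ → accept-agree c (centre∈ (provenance S B k ω₁ ω₂ ω₃ ω₄ c∈)))

-- Records as bit strings

module Records where

  open Prelude
  open import Defs using (𝔽₂^; Record)
  open Certificates
  open Algorithms

  private variable
    n : ℕ

  -- Unary notation delimits itself and is affordable: the numbers stored are at most `m`, next to
  -- three lists of `m` vectors.
  putℕ : ℕ → List Bool → List Bool
  putℕ zero    bs = false ∷ bs
  putℕ (suc k) bs = true ∷ putℕ k bs

  getℕ : List Bool → ℕ × List Bool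
  getℕ []           = 0 , []
  getℕ (false ∷ bs) = 0 , bs
  getℕ (true ∷ bs)  = map₁ suc (getℕ bs)

  getℕ-putℕ : ∀ k bs → getℕ (putℕ k bs) ≡ (k , bs)
  getℕ-putℕ zero    bs = refl
  getℕ-putℕ (suc k) bs = cong (map₁ suc) (getℕ-putℕ k bs)

  length-putℕ : ∀ k bs → length (putℕ k bs) ≡ suc k + length bs
  length-putℕ zero    bs = refl
  length-putℕ (suc k) bs = cong suc (length-putℕ k bs)

  putVec : 𝔽₂^ n → List Bool → List Bool
  putVec []      bs = bs
  putVec (b ∷ x) bs = b ∷ putVec x bs

  getVec : ∀ n → List Bool → 𝔽₂^ n × List Bool
  getVec zero    bs       = [] , bs
  getVec (suc n) []       = map₁ (false ∷_) (getVec n [])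
  getVec (suc n) (b ∷ bs) = map₁ (b ∷_) (getVec n bs)

  getVec-putVec : ∀ (x : 𝔽₂^ n) bs → getVec n (putVec x bs) ≡ (x , bs)
  getVec-putVec []      bs = refl
  getVec-putVec (b ∷ x) bs = cong (map₁ (b ∷_)) (getVec-putVec x bs)

  length-putVec : ∀ (x : 𝔽₂^ n) bs → length (putVec x bs) ≡ n + length bs
  length-putVec []      bs = refl
  length-putVec (b ∷ x) bs = cong suc (length-putVec x bs)

  putList : List (𝔽₂^ n) → List Bool → List Bool
  putList []       bs = bs
  putList (x ∷ xs) bs = putVec x (putList xs bs)

  getList : ∀ n → ℕ → List Bool → List (𝔽₂^ n) × List Bool
  getList n zero    bs = [] , bs
  getList n (suc m) bs = let x , bs₁ = getVec n bs in map₁ (x ∷_) (getList n m bs₁)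

  getList-putList : ∀ (xs : List (𝔽₂^ n)) bs → getList n (length xs) (putList xs bs) ≡ (xs , bs)
  getList-putList []       bs = refl
  getList-putList {n} (x ∷ xs) bs rewrite getVec-putVec x (putList xs bs) | getList-putList xs bs = refl

  length-putList : ∀ (xs : List (𝔽₂^ n)) bs → length (putList xs bs) ≡ length xs * n + length bs
  length-putList []       bs = refl
  length-putList {n} (x ∷ xs) bs = trans (length-putVec x _) (trans (cong (n +_) (length-putList xs bs)) (sym (+-assoc n (length xs * n) _)))

  record Data (n : ℕ) : Set where
    constructor store
    field
      candidate : Candidate n
      w₁ w₂ w₃  : List (𝔽₂^ n)

  encodeSamples : ℕ → 𝔽₂^ n → (w₁ w₂ w₃ : List (𝔽₂^ n)) → List Bool
  encodeSamples m v w₁ w₂ w₃ = putℕ m (putVec v (putList w₁ (putList w₂ (putList w₃ []))))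

  decodeSamples : ∀ n → (𝔽₂^ n → Candidate n) → List Bool → Data n
  decodeSamples n c bs =
    let m , bs₁  = getℕ bs
        v , bs₂  = getVec n bs₁
        w₁ , bs₃ = getList n m bs₂
        w₂ , bs₄ = getList n m bs₃
        w₃ , _   = getList n m bs₄
    in store (c v) w₁ w₂ w₃

  encode : ℕ → Candidate n → (w₁ w₂ w₃ : List (𝔽₂^ n)) → Record
  encode m (high d θ)  w₁ w₂ w₃ = true ∷ putℕ θ (encodeSamples m d w₁ w₂ w₃)
  encode m (low a j D) w₁ w₂ w₃ = false ∷ putℕ j (putℕ D (encodeSamples m a w₁ w₂ w₃))

  decode : ∀ n → Record → Data n
  decode n []           = decodeSamples n (λ d → high d 0) []
  decode n (true ∷ bs)  = let θ , bs₁ = getℕ bs in decodeSamples n (λ d → high d θ) bs₁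
  decode n (false ∷ bs) = let j , bs₁ = getℕ bs ; D , bs₂ = getℕ bs₁ in decodeSamples n (λ a → low a j D) bs₂

  decodeSamples-encode : ∀ {m} (c : 𝔽₂^ n → Candidate n) v {w₁ w₂ w₃} → length w₁ ≡ m → length w₂ ≡ m → length w₃ ≡ m →
    decodeSamples n c (encodeSamples m v w₁ w₂ w₃) ≡ store (c v) w₁ w₂ w₃
  decodeSamples-encode {n} {m} c v {w₁} {w₂} {w₃} l₁ l₂ l₃
    rewrite getℕ-putℕ m (putVec v (putList w₁ (putList w₂ (putList w₃ []))))
          | getVec-putVec v (putList w₁ (putList w₂ (putList w₃ [])))
          | trans (cong (λ m → getList n m (putList w₁ (putList w₂ (putList w₃ [])))) (sym l₁)) (getList-putList w₁ (putList w₂ (putList w₃ [])))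
          | trans (cong (λ m → getList n m (putList w₂ (putList w₃ []))) (sym l₂)) (getList-putList w₂ (putList w₃ []))
          | trans (cong (λ m → getList n m (putList w₃ [])) (sym l₃)) (getList-putList w₃ [])
    = refl

  decode-encode : ∀ {m} (c : Candidate n) {w₁ w₂ w₃} → length w₁ ≡ m → length w₂ ≡ m → length w₃ ≡ m →
    decode n (encode m c w₁ w₂ w₃) ≡ store c w₁ w₂ w₃
  decode-encode {n} {m} (high d θ) {w₁} {w₂} {w₃} l₁ l₂ l₃
    rewrite getℕ-putℕ θ (encodeSamples m d w₁ w₂ w₃) = decodeSamples-encode (λ d → high d θ) d l₁ l₂ l₃
  decode-encode {n} {m} (low a j D) {w₁} {w₂} {w₃} l₁ l₂ l₃
    rewrite getℕ-putℕ j (putℕ D (encodeSamples m a w₁ w₂ w₃)) | getℕ-putℕ D (encodeSamples m a w₁ w₂ w₃) =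
    decodeSamples-encode (λ a → low a j D) a l₁ l₂ l₃

  thresholds : Candidate n → ℕ
  thresholds (high d θ)  = θ
  thresholds (low a j D) = suc j + D

  length-encode : ∀ {m} (c : Candidate n) {w₁ w₂ w₃} → length w₁ ≡ m → length w₂ ≡ m → length w₃ ≡ m →
    length (encode m c w₁ w₂ w₃) ≡ thresholds c + (3 + m + n + (m * n + (m * n + m * n)))
  length-encode {n} {m} c {w₁} {w₂} {w₃} l₁ l₂ l₃ = go c
    where
    samples : ∀ v → length (encodeSamples m v w₁ w₂ w₃) ≡ suc m + (n + (m * n + (m * n + (m * n + 0))))
    samples v rewrite length-putℕ m (putVec v (putList w₁ (putList w₂ (putList w₃ []))))
      | length-putVec v (putList w₁ (putList w₂ (putList w₃ []))) | length-putList w₁ (putList w₂ (putList w₃ []))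
      | length-putList w₂ (putList w₃ []) | length-putList w₃ [] | l₁ | l₂ | l₃ = refl
    go : ∀ c → length (encode m c w₁ w₂ w₃) ≡ thresholds c + (3 + m + n + (m * n + (m * n + m * n)))
    go (high d θ) rewrite length-putℕ θ (encodeSamples m d w₁ w₂ w₃) | samples d = certify-≡ (θ ∷ m ∷ n ∷ m * n ∷ [])
      (con 1 :+ (con 1 :+ v0 :+ (con 1 :+ v1 :+ (v2 :+ (v3 :+ (v3 :+ (v3 :+ con 0)))))))
      (v0 :+ (con 3 :+ v1 :+ v2 :+ (v3 :+ (v3 :+ v3)))) [] [] tt tt
    go (low a j D) rewrite length-putℕ j (putℕ D (encodeSamples m a w₁ w₂ w₃)) | length-putℕ D (encodeSamples m a w₁ w₂ w₃) | samples a =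
      certify-≡ (j ∷ D ∷ m ∷ n ∷ m * n ∷ [])
        (con 1 :+ (con 1 :+ v0 :+ (con 1 :+ v1 :+ (con 1 :+ v2 :+ (v3 :+ (v4 :+ (v4 :+ (v4 :+ con 0))))))))
        (con 1 :+ v0 :+ v1 :+ (con 3 :+ v2 :+ v3 :+ (v4 :+ (v4 :+ v4)))) [] [] tt tt

-- The randomized procedure: output, possible runs and failure probability

module Runs where

  open Prelude
  open import Data.List.Relation.Unary.All as All using (All)
  open import Data.Nat.Base as ℕ using (ℕ; suc; _+_; _*_; _^_; _≤_; _≤ᵇ_; z≤n; s≤s; NonZero)
  open import Data.Rational.Base as ℚ using (ℚ; 0ℚ; 1ℚ)
  import Data.Rational.Properties as ℚ
  open import Defs using (𝔽₂^; _⊞_; _≟_; points; Subset; elements; card; _⊕_; _∈_; _⊆_; Query; ⟦_⟧; #queries; Randomized; return; Pr; _⊢_⇓_⟨_,_⟩; Record; Output; FAIL; rec; isFAIL; Branch; high; low; CleanedFrom)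
  open Certificates using (certify; v0; v1; v2; v3; v4; con; _:+_; _:*_; _:≤_∶_; _×ʰ_)
  open Counting
  open Arithmetic
  open TailBounds
  open Algorithms
  open Soundness
  open Stages
  open Outcomes
  open Rationals
  open Probability
  open Oracles
  open Records

  memberOf : ∀ {n} → Data n → 𝔽₂^ n → Query n Bool
  memberOf (store c w₁ w₂ w₃) x =
    learn (sums w₁ (x ∷ centre c ∷ w₂ ++ w₃)) (λ _ → false) λ O → Membership.clean O w₁ w₂ w₃ c x

  branchOf : ∀ {n} → Data n → Branch n
  branchOf (store (high d θ)  w₁ w₂ w₃) = high d
  branchOf (store (low a j D) w₁ w₂ w₃) = low a λ v →
    learn (map (v ⊞_) w₁) (λ _ → false) λ O → Membership.popular O w₁ w₂ w₃ j v

  memberOf-clean : ∀ {n} (S : Subset n) c w₁ w₂ w₃ x → ⟦ memberOf (store c w₁ w₂ w₃) x ⟧ S ≡ Membership.clean S w₁ w₂ w₃ c x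
  memberOf-clean S c w₁ w₂ w₃ x = trans (⟦learn⟧ (sums w₁ V) _ _ S)
    (clean-agree {w₁ = w₁} {V = V} (learned-correct (λ _ → false) S) (λ y∈ → there (there (∈-++⁺ˡ y∈))) (λ y∈ → there (there (∈-++⁺ʳ w₂ y∈)))
      c (there (here refl)) (here refl))
    where V = x ∷ centre c ∷ w₂ ++ w₃

  branchOf-cleaned : ∀ {n} (S : Subset n) c w₁ w₂ w₃ → (∀ {a j D} → c ≡ low a j D → a ∈ S) →
    CleanedFrom S (branchOf (store c w₁ w₂ w₃)) (λ x → ⟦ memberOf (store c w₁ w₂ w₃) x ⟧ S)
  branchOf-cleaned S c@(high d θ) w₁ w₂ w₃ _ x x∈ =
    let Sx , Sd = T-∧⁻ {S x} (proj₁ (T-∧⁻ {Membership.base S w₁ w₂ w₃ c x} (subst T (memberOf-clean S c w₁ w₂ w₃ x) x∈)))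
    in Sx , subst (T ∘ S) (⊞-comm d x) Sd
  branchOf-cleaned {n} S c@(low a j D) w₁ w₂ w₃ a∈S = a∈S refl , λ x x∈ →
    let Sx , p = T-∧⁻ {S x} (proj₁ (T-∧⁻ {Membership.base S w₁ w₂ w₃ c x} (subst T (memberOf-clean S c w₁ w₂ w₃ x) x∈)))
    in Sx , subst T (sym (trans (⟦learn⟧ (map (a ⊞ x ⊞_) w₁) _ _ S) (cong (j ≤ᵇ_) (#-cong-∈ {n} w₁ λ s s∈ →
         learned-correct (λ _ → false) S (∈-map⁺ (a ⊞ x ⊞_) s∈))))) p

  memberOf-⊆ : ∀ {n} (S : Subset n) c w₁ w₂ w₃ → (λ x → ⟦ memberOf (store c w₁ w₂ w₃) x ⟧ S) ⊆ S
  memberOf-⊆ S c w₁ w₂ w₃ x x∈ = base⊆ c (proj₁ (T-∧⁻ {Membership.base S w₁ w₂ w₃ c x} (subst T (memberOf-clean S c w₁ w₂ w₃ x) x∈)))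
    where
    base⊆ : ∀ c → T (Membership.base S w₁ w₂ w₃ c x) → T (S x)
    base⊆ (high d θ)  h = proj₁ (T-∧⁻ {S x} h)
    base⊆ (low a j D) h = proj₁ (T-∧⁻ {S x} h)

  elements-cong : ∀ {n} {X Y : Subset n} → (∀ x → X x ≡ Y x) → elements X ≡ elements Y
  elements-cong {n} h = filterᵇ-cong-∈ {n} (points n) λ x _ → h x

  ⊕-cong : ∀ {n} {X Y : Subset n} → (∀ x → X x ≡ Y x) → ∀ x → (X ⊕ X) x ≡ (Y ⊕ Y) x
  ⊕-cong h x = cong (λ E → does (any? (λ s → any? (λ t → (s ⊞ t) ≟ x) E) E)) (elements-cong h)

  Guarantee-cong : ∀ {n} {S : Subset n} {B X Y P Q} → (∀ x → X x ≡ Y x) → (Q → P) → Guarantee S B X P → Guarantee S B Y Q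
  Guarantee-cong {S = S} {B} h f g = record
    { size          = subst (λ y → card S * 42 ≤ B * y * 128) cardY size
    ; doubling      = subst₂ (λ s y → s * 9 ≤ B * B * B * B * B * B * B * B * y * 2305843009213693952) cardYY cardY doubling
    ; high-doubling = λ q → subst₂ (λ s y → s * 9 ≤ B * B * B * B * B * B * y * 134217728) cardYY cardY (high-doubling (f q)) }
    where
    open Guarantee g
    cardY = cong length (elements-cong h)
    cardYY = cong length (elements-cong (⊕-cong h))

  module Run {n : ℕ} (B k₁ : ℕ) where

    k : ℕ
    k = k₁ * 8

    open Parameters B k

    private
      Pair : Set
      Pair = 𝔽₂^ n × 𝔽₂^ n

    report : (ω₁ ω₂ ω₃ : List Pair) → List (Candidate n) → Output
    report ω₁ ω₂ ω₃ []      = FAIL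
    report ω₁ ω₂ ω₃ (c ∷ _) = rec (encode m c (map proj₁ ω₁) (map proj₁ ω₂) (map proj₁ ω₃))

    search : (ω₁ ω₂ ω₃ ω₄ : List Pair) → Query n Output
    search ω₁ ω₂ ω₃ ω₄ = learn (sums (map proj₁ ω₁) (searchPoints ω₂ ω₃ ω₄)) (λ _ → false) λ O →
      report ω₁ ω₂ ω₃ (Search.accepted O B k ω₁ ω₂ ω₃ ω₄)

    finish : (ω₁ ω₂ ω₃ ω₄ : List Pair) → Randomized n Output
    finish ω₁ ω₂ ω₃ ω₄ = embed (search ω₁ ω₂ ω₃ ω₄) return

    after₃ : (ω₁ ω₂ ω₃ : List Pair) → Randomized n Output
    after₃ ω₁ ω₂ ω₃ = drawPairs m (finish ω₁ ω₂ ω₃)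

    after₂ : (ω₁ ω₂ : List Pair) → Randomized n Output
    after₂ ω₁ ω₂ = drawPairs m (after₃ ω₁ ω₂)

    after₁ : List Pair → Randomized n Output
    after₁ ω₁ = drawPairs m (after₂ ω₁)

    run : Randomized n Output
    run = drawPairs m after₁

    outcome : Subset n → (ω₁ ω₂ ω₃ ω₄ : List Pair) → Output
    outcome S ω₁ ω₂ ω₃ ω₄ = report ω₁ ω₂ ω₃ (Search.accepted S B k ω₁ ω₂ ω₃ ω₄)

    ⟦search⟧ : ∀ S ω₁ ω₂ ω₃ ω₄ → ⟦ search ω₁ ω₂ ω₃ ω₄ ⟧ S ≡ outcome S ω₁ ω₂ ω₃ ω₄
    ⟦search⟧ S ω₁ ω₂ ω₃ ω₄ = trans (⟦learn⟧ (sums (map proj₁ ω₁) (searchPoints ω₂ ω₃ ω₄)) _ _ S)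
      (cong (report ω₁ ω₂ ω₃) (accepted-agree B k ω₁ ω₂ ω₃ ω₄ (learned-correct (λ _ → false) S)))

    #queries-search : ∀ S ω₁ ω₂ ω₃ ω₄ → #queries (search ω₁ ω₂ ω₃ ω₄) S ≡ length (sums (map proj₁ ω₁) (searchPoints ω₂ ω₃ ω₄))
    #queries-search S ω₁ ω₂ ω₃ ω₄ = #queries-learn (sums (map proj₁ ω₁) (searchPoints ω₂ ω₃ ω₄)) _ _ S

    module _ (S : Subset n) where
      open Families S B k

      -- What the worst-case bounds need to know about an arbitrary possible run.
      record Trace (o : Output) (s q : ℕ) : Set where
        field
          ω₁ ω₂ ω₃ ω₄ : List Pair
          l₁ : length ω₁ ≡ m
          l₂ : length ω₂ ≡ m
          l₃ : length ω₃ ≡ m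
          l₄ : length ω₄ ≡ m
          in₄ : All (λ (x , y) → x ∈ S × y ∈ S) ω₄
          output  : o ≡ outcome S ω₁ ω₂ ω₃ ω₄
          samples : s ≡ m * 8
          queries : q ≡ length (sums (map proj₁ ω₁) (searchPoints ω₂ ω₃ ω₄))

      trace : ∀ {o s q} → S ⊢ run ⇓ o ⟨ s , q ⟩ → Trace o s q
      trace r₀ =
        let ω₁ , s₁ , l₁ , _ , e₁ , r₁ = run-drawPairs m {κ = after₁} r₀
            ω₂ , s₂ , l₂ , _ , e₂ , r₂ = run-drawPairs m {κ = after₂ ω₁} r₁
            ω₃ , s₃ , l₃ , _ , e₃ , r₃ = run-drawPairs m {κ = after₃ ω₁ ω₂} r₂
            ω₄ , s₄ , l₄ , in₄ , e₄ , r₄ = run-drawPairs m {κ = finish ω₁ ω₂ ω₃} r₃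
            q₁ , e₅ , r₅ = run-embed (search ω₁ ω₂ ω₃ ω₄) {κ = return} r₄
            o≡ , s₄≡0 , q₁≡0 = returned r₅
        in record
          { ω₁ = ω₁ ; ω₂ = ω₂ ; ω₃ = ω₃ ; ω₄ = ω₄ ; l₁ = l₁ ; l₂ = l₂ ; l₃ = l₃ ; l₄ = l₄ ; in₄ = in₄
          ; output  = trans o≡ (⟦search⟧ S ω₁ ω₂ ω₃ ω₄)
          ; samples = total e₁ e₂ e₃ e₄ s₄≡0
          ; queries = no-more e₅ q₁≡0 (#queries-search S ω₁ ω₂ ω₃ ω₄)
          }
        where
        returned : ∀ {o o′ s q} → S ⊢ return o′ ⇓ o ⟨ s , q ⟩ → o ≡ o′ × s ≡ 0 × q ≡ 0
        returned _⊢_⇓_⟨_,_⟩.return = refl , refl , refl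
        no-more : ∀ {q a q₁ b} → q ≡ a + q₁ → q₁ ≡ 0 → a ≡ b → q ≡ b
        no-more {a = a} refl refl refl = +-identityʳ a
        total : ∀ {s s₁ s₂ s₃ s₄} → s ≡ m + m + s₁ → s₁ ≡ m + m + s₂ → s₂ ≡ m + m + s₃ → s₃ ≡ m + m + s₄ → s₄ ≡ 0 → s ≡ m * 8
        total refl refl refl refl refl =
          Certificates.certify-≡ (m ∷ []) (v0 :+ v0 :+ (v0 :+ v0 :+ (v0 :+ v0 :+ (v0 :+ v0 :+ con 0)))) (v0 :* con 8) [] [] tt tt

      record Recorded (D : Record) (ω₁ ω₂ ω₃ ω₄ : List Pair) : Set where
        field
          c       : Candidate n
          c∈      : c ∈ˡ Search.accepted S B k ω₁ ω₂ ω₃ ω₄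
          record≡ : D ≡ encode m c (map proj₁ ω₁) (map proj₁ ω₂) (map proj₁ ω₃)

      recorded : ∀ {D ω₁ ω₂ ω₃ ω₄} → rec D ≡ outcome S ω₁ ω₂ ω₃ ω₄ → Recorded D ω₁ ω₂ ω₃ ω₄
      recorded {D} {ω₁} {ω₂} {ω₃} {ω₄} e = go (Search.accepted S B k ω₁ ω₂ ω₃ ω₄) refl e
        where
        go : ∀ cs → Search.accepted S B k ω₁ ω₂ ω₃ ω₄ ≡ cs → rec D ≡ report ω₁ ω₂ ω₃ cs → Recorded D ω₁ ω₂ ω₃ ω₄
        go (c ∷ cs) eq refl = record { c = c ; c∈ = subst (c ∈ˡ_) (sym eq) (here refl) ; record≡ = refl }

      decoded : ∀ {D ω₁ ω₂ ω₃ ω₄} → length ω₁ ≡ m → length ω₂ ≡ m → length ω₃ ≡ m → (r : Recorded D ω₁ ω₂ ω₃ ω₄) →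
        decode n D ≡ store (Recorded.c r) (map proj₁ ω₁) (map proj₁ ω₂) (map proj₁ ω₃)
      decoded {ω₁ = ω₁} {ω₂} {ω₃} l₁ l₂ l₃ r = trans (cong (decode n) (Recorded.record≡ r))
        (decode-encode (Recorded.c r) (trans (length-map proj₁ ω₁) l₁) (trans (length-map proj₁ ω₂) l₂) (trans (length-map proj₁ ω₃) l₃))

      module _ (1≤B : 1 ≤ B) (1≤k : 1 ≤ k) (1≤N : 1 ≤ card S) where

        Fairness : (ω₁ ω₂ ω₃ ω₄ : List Pair) → Set
        Fairness ω₁ ω₂ ω₃ ω₄ = Trial.AllFair S B k ω₁ ω₂ ω₃ ω₄

        fairness : ∀ ω₁ ω₂ ω₃ ω₄ → length ω₁ ≡ m → length ω₂ ≡ m →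
          T (repAll Ω m k₁ family₁ ω₁) → T (repAll Ω m k₁ (family₂ ω₁) ω₂) →
          T (repAll Ω m k₁ (family₃ ω₁ ω₂) ω₃) → T (repAll Ω m k₁ (family₄ ω₁ ω₂ ω₃) ω₄) → Fairness ω₁ ω₂ ω₃ ω₄
        fairness ω₁ ω₂ ω₃ ω₄ l₁ l₂ ok₁ ok₂ ok₃ ok₄ = allFair 1≤N {ω₁} {ω₂} {ω₃} {ω₄} l₁ l₂
          (repAll-sound Ω m k₁ {family₁} {ω₁} ok₁) (repAll-sound Ω m k₁ {family₂ ω₁} {ω₂} ok₂)
          (repAll-sound Ω m k₁ {family₃ ω₁ ω₂} {ω₃} ok₃) (repAll-sound Ω m k₁ {family₄ ω₁ ω₂ ω₃} {ω₄} ok₄)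

        module _ {K : ℕ} (rare : size * 2 * 2 ^ K ≤ 2 ^ k₁) where

          private
            1≤L′ : 1 ≤ length Ω
            1≤L′ = 1≤L S 1≤N isFAIL

            -- A family has at most `size` sets, each misjudged with probability at most
            -- `2 · 2 ^ (−k₁)`; `rare` says that these probabilities add up to at most `2 ^ (−K)`.
            few : ∀ family → length family ≤ size →
                  Σ^ Ω m (𝟙 ∘ not ∘ repAll Ω m k₁ family) * 2 ^ K ≤ length Ω ^ m
            few family le = *-cancelʳ-≤ _ _ (size * 2) {{>-nonZero 1≤size2}}
              (certify (F ∷ 2 ^ K ∷ size * 2 ∷ 2 ^ k₁ ∷ length Ω ^ m ∷ []) (v0 :* v1 :* v2) (v4 :* v2)
                ((v0 ×ʰ v2 :* v1 :≤ v3 ∶ rare) ∷ (v0 :* v3 :≤ v4 :* v2 ∶ bound) ∷ []) tt)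
              where
              F = Σ^ Ω m (𝟙 ∘ not ∘ repAll Ω m k₁ family)
              bound : F * 2 ^ k₁ ≤ length Ω ^ m * (size * 2)
              bound = ≤-trans (repAll-fails Ω m k₁ 1≤L′ family)
                (≤-trans (≤-reflexive (*-assoc (length Ω ^ m) 2 (length family)))
                  (*-monoʳ-≤ (length Ω ^ m) (≤-trans (*-monoʳ-≤ 2 le) (≤-reflexive (*-comm 2 size)))))
              1≤size2 : 1 ≤ size * 2
              1≤size2 = *-mono-≤ (*-mono-≤ (*-mono-≤ (≤-trans (s≤s (z≤n {1})) (m≤n+m 2 m)) (*-mono-≤ (m^n>0 2 n) (m^n>0 2 n))) (s≤s (z≤n {1}))) (s≤s (z≤n {1}))

            instance
              2^K≢0 : NonZero (2 ^ K)
              2^K≢0 = m^n≢0 2 K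

            ε = 1 ÷ 2 ^ K

            add-ε : ∀ a → ε ℚ.+ a ÷ 2 ^ K ≡ suc a ÷ 2 ^ K
            add-ε a = trans (÷-+ 1 (2 ^ K) a (2 ^ K) {{2^K≢0}} {{2^K≢0}} {{m*n≢0 (2 ^ K) (2 ^ K)}})
              (÷-≡ {1 * 2 ^ K + a * 2 ^ K} {2 ^ K * 2 ^ K} {suc a} {2 ^ K} {{m*n≢0 (2 ^ K) (2 ^ K)}}
                (trans (cong (_* 2 ^ K) (cong (_+ a * 2 ^ K) (*-identityˡ (2 ^ K)))) (*-assoc (suc a) (2 ^ K) (2 ^ K))))

          -- Each of the four stages adds `2 ^ (−K)`. When all of them succeed the estimates are
          -- fair, and the output avoids `E` with certainty.
          Pr-run : ∀ E → (∀ {ω₁ ω₂ ω₃ ω₄} → length ω₁ ≡ m → length ω₂ ≡ m → length ω₃ ≡ m →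
                            Fairness ω₁ ω₂ ω₃ ω₄ → E (outcome S ω₁ ω₂ ω₃ ω₄) ≡ false) →
                   Pr S run E ℚ.≤ 4 ÷ 2 ^ K
          Pr-run E avoid = subst (Pr S run E ℚ.≤_) (add-ε 3)
            (Pr-stage S 1≤N E m after₁ (repAll Ω m k₁ family₁) K (3 ÷ 2 ^ K) (0≤÷ 3 (2 ^ K)) (few family₁ length₁≤) λ ω₁ l₁ ok₁ →
             subst (Pr S (after₁ ω₁) E ℚ.≤_) (add-ε 2)
            (Pr-stage S 1≤N E m (after₂ ω₁) (repAll Ω m k₁ (family₂ ω₁)) K (2 ÷ 2 ^ K) (0≤÷ 2 (2 ^ K)) (few (family₂ ω₁) (length₂≤ ω₁)) λ ω₂ l₂ ok₂ →
             subst (Pr S (after₂ ω₁ ω₂) E ℚ.≤_) (add-ε 1)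
            (Pr-stage S 1≤N E m (after₃ ω₁ ω₂) (repAll Ω m k₁ (family₃ ω₁ ω₂)) K (1 ÷ 2 ^ K) (0≤÷ 1 (2 ^ K)) (few (family₃ ω₁ ω₂) (length₃≤ ω₁ ω₂)) λ ω₃ l₃ ok₃ →
             subst (Pr S (after₃ ω₁ ω₂ ω₃) E ℚ.≤_) (add-ε 0)
            (Pr-stage S 1≤N E m (finish ω₁ ω₂ ω₃) (repAll Ω m k₁ (family₄ ω₁ ω₂ ω₃)) K (0 ÷ 2 ^ K) (0≤÷ 0 (2 ^ K)) (few (family₄ ω₁ ω₂ ω₃) (length₄≤ ω₁ ω₂ ω₃)) λ ω₄ l₄ ok₄ →
             ℚ.≤-trans (ℚ.≤-reflexive (trans (Pr-embed S (search ω₁ ω₂ ω₃ ω₄) return E)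
                 (cong (if_then 1ℚ else 0ℚ) (trans (cong E (⟦search⟧ S ω₁ ω₂ ω₃ ω₄)) (avoid {ω₁} {ω₂} {ω₃} {ω₄} l₁ l₂ l₃
                   (fairness ω₁ ω₂ ω₃ ω₄ l₁ l₂ ok₁ ok₂ ok₃ ok₄))))))
               (0≤÷ 0 (2 ^ K))))))

-- Upper cuts, logarithms and the dyadic location of a real

module Reals where

  open Prelude
  open import Data.Integer.Base as ℤ using (+_; ∣_∣)
  import Data.Integer.Properties as ℤ
  open import Data.Nat.Base as ℕ using (ℕ; zero; suc; NonZero; z≤n; s≤s)
  import Data.Nat.Properties as ℕ
  open import Data.Rational.Base as ℚ using (ℚ; 0ℚ; 1ℚ; ↥_; ↧ₙ_)
  import Data.Rational.Properties as ℚ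
  open import Defs using (OpenUnit; module OpenUnit; UpperCut; fromℚ; fromℕ; _⁻¹; log₂)
  import Defs as R
  open Certificates
  open Rationals

  ≤-transᶜ : ∀ {x y z : UpperCut} → x R.≤ y → y R.≤ z → x R.≤ z
  ≤-transᶜ f g q zq = f q (g q zq)

  fromℚ-mono : ∀ {p r} → p ℚ.≤ r → fromℚ p R.≤ fromℚ r
  fromℚ-mono p≤r q r<q = ℚ.≤-<-trans p≤r r<q

  fromℚ-mono⁻ : ∀ {p r} → fromℚ p R.≤ fromℚ r → p ℚ.≤ r
  fromℚ-mono⁻ {p} {r} h = ℚ.≮⇒≥ λ r<p → ℚ.<-irrefl refl (h p r<p)

  *-monoᶜ : ∀ {x x′ y y′ : UpperCut} → x R.≤ x′ → y R.≤ y′ → x R.* y R.≤ x′ R.* y′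
  *-monoᶜ f g q (u , v , xu , yv , le) = u , v , f u xu , g v yv , le

  +-monoᶜ : ∀ {x x′ y y′ : UpperCut} → x R.≤ x′ → y R.≤ y′ → x R.+ y R.≤ x′ R.+ y′
  +-monoᶜ f g q (u , v , xu , yv , le) = u , v , f u xu , g v yv , le

  fromℚ-+-≤ : ∀ {p r} → fromℚ (p ℚ.+ r) R.≤ fromℚ p R.+ fromℚ r
  fromℚ-+-≤ q (u , v , p<u , r<v , le) = ℚ.<-≤-trans (ℚ.+-mono-< p<u r<v) le

  fromℚ-*-≤ : ∀ {p r} → 0ℚ ℚ.≤ p → 0ℚ ℚ.≤ r → fromℚ (p ℚ.* r) R.≤ fromℚ p R.* fromℚ r
  fromℚ-*-≤ {p} {r} 0≤p 0≤r q (u , v , p<u , r<v , le) = begin-strict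
    p ℚ.* r   ≤⟨ ℚ.*-monoʳ-≤-nonNeg r {{ℚ.nonNegative 0≤r}} (ℚ.<⇒≤ p<u) ⟩
    u ℚ.* r   <⟨ ℚ.*-monoʳ-<-pos u {{ℚ.positive (ℚ.≤-<-trans 0≤p p<u)}} r<v ⟩
    u ℚ.* v   ≤⟨ le ⟩
    q         ∎
    where open ℚ.≤-Reasoning

  -- With ε = min(1, (q − p r) / (p + r + 1)), (p + ε)(r + ε) ≤ q.
  ≤-fromℚ-* : ∀ {p r} → 0ℚ ℚ.≤ p → 0ℚ ℚ.≤ r → fromℚ p R.* fromℚ r R.≤ fromℚ (p ℚ.* r)
  ≤-fromℚ-* {p} {r} 0≤p 0≤r q pr<q = p ℚ.+ ε , r ℚ.+ ε , above p , above r , bound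
    where
    open ℚ.≤-Reasoning
    c = p ℚ.+ r ℚ.+ 1ℚ
    0<c : 0ℚ ℚ.< c
    0<c = ℚ.+-mono-≤-< (ℚ.+-mono-≤ 0≤p 0≤r) (0<÷ 1 1)
    instance
      c-pos : ℚ.Positive c
      c-pos = ℚ.positive 0<c
      c≢0 : ℚ.NonZero c
      c≢0 = ℚ.pos⇒nonZero c
    s = q ℚ.- p ℚ.* r
    0<s : 0ℚ ℚ.< s
    0<s = subst (ℚ._< s) (ℚ.+-inverseʳ (p ℚ.* r)) (ℚ.+-monoˡ-< (ℚ.- (p ℚ.* r)) pr<q)
    ε₀ = s ℚ.* ℚ.1/ c
    ε = ε₀ ℚ.⊓ 1ℚ
    0<ε₀ : 0ℚ ℚ.< ε₀
    0<ε₀ = subst (ℚ._< ε₀) (ℚ.*-zeroˡ (ℚ.1/ c)) (ℚ.*-monoˡ-<-pos (ℚ.1/ c) {{ℚ.1/pos⇒pos c}} 0<s)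
    0<ε : 0ℚ ℚ.< ε
    0<ε with ℚ.⊓-sel ε₀ 1ℚ
    ... | inj₁ e = subst (0ℚ ℚ.<_) (sym e) 0<ε₀
    ... | inj₂ e = subst (0ℚ ℚ.<_) (sym e) (0<÷ 1 1)
    above : ∀ p → p ℚ.< p ℚ.+ ε
    above p = subst (ℚ._< p ℚ.+ ε) (ℚ.+-identityʳ p) (ℚ.+-monoʳ-< p 0<ε)
    expand : (p ℚ.+ ε) ℚ.* (r ℚ.+ ε) ≡ p ℚ.* r ℚ.+ ε ℚ.* (p ℚ.+ r ℚ.+ ε)
    expand = begin-equality
      (p ℚ.+ ε) ℚ.* (r ℚ.+ ε)                                   ≡⟨ ℚ.*-distribʳ-+ (r ℚ.+ ε) p ε ⟩
      p ℚ.* (r ℚ.+ ε) ℚ.+ ε ℚ.* (r ℚ.+ ε)                       ≡⟨ cong (ℚ._+ ε ℚ.* (r ℚ.+ ε)) (ℚ.*-distribˡ-+ p r ε) ⟩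
      p ℚ.* r ℚ.+ p ℚ.* ε ℚ.+ ε ℚ.* (r ℚ.+ ε)                   ≡⟨ ℚ.+-assoc (p ℚ.* r) (p ℚ.* ε) _ ⟩
      p ℚ.* r ℚ.+ (p ℚ.* ε ℚ.+ ε ℚ.* (r ℚ.+ ε))                 ≡⟨ cong (λ z → p ℚ.* r ℚ.+ (z ℚ.+ ε ℚ.* (r ℚ.+ ε))) (ℚ.*-comm p ε) ⟩
      p ℚ.* r ℚ.+ (ε ℚ.* p ℚ.+ ε ℚ.* (r ℚ.+ ε))                 ≡⟨ cong (p ℚ.* r ℚ.+_) (sym (ℚ.*-distribˡ-+ ε p (r ℚ.+ ε))) ⟩
      p ℚ.* r ℚ.+ ε ℚ.* (p ℚ.+ (r ℚ.+ ε))                       ≡⟨ cong (λ z → p ℚ.* r ℚ.+ ε ℚ.* z) (sym (ℚ.+-assoc p r ε)) ⟩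
      p ℚ.* r ℚ.+ ε ℚ.* (p ℚ.+ r ℚ.+ ε)                         ∎
    bound : (p ℚ.+ ε) ℚ.* (r ℚ.+ ε) ℚ.≤ q
    bound = begin
      (p ℚ.+ ε) ℚ.* (r ℚ.+ ε)               ≡⟨ expand ⟩
      p ℚ.* r ℚ.+ ε ℚ.* (p ℚ.+ r ℚ.+ ε)     ≤⟨ ℚ.+-monoʳ-≤ (p ℚ.* r) (ℚ.*-monoˡ-≤-nonNeg ε {{ℚ.nonNegative (ℚ.<⇒≤ 0<ε)}}
                                                 (ℚ.+-monoʳ-≤ (p ℚ.+ r) (ℚ.p⊓q≤q ε₀ 1ℚ))) ⟩
      p ℚ.* r ℚ.+ ε ℚ.* c                   ≤⟨ ℚ.+-monoʳ-≤ (p ℚ.* r) (ℚ.*-monoʳ-≤-nonNeg c {{ℚ.nonNegative (ℚ.<⇒≤ 0<c)}} (ℚ.p⊓q≤p ε₀ 1ℚ)) ⟩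
      p ℚ.* r ℚ.+ s ℚ.* ℚ.1/ c ℚ.* c        ≡⟨ cong (p ℚ.* r ℚ.+_) (trans (ℚ.*-assoc s (ℚ.1/ c) c) (trans (cong (s ℚ.*_) (ℚ.*-inverseˡ c)) (ℚ.*-identityʳ s))) ⟩
      p ℚ.* r ℚ.+ s                         ≡⟨ ℚ.+-comm (p ℚ.* r) s ⟩
      q ℚ.- p ℚ.* r ℚ.+ p ℚ.* r             ≡⟨ ℚ.+-assoc q _ _ ⟩
      q ℚ.+ (ℚ.- (p ℚ.* r) ℚ.+ p ℚ.* r)     ≡⟨ cong (q ℚ.+_) (ℚ.+-inverseˡ (p ℚ.* r)) ⟩
      q ℚ.+ 0ℚ                              ≡⟨ ℚ.+-identityʳ q ⟩
      q                                     ∎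

  *-lower : ∀ {x y : UpperCut} a b c d .{{_ : NonZero b}} .{{_ : NonZero d}} .{{_ : NonZero (b ℕ.* d)}} →
            fromℚ (a ÷ b) R.≤ x → fromℚ (c ÷ d) R.≤ y → fromℚ ((a ℕ.* c) ÷ (b ℕ.* d)) R.≤ x R.* y
  *-lower a b c d f g = ≤-transᶜ (fromℚ-mono (ℚ.≤-reflexive (sym (÷-* a b c d))))
    (≤-transᶜ (fromℚ-*-≤ (0≤÷ a b) (0≤÷ c d)) (*-monoᶜ f g))

  ^-lower : ∀ {x : UpperCut} a b .{{b≢0 : NonZero b}} k → fromℚ (a ÷ b) R.≤ x → fromℚ (_÷_ (a ℕ.^ k) (b ℕ.^ k) {{ℕ.m^n≢0 b k}}) R.≤ x R.^ k
  ^-lower a b {{b≢0}} zero    f = λ q h → h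
  ^-lower a b {{b≢0}} (suc k) f = *-lower a b (a ℕ.^ k) (b ℕ.^ k) {{b≢0}} {{ℕ.m^n≢0 b k}} {{ℕ.m^n≢0 b (suc k)}} f (^-lower a b k f)

  +-lower : ∀ {x y : UpperCut} a b → fromℕ a R.≤ x → fromℕ b R.≤ y → fromℕ (a ℕ.+ b) R.≤ x R.+ y
  +-lower a b f g = ≤-transᶜ (fromℚ-mono (ℚ.≤-reflexive (sym (↑-+ a b)))) (≤-transᶜ fromℚ-+-≤ (+-monoᶜ f g))

  -- If `q ≤ p`, openness gives a point of the lower cut above `p`; by lowering it, `q` lies in both
  -- cuts, against disjointness.
  L<U : ∀ (x : OpenUnit) {p q} → OpenUnit.L x p → OpenUnit.U x q → p ℚ.< q
  L<U x {p} {q} Lp Uq with p ℚ.<? q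
  ... | yes p<q = p<q
  ... | no ¬p<q =
    let p′ , p<p′ , Lp′ = OpenUnit.L-open x Lp
    in ⊥-elim (OpenUnit.disjoint x (OpenUnit.L-lower x (ℚ.≤-<-trans (ℚ.≮⇒≥ ¬p<q) p<p′) Lp′) Uq)

  ⁻¹-lower : ∀ (x : OpenUnit) a b .{{a≢0 : NonZero a}} .{{b≢0 : NonZero b}} → OpenUnit.U x (a ÷ b) → fromℚ (b ÷ a) R.≤ x ⁻¹
  ⁻¹-lower x a b {{a≢0}} {{b≢0}} Uab q (c , 0<c , Lc , 1≤cq) with q ℚ.≤? b ÷ a
  ... | no ¬p = ℚ.≰⇒> ¬p
  ... | yes q≤ = ⊥-elim (ℚ.<-irrefl refl (begin-strict
    1ℚ                     ≤⟨ 1≤cq ⟩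
    c ℚ.* q                ≤⟨ ℚ.*-monoˡ-≤-nonNeg c {{ℚ.nonNegative (ℚ.<⇒≤ 0<c)}} q≤ ⟩
    c ℚ.* (b ÷ a)          <⟨ ℚ.*-monoˡ-<-pos (b ÷ a) {{ℚ.positive (0<÷ b a)}} (L<U x Lc Uab) ⟩
    (a ÷ b) ℚ.* (b ÷ a)    ≡⟨ trans (÷-* a b b a {{b≢0}} {{a≢0}} {{ℕ.m*n≢0 b a}}) (÷-≡ {a ℕ.* b} {b ℕ.* a} {1} {1} {{ℕ.m*n≢0 b a}}
                                (trans (ℕ.*-identityʳ (a ℕ.* b)) (trans (ℕ.*-comm a b) (sym (ℕ.*-identityˡ (b ℕ.* a)))))) ⟩
    1ℚ                     ∎))
    where open ℚ.≤-Reasoning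

  log₂-nonneg : ∀ (x : UpperCut) → fromℕ 0 R.≤ log₂ x
  log₂-nonneg x q (0<q , _) = 0<q

  -- For `p/d` above `log₂ x`, `2 ^ (e d) ≤ x ^ d < 2 ^ p`, hence `e d < p`.
  log₂-lower : ∀ {x : UpperCut} e → fromℚ ((2 ℕ.^ e) ÷ 1) R.≤ x → fromℕ e R.≤ log₂ x
  log₂-lower {x} e f q (0<q , h) = subst (↑ e ℚ.<_) q≡ (÷-< {e} {1} {p} {d} (subst (e ℕ.* d ℕ.<_) (sym (ℕ.*-identityʳ p)) ed<p))
    where
    p = ∣ ↥ q ∣
    d = ↧ₙ q
    q≡ : p ÷ d ≡ q
    q≡ = trans (cong (ℚ._/ d) (ℤ.0≤i⇒+∣i∣≡i (ℤ.<⇒≤ (ℚ.drop-*<* 0<q |> subst₂ ℤ._<_ (ℤ.*-zeroˡ (ℚ.↧ q)) (ℤ.*-identityʳ (↥ q)))))) (ℚ.↥p/↧p≡p q)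
      where
      _|>_ : ∀ {A B : Set} → A → (A → B) → B
      y |> g = g y
    powers : (2 ℕ.^ e) ℕ.^ d ℕ.< 2 ℕ.^ p
    powers = ℕ.≰⇒> λ le → ℚ.<-irrefl refl (ℚ.<-≤-trans (^-lower (2 ℕ.^ e) 1 d f (↑ (2 ℕ.^ p)) h)
      (÷-≤ {2 ℕ.^ p} {1} {(2 ℕ.^ e) ℕ.^ d} {1 ℕ.^ d} {{_}} {{ℕ.m^n≢0 1 d}}
        (subst₂ ℕ._≤_ (sym (trans (cong (2 ℕ.^ p ℕ.*_) (ℕ.^-zeroˡ d)) (ℕ.*-identityʳ _))) (sym (ℕ.*-identityʳ _)) le)))
    ed<p : e ℕ.* d ℕ.< p
    ed<p = ℕ.≰⇒> λ p≤ed → ℕ.<⇒≱ powers (ℕ.≤-trans (ℕ.^-monoʳ-≤ 2 p≤ed) (ℕ.≤-reflexive (sym (ℕ.^-*-assoc 2 e d))))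

  -- i is found by locating x in turn between 15/16 · 4⁻ⁱ and 4⁻ⁱ, i = 0, 1, …
  record Scaled (x : OpenUnit) : Set where
    constructor scaled
    field
      i     : ℕ
      -- Quantifying over `M` with an equation lets the denominator be `4 ^ i` or `B * B` without
      -- rewriting inside a fraction.
      above : ∀ {M} .{{_ : NonZero M}} → M ≡ 4 ℕ.^ i → OpenUnit.L x (_÷_ 15 (M ℕ.* 16) {{ℕ.m*n≢0 M 16}})
      below : ∀ {M} .{{_ : NonZero M}} → M ≡ 4 ℕ.^ i → OpenUnit.U x (4 ÷ M)

  module _ (x : OpenUnit) where
    open OpenUnit x

    private
      4^-nz : ∀ i → NonZero (4 ℕ.^ i)
      4^-nz i = ℕ.m^n≢0 4 i

      lo hi : ℕ → ℚ
      lo i = _÷_ 15 (4 ℕ.^ i ℕ.* 16) {{ℕ.m*n≢0 (4 ℕ.^ i) 16 {{4^-nz i}}}}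
      hi i = _÷_ 4 (4 ℕ.^ i) {{4^-nz i}}

      hi-suc : ∀ i → hi (suc i) ≡ _÷_ 1 (4 ℕ.^ i) {{4^-nz i}}
      hi-suc i = ÷-≡ {4} {4 ℕ.^ suc i} {1} {4 ℕ.^ i} {{4^-nz (suc i)}} {{4^-nz i}} (sym (ℕ.*-identityˡ (4 ℕ.^ suc i)))

      lo<hi : ∀ i → lo i ℚ.< hi (suc i)
      lo<hi i = subst (lo i ℚ.<_) (sym (hi-suc i)) (÷-< {15} {M ℕ.* 16} {1} {M} {{ℕ.m*n≢0 M 16 {{4^-nz i}}}} {{4^-nz i}}
        (certify (M ∷ []) (con 1 :+ con 15 :* v0) (con 1 :* (v0 :* con 16)) ((con 1 :≤ v0 ∶ ℕ.m^n>0 4 i) ∷ []) tt))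
        where M = 4 ℕ.^ i

      -- Not by `with', which would normalise the gcds in lo and hi.
      Bracket : Set
      Bracket = ∃[ i ] L (lo i) × U (hi i)

      -- The invariant is that `lo` at index `i + fuel` lies below `x`, so the search ends at that
      -- index at the latest.
      search : ∀ fuel i → L (lo (i ℕ.+ fuel)) → U (hi i) → Bracket
      decide : ∀ fuel i → L (lo (i ℕ.+ suc fuel)) → L (lo i) ⊎ U (hi (suc i)) → U (hi i) → Bracket
      search zero       i Ll Uh = i , subst (λ j → L (lo j)) (ℕ.+-identityʳ i) Ll , Uh
      search (suc fuel) i Ll Uh = decide fuel i Ll (located (lo<hi i)) Uh
      decide fuel i Ll (inj₁ Li) Uh = i , Li , Uh
      decide fuel i Ll (inj₂ Ui) Uh = search fuel (suc i) (subst (λ j → L (lo j)) (ℕ.+-suc i fuel) Ll) Ui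

      n<4^n : ∀ n → n ℕ.< 4 ℕ.^ n
      n<4^n zero    = s≤s z≤n
      n<4^n (suc n) = ℕ.≤-trans (ℕ.+-mono-≤ (ℕ.m^n>0 4 n) (n<4^n n)) (ℕ.+-monoʳ-≤ (4 ℕ.^ n) (ℕ.m≤m+n (4 ℕ.^ n) _))

      lo<inverse : ∀ F .{{_ : NonZero F}} → lo F ℚ.< 1 ÷ F
      lo<inverse F = ÷-< {15} {4 ℕ.^ F ℕ.* 16} {1} {F} {{ℕ.m*n≢0 (4 ℕ.^ F) 16 {{4^-nz F}}}}
        (certify (4 ℕ.^ F ∷ F ∷ []) (con 1 :+ con 15 :* v1) (con 1 :* (v0 :* con 16)) ((con 16 ×ʰ con 1 :+ v1 :≤ v0 ∶ n<4^n F) ∷ []) tt)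

      inverse≤ : ∀ p → 0ℚ ℚ.< p → 1 ÷ ↧ₙ p ℚ.≤ p
      inverse≤ p 0<p = subst (1 ÷ ↧ₙ p ℚ.≤_) (trans (cong (ℚ._/ ↧ₙ p) num≡) (ℚ.↥p/↧p≡p p))
        (÷-≤ {1} {↧ₙ p} {∣ ↥ p ∣} {↧ₙ p} (ℕ.*-monoˡ-≤ (↧ₙ p) 1≤num))
        where
        0<num : + 0 ℤ.< ↥ p
        0<num = subst₂ ℤ._<_ (ℤ.*-zeroˡ (ℚ.↧ p)) (ℤ.*-identityʳ (↥ p)) (ℚ.drop-*<* 0<p)
        num≡ : + ∣ ↥ p ∣ ≡ ↥ p
        num≡ = ℤ.0≤i⇒+∣i∣≡i (ℤ.<⇒≤ 0<num)
        1≤num : 1 ℕ.≤ ∣ ↥ p ∣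
        1≤num = ℤ.drop‿+<+ (subst (+ 0 ℤ.<_) (sym num≡) 0<num)

      lo-below : ∀ p F .{{_ : NonZero F}} → 1 ÷ F ℚ.≤ p → L p → L (lo F)
      lo-below p F le Lp = L-lower (ℚ.<-≤-trans (lo<inverse F) le) Lp

      -- Openness at 0 gives a positive `p` below `x`; its denominator `F` satisfies `1 / F ≤ p`,
      -- and `lo F < 1 / F`.
      eventually : ∃[ F ] L (lo F)
      eventually = let p , 0<p , Lp = L-open positive in ↧ₙ p , lo-below p (↧ₙ p) (inverse≤ p 0<p) Lp

      U₄ : U (hi 0)
      U₄ = U-upper (÷-< {1} {1} {4} {1} (s≤s (s≤s z≤n))) below-1

      retype : ∀ {M M′} .{{nz : NonZero M}} .{{nz′ : NonZero M′}} → M ≡ M′ → ∀ (P : ℚ → Set) a → P (_÷_ a M′ {{nz′}}) → P (_÷_ a M {{nz}})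
      retype refl P a h = h

    approximate : Scaled x
    approximate = let F , LF = eventually ; i , Li , Ui = search F 0 LF U₄ in scaled i
      (λ {M} {{nz}} e → retype {{ℕ.m*n≢0 M 16 {{nz}}}} {{ℕ.m*n≢0 (4 ℕ.^ i) 16 {{4^-nz i}}}} (cong (ℕ._* 16) e) L 15 Li)
      (λ {M} {{nz}} e → retype {{nz}} {{4^-nz i}} e U 4 Ui)

-- From integer estimates in `B` and `κ` to real ones in `α` and `Λ`

module Estimates where

  open Prelude
  open import Data.Rational.Base as ℚ using (ℚ; 0ℚ)
  import Data.Rational.Properties as ℚ
  open import Defs using (OpenUnit; module OpenUnit; UpperCut; fromℚ; fromℕ; ⌜_⌝; _⁻¹; √; log₂; c-BSG)
  import Defs as R
  open Certificates
  open Rationals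
  open Reals

  double≤2^ : ∀ u → 1 ≤ u → u * 2 ≤ 2 ^ u
  double≤2^ 1             _ = ≤-refl
  double≤2^ (suc (suc u)) _ = certify (u ∷ 2 ^ suc u ∷ []) ((con 2 :+ v0) :* con 2) (con 2 :* v1)
    ((con 2 ×ʰ (con 1 :+ v0) :* con 2 :≤ v1 ∶ double≤2^ (suc u) (s≤s z≤n)) ∷ []) tt

  4^≡2^*2^ : ∀ i → 4 ^ i ≡ 2 ^ i * 2 ^ i
  4^≡2^*2^ i = trans (^-*-assoc 2 2 i) (trans (cong (2 ^_) (cong (i +_) (+-identityʳ i))) (^-distribˡ-+-* 2 i i))

  -- 2 ^ lg i ≤ 4 ^ i / 4 unless i = 0.
  lg : ℕ → ℕ
  lg zero    = 0
  lg (suc i) = i + i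

  lg-lower : ∀ (x : OpenUnit) i → (∀ {M} .{{_ : NonZero M}} → M ≡ 4 ^ i → OpenUnit.U x (4 ÷ M)) → fromℕ (lg i) R.≤ log₂ (x ⁻¹)
  lg-lower x zero    _ = log₂-nonneg (x ⁻¹)
  lg-lower x (suc i) U = log₂-lower (i + i) (≤-transᶜ
    (fromℚ-mono (÷-≤ {2 ^ (i + i)} {1} {M} {4} (≤-trans (≤-reflexive eq) (≤-reflexive (sym (*-identityʳ M))))))
    (⁻¹-lower x 4 M {{_}} {{M≢0}} (U {{M≢0}} refl)))
    where
    M = 4 ^ suc i
    M≢0 = m^n≢0 4 (suc i)
    eq : 2 ^ (i + i) * 4 ≡ M
    eq = trans (*-comm (2 ^ (i + i)) 4) (cong (4 *_) (trans (^-distribˡ-+-* 2 i i) (sym (4^≡2^*2^ i))))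

  i≤lg+1 : ∀ i → i ≤ lg i + 1
  i≤lg+1 zero    = z≤n
  i≤lg+1 (suc i) = certify (i ∷ []) (con 1 :+ v0) (v0 :+ v0 :+ con 1) [] tt

  below-⌜⌝ : ∀ (x : OpenUnit) {p} → OpenUnit.L x p → fromℚ p R.≤ ⌜ x ⌝
  below-⌜⌝ x Lp q Uq = L<U x Lp Uq

  √-upper : ∀ (x : OpenUnit) B .{{_ : NonZero B}} .{{_ : NonZero (B * B)}} → OpenUnit.U x (4 ÷ (B * B)) → √ ⌜ x ⌝ R.≤ fromℚ (2 ÷ B)
  √-upper x B U q 2/B<q = 0<q , OpenUnit.U-upper x (begin-strict
    4 ÷ (B * B)          ≡⟨ sym (÷-* 2 B 2 B) ⟩
    (2 ÷ B) ℚ.* (2 ÷ B)  ≤⟨ ℚ.*-monoʳ-≤-nonNeg (2 ÷ B) {{ℚ.nonNegative (0≤÷ 2 B)}} (ℚ.<⇒≤ 2/B<q) ⟩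
    q ℚ.* (2 ÷ B)        <⟨ ℚ.*-monoʳ-<-pos q {{ℚ.positive 0<q}} 2/B<q ⟩
    q ℚ.* q              ∎) U
    where
    open ℚ.≤-Reasoning
    0<q : 0ℚ ℚ.< q
    0<q = ℚ.≤-<-trans (0≤÷ 2 B) 2/B<q

  -- Split `2 ^ (50 κ)` as `Z * Z`. One factor pays for `P² Q² W 2 ^ 22`, whose exponent
  -- `2 i + 2 n + 2 ℓ + 25` is at most `25 κ`. The other pays for the linear factor `50 κ` in the
  -- sample size.
  rare-failures : ∀ n i ℓ κ → n + i + ℓ + 1 ≤ κ →
    (2 ^ i * 2 ^ i * (κ * 50 * 8) * 65536 + 2) * (2 ^ n * 2 ^ n) * 2 * 2 * 2 ^ (ℓ + ℓ + 3) ≤ 2 ^ (κ * 50)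
  rare-failures n i ℓ κ h = ≤-trans main (≤-reflexive 2^k₁)
    where
    u = κ * 25
    1≤κ : 1 ≤ κ
    1≤κ = ≤-trans (m≤n+m 1 (n + i + ℓ)) h
    P = 2 ^ i
    Q = 2 ^ n
    W = 2 ^ (ℓ + ℓ + 3)
    Z = 2 ^ u
    2^k₁ : Z * Z ≡ 2 ^ (κ * 50)
    2^k₁ = trans (sym (^-distribˡ-+-* 2 u u)) (cong (2 ^_) (sym (*-distribˡ-+ κ 25 25)))
    k₁≤Z : κ * 50 ≤ Z
    k₁≤Z = ≤-trans (≤-reflexive (sym (*-assoc κ 25 2))) (double≤2^ u (*-mono-≤ 1≤κ (s≤s {n = 24} z≤n)))
    powers : P * P * (Q * Q) * W * 4194304 ≤ Z
    powers = ≤-trans (≤-reflexive eq) (^-monoʳ-≤ 2 (certify (n ∷ i ∷ ℓ ∷ κ ∷ []) (v1 :+ v1 :+ (v0 :+ v0) :+ (v2 :+ v2 :+ con 3) :+ con 22) (v3 :* con 25)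
        ((con 25 ×ʰ v0 :+ v1 :+ v2 :+ con 1 :≤ v3 ∶ h) ∷ []) tt))
      where
      eq : P * P * (Q * Q) * W * 2 ^ 22 ≡ 2 ^ (i + i + (n + n) + (ℓ + ℓ + 3) + 22)
      eq = sym (trans (^-distribˡ-+-* 2 (i + i + (n + n) + (ℓ + ℓ + 3)) 22) (cong (_* 2 ^ 22)
        (trans (^-distribˡ-+-* 2 (i + i + (n + n)) (ℓ + ℓ + 3)) (cong (_* W)
          (trans (^-distribˡ-+-* 2 (i + i) (n + n)) (cong₂ _*_ (^-distribˡ-+-* 2 i i) (^-distribˡ-+-* 2 n n)))))))
    2≤m : 2 ≤ P * P * (κ * 50 * 8) * 65536
    2≤m = *-mono-≤ (*-mono-≤ (*-mono-≤ (m^n>0 2 i) (m^n>0 2 i)) (*-mono-≤ (*-mono-≤ 1≤κ (s≤s (z≤n {49}))) (s≤s (z≤n {7})))) (s≤s (s≤s (z≤n {65534})))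
    main : (P * P * (κ * 50 * 8) * 65536 + 2) * (Q * Q) * 2 * 2 * W ≤ Z * Z
    main = certify (P ∷ Q ∷ W ∷ Z ∷ κ ∷ []) ((v0 :* v0 :* (v4 :* con 50 :* con 8) :* con 65536 :+ con 2) :* (v1 :* v1) :* con 2 :* con 2 :* v2) (v3 :* v3)
      ((v1 :* v1 :* v2 :* con 4 ×ʰ con 2 :≤ v0 :* v0 :* (v4 :* con 50 :* con 8) :* con 65536 ∶ 2≤m) ∷
       (v4 :* con 50 ×ʰ v0 :* v0 :* (v1 :* v1) :* v2 :* con 4194304 :≤ v3 ∶ powers) ∷
       (v3 ×ʰ v4 :* con 50 :≤ v3 ∶ k₁≤Z) ∷ []) tt

  module Bounds (α : OpenUnit) (Λ₀ : UpperCut) (B κ : ℕ) (1≤B : 1 ≤ B) (1≤κ : 1 ≤ κ)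
                (α⁻¹≥ : fromℚ ((B * B) ÷ 4) R.≤ α ⁻¹) (Λ≥ : fromℚ (κ ÷ 4) R.≤ Λ₀) where

    private
      same : ∀ {c : UpperCut} → c R.≤ c
      same q h = h

      1≤x : 1 ≤ B * B * κ
      1≤x = *-mono-≤ (*-mono-≤ 1≤B 1≤B) 1≤κ

      1≤BB : 1 ≤ B * B
      1≤BB = *-mono-≤ 1≤B 1≤B

      1≤κκ : 1 ≤ κ * κ
      1≤κκ = *-mono-≤ 1≤κ 1≤κ

    -- `262144 = 4 ^ 9` covers the worst loss, in `queries-cut`: `α⁻¹ ≥ B² / 4` is used to the
    -- fourth power and `Λ ≥ κ / 4` to the fifth.
    module _ {C K : ℕ} (C≤K : C * 262144 ≤ K) where

      samples-cut : ∀ {s} → s ≤ B * B * κ * C → fromℕ s R.≤ fromℕ K R.* (α ⁻¹) R.^ 2 R.* Λ₀ R.^ 4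
      samples-cut {s} h = ≤-transᶜ (fromℚ-mono (÷-≤ {s} {1} {K * (B * B) ^ 2 * κ ^ 4} {1 * 4 ^ 2 * 4 ^ 4}
          (certify (B ∷ κ ∷ C ∷ K ∷ s ∷ []) (v4 :* (con 1 :* con 4 :^ 2 :* con 4 :^ 4)) (v3 :* (v0 :* v0) :^ 2 :* v1 :^ 4 :* con 1)
            ((con 4096 ×ʰ v4 :≤ v0 :* v0 :* v1 :* v2 ∶ h) ∷
             (v2 :* v0 :* v0 :* v1 :* con 262144 ×ʰ con 1 :≤ v0 :* v0 :* v1 :* (v1 :* v1) ∶ *-mono-≤ 1≤x 1≤κκ) ∷
             ((v0 :* v0) :^ 2 :* v1 :^ 4 ×ʰ v2 :* con 262144 :≤ v3 ∶ C≤K) ∷ []) tt)))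
        (*-lower (K * (B * B) ^ 2) (1 * 4 ^ 2) (κ ^ 4) (4 ^ 4) (*-lower K 1 ((B * B) ^ 2) (4 ^ 2) same (^-lower (B * B) 4 2 α⁻¹≥)) (^-lower κ 4 4 Λ≥))

      -- The count is cubic in `B² κ`; the remaining factor `B² κ²` of the bound is at least 1.
      queries-cut : ∀ {q} → q ≤ (B * B * κ) * (B * B * κ) * (B * B * κ) * C → fromℕ q R.≤ fromℕ K R.* (α ⁻¹) R.^ 4 R.* Λ₀ R.^ 5
      queries-cut {q} h = ≤-transᶜ (fromℚ-mono (÷-≤ {q} {1} {K * (B * B) ^ 4 * κ ^ 5} {1 * 4 ^ 4 * 4 ^ 5}
          (certify (B ∷ κ ∷ C ∷ K ∷ q ∷ []) (v4 :* (con 1 :* con 4 :^ 4 :* con 4 :^ 5)) (v3 :* (v0 :* v0) :^ 4 :* v1 :^ 5 :* con 1)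
            ((con 262144 ×ʰ v4 :≤ x :* x :* x :* v2 ∶ h) ∷
             (v2 :* con 262144 :* x :* x :* x ×ʰ con 1 :≤ v0 :* v0 :* (v1 :* v1) ∶ *-mono-≤ 1≤BB 1≤κκ) ∷
             ((v0 :* v0) :^ 4 :* v1 :^ 5 ×ʰ v2 :* con 262144 :≤ v3 ∶ C≤K) ∷ []) tt)))
        (*-lower (K * (B * B) ^ 4) (1 * 4 ^ 4) (κ ^ 5) (4 ^ 5) (*-lower K 1 ((B * B) ^ 4) (4 ^ 4) same (^-lower (B * B) 4 4 α⁻¹≥)) (^-lower κ 4 5 Λ≥))
        where x = v0 :* v0 :* v1

      member-cut : ∀ {q} → q ≤ (B * B * κ) * (B * B * κ) * (B * B * κ) * C → fromℕ q R.≤ fromℕ K R.* (α ⁻¹) R.^ 4 R.* Λ₀ R.^ 3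
      member-cut {q} h = ≤-transᶜ (fromℚ-mono (÷-≤ {q} {1} {K * (B * B) ^ 4 * κ ^ 3} {1 * 4 ^ 4 * 4 ^ 3}
          (certify (B ∷ κ ∷ C ∷ K ∷ q ∷ []) (v4 :* (con 1 :* con 4 :^ 4 :* con 4 :^ 3)) (v3 :* (v0 :* v0) :^ 4 :* v1 :^ 3 :* con 1)
            ((con 16384 ×ʰ v4 :≤ x :* x :* x :* v2 ∶ h) ∷
             (v2 :* con 262144 :* x :* x :* x ×ʰ con 1 :≤ v0 :* v0 ∶ 1≤BB) ∷
             ((v0 :* v0) :^ 4 :* v1 :^ 3 ×ʰ v2 :* con 262144 :≤ v3 ∶ C≤K) ∷ []) tt)))
        (*-lower (K * (B * B) ^ 4) (1 * 4 ^ 4) (κ ^ 3) (4 ^ 3) (*-lower K 1 ((B * B) ^ 4) (4 ^ 4) same (^-lower (B * B) 4 4 α⁻¹≥)) (^-lower κ 4 3 Λ≥))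
        where x = v0 :* v0 :* v1

      length-cut : ∀ n {l} → l ≤ n * (B * B * κ) * C → fromℕ l R.≤ fromℕ K R.* fromℕ n R.* (α ⁻¹) R.^ 2 R.* Λ₀
      length-cut n {l} h = ≤-transᶜ (fromℚ-mono (÷-≤ {l} {1} {K * n * (B * B) ^ 2 * κ} {1 * 1 * 4 ^ 2 * 4}
          (certify (B ∷ κ ∷ C ∷ K ∷ n ∷ l ∷ []) (v5 :* (con 1 :* con 1 :* con 4 :^ 2 :* con 4)) (v3 :* v4 :* (v0 :* v0) :^ 2 :* v1 :* con 1)
            ((con 64 ×ʰ v5 :≤ v4 :* (v0 :* v0 :* v1) :* v2 ∶ h) ∷
             (v2 :* con 262144 :* v4 :* (v0 :* v0 :* v1) ×ʰ con 1 :≤ v0 :* v0 ∶ 1≤BB) ∷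
             (v4 :* (v0 :* v0) :^ 2 :* v1 ×ʰ v2 :* con 262144 :≤ v3 ∶ C≤K) ∷ []) tt)))
        (*-lower (K * n * (B * B) ^ 2) (1 * 1 * 4 ^ 2) κ 4 (*-lower (K * n) (1 * 1) ((B * B) ^ 2) (4 ^ 2) (*-lower K 1 n 1 same same) (^-lower (B * B) 4 2 α⁻¹≥)) Λ≥)

    -- The factor `256 = 4 ^ 4` comes from `B² ≤ 4 / α` and turns `2 ^ 61` into `2 ^ 69`. Likewise
    -- `4 ^ 3` in `high-doubling-cut` turns `2 ^ 27` into `2 ^ 33`.
    doubling-cut : ∀ {C c s y} → c * 256 ≤ C → s * 9 ≤ B * B * B * B * B * B * B * B * y * c →
                   fromℕ s R.≤ fromℚ (C ÷ 9) R.* (α ⁻¹) R.^ 4 R.* fromℕ y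
    doubling-cut {C} {c} {s} {y} hC h = ≤-transᶜ (fromℚ-mono (÷-≤ {s} {1} {C * (B * B) ^ 4 * y} {9 * 4 ^ 4 * 1}
        (certify (B ∷ C ∷ c ∷ s ∷ y ∷ []) (v3 :* (con 9 :* con 4 :^ 4 :* con 1)) (v1 :* (v0 :* v0) :^ 4 :* v4 :* con 1)
          ((con 256 ×ʰ v3 :* con 9 :≤ v0 :* v0 :* v0 :* v0 :* v0 :* v0 :* v0 :* v0 :* v4 :* v2 ∶ h) ∷
           ((v0 :* v0) :^ 4 :* v4 ×ʰ v2 :* con 256 :≤ v1 ∶ hC) ∷ []) tt)))
      (*-lower (C * (B * B) ^ 4) (9 * 4 ^ 4) y 1 (*-lower C 9 ((B * B) ^ 4) (4 ^ 4) same (^-lower (B * B) 4 4 α⁻¹≥)) same)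

    high-doubling-cut : ∀ {C c s y} → c * 64 ≤ C → s * 9 ≤ B * B * B * B * B * B * y * c →
                        fromℕ s R.≤ fromℚ (C ÷ 9) R.* (α ⁻¹) R.^ 3 R.* fromℕ y
    high-doubling-cut {C} {c} {s} {y} hC h = ≤-transᶜ (fromℚ-mono (÷-≤ {s} {1} {C * (B * B) ^ 3 * y} {9 * 4 ^ 3 * 1}
        (certify (B ∷ C ∷ c ∷ s ∷ y ∷ []) (v3 :* (con 9 :* con 4 :^ 3 :* con 1)) (v1 :* (v0 :* v0) :^ 3 :* v4 :* con 1)
          ((con 64 ×ʰ v3 :* con 9 :≤ v0 :* v0 :* v0 :* v0 :* v0 :* v0 :* v4 :* v2 ∶ h) ∷
           ((v0 :* v0) :^ 3 :* v4 ×ʰ v2 :* con 64 :≤ v1 ∶ hC) ∷ []) tt)))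
      (*-lower (C * (B * B) ^ 3) (9 * 4 ^ 3) y 1 (*-lower C 9 ((B * B) ^ 3) (4 ^ 3) same (^-lower (B * B) 4 3 α⁻¹≥)) same)

    -- `√α ≤ 2 / B` turns `21/128` into `42 / (128 B)`. Here a product of cuts has to be bounded
    -- from above, which takes the approximation argument of `≤-fromℚ-*`.
    size-cut : ∀ {N y} .{{_ : NonZero B}} .{{_ : NonZero (B * B)}} → OpenUnit.U α (4 ÷ (B * B)) → N * 42 ≤ B * y * 128 →
               c-BSG R.* √ ⌜ α ⌝ R.* fromℕ N R.≤ fromℕ y
    size-cut {N} {y} {{B≢0}} U h = ≤-transᶜ (*-monoᶜ (*-monoᶜ same (√-upper α B U)) same)
      (≤-transᶜ (*-monoᶜ (≤-fromℚ-* (0≤÷ 21 128) (0≤÷ 2 B)) same)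
        (≤-transᶜ (*-monoᶜ (fromℚ-mono (ℚ.≤-reflexive (÷-* 21 128 2 B {{_}} {{B≢0}} {{nz}}))) same)
          (≤-transᶜ (≤-fromℚ-* (0≤÷ 42 (128 * B) {{nz}}) (0≤÷ N 1))
            (≤-transᶜ (fromℚ-mono (ℚ.≤-reflexive (÷-* 42 (128 * B) N 1 {{nz}} {{_}} {{nz₁}})))
              (fromℚ-mono (÷-≤ {42 * N} {128 * B * 1} {y} {1} {{nz₁}}
                (certify (B ∷ N ∷ y ∷ []) (con 42 :* v1 :* con 1) (v2 :* (con 128 :* v0 :* con 1))
                  ((v1 :* con 42 :≤ v0 :* v2 :* con 128 ∶ h) ∷ []) tt)))))))
      where
      nz = m*n≢0 128 B {{_}} {{B≢0}}
      nz₁ = m*n≢0 (128 * B) 1 {{nz}}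

-- Choice of the scales and verification of all claims

module Assembly where

  open Prelude
  open import Data.List.Relation.Unary.All as All using (All)
  open import Data.Rational.Base as ℚ using (ℚ; 0ℚ)
  import Data.Rational.Properties as ℚ
  open import Defs hiding (_+_; _*_; _^_; _≤_; _≟_)
  import Defs as R
  open Certificates hiding (⟦_⟧)
  open Counting
  open Arithmetic
  open TailBounds using (T-∧⁻; T-∧⁺)
  open Algorithms
  open Outcomes
  open Rationals
  open Reals
  open Oracles
  open Records
  open Runs
  open Estimates

  branch : ∀ n → Record → Branch n
  branch zero    D = high []
  branch (suc n) D = branchOf (decode (suc n) D)

  member : ∀ n → Record → 𝔽₂^ n → Query n Bool
  member zero    D x = ask x answer
  member (suc n) D x = memberOf (decode (suc n) D) x

  reader : Reader
  reader = record { branch = λ {n} → branch n ; member = λ {n} → member n }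

  module Scales (n : ℕ) (α ρₛ ρ꜀ : OpenUnit) where

    open Scaled (approximate α) public using (i)
    open Scaled (approximate ρₛ) public using () renaming (i to ℓₛ)
    open Scaled (approximate ρ꜀) public using () renaming (i to ℓ꜀)

    -- Abstract since 2 ^ (κ * 50) must not be unfolded.
    abstract
      κ : ℕ
      κ = suc n + i + ℓₛ + ℓ꜀

      κ≡ : κ ≡ suc n + i + ℓₛ + ℓ꜀
      κ≡ = refl

    B k₁ ℓ : ℕ
    B  = 2 ^ i
    k₁ = κ * 50
    ℓ  = ℓₛ + ℓ꜀

    1≤B : 1 ≤ B
    1≤B = m^n>0 2 i

    1≤κ : 1 ≤ κ
    1≤κ = subst (1 ≤_) (sym κ≡) (s≤s z≤n)

    1≤k : 1 ≤ k₁ * 8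
    1≤k = *-mono-≤ (*-mono-≤ 1≤κ (s≤s (z≤n {49}))) (s≤s (z≤n {7}))

    instance
      B≢0 : NonZero B
      B≢0 = >-nonZero 1≤B
      BB≢0 : NonZero (B * B)
      BB≢0 = >-nonZero (*-mono-≤ 1≤B 1≤B)

    α<4/B² : OpenUnit.U α (4 ÷ (B * B))
    α<4/B² = Scaled.below (approximate α) (sym (4^≡2^*2^ i))

    α>15/16B² : OpenUnit.L α (_÷_ 15 (B * B * 16) {{m*n≢0 (B * B) 16}})
    α>15/16B² = Scaled.above (approximate α) (sym (4^≡2^*2^ i))

    Λ≥ : fromℚ (κ ÷ 4) R.≤ Λ n α ρₛ ρ꜀
    Λ≥ = ≤-transᶜ (fromℚ-mono (÷-≤ {κ} {4} {(1 + n) + lg i + lg ℓₛ + lg ℓ꜀} {1}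
        (certify (n ∷ i ∷ ℓₛ ∷ ℓ꜀ ∷ lg i ∷ lg ℓₛ ∷ lg ℓ꜀ ∷ κ ∷ []) (v7 :* con 1) ((con 1 :+ v0 :+ v4 :+ v5 :+ v6) :* con 4)
          ((v7 :≤ con 1 :+ v0 :+ v1 :+ v2 :+ v3 ∶ ≤-reflexive κ≡) ∷ (v1 :≤ v4 :+ con 1 ∶ i≤lg+1 i) ∷ (v2 :≤ v5 :+ con 1 ∶ i≤lg+1 ℓₛ) ∷ (v3 :≤ v6 :+ con 1 ∶ i≤lg+1 ℓ꜀) ∷ []) tt)))
      (+-lower ((1 + n) + lg i + lg ℓₛ) (lg ℓ꜀) (+-lower ((1 + n) + lg i) (lg ℓₛ) (+-lower (1 + n) (lg i) (λ q h → h)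
        (lg-lower α i (Scaled.below (approximate α)))) (lg-lower ρₛ ℓₛ (Scaled.below (approximate ρₛ)))) (lg-lower ρ꜀ ℓ꜀ (Scaled.below (approximate ρ꜀))))

    open Bounds α (Λ n α ρₛ ρ꜀) B κ 1≤B 1≤κ (⁻¹-lower α 4 (B * B) α<4/B²) Λ≥ public

    private
      2^K≢0 : NonZero (2 ^ (ℓ + ℓ + 3))
      2^K≢0 = m^n≢0 2 (ℓ + ℓ + 3)

    -- This is half of `4 ^ (−ℓ)`. Each error parameter was located above `15/16 · 4 ^ (−j)` for
    -- some `j ≤ ℓ`.
    failure : ℚ
    failure = _÷_ 4 (2 ^ (ℓ + ℓ + 3)) {{2^K≢0}}

    failure≤ : ∀ (ρ : OpenUnit) → let j = Scaled.i (approximate ρ) in j ≤ ℓ → ∀ {p} → p ℚ.≤ failure → fromℚ p R.≤ ⌜ ρ ⌝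
    failure≤ ρ j≤ℓ {p} p≤ q Uq = ℚ.≤-<-trans (ℚ.≤-trans p≤ (÷-≤ {4} {2 ^ (ℓ + ℓ + 3)} {15} {4 ^ j * 16} {{2^K≢0}} {{m*n≢0 (4 ^ j) 16 {{4^j≢0}}}}
        (certify (4 ^ j ∷ 2 ^ (ℓ + ℓ + 3) ∷ []) (con 4 :* (v0 :* con 16)) (con 15 :* v1) ((con 8 ×ʰ v0 :* con 8 :≤ v1 ∶ le) ∷ []) tt)))
      (L<U ρ (Scaled.above (approximate ρ) {{4^j≢0}} refl) Uq)
      where
      j = Scaled.i (approximate ρ)
      4^j≢0 : NonZero (4 ^ j)
      4^j≢0 = m^n≢0 4 j
      le : 4 ^ j * 8 ≤ 2 ^ (ℓ + ℓ + 3)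
      le = ≤-trans (≤-reflexive (trans (cong (_* 8) (trans (4^≡2^*2^ j) (sym (^-distribˡ-+-* 2 j j)))) (sym (^-distribˡ-+-* 2 (j + j) 3))))
        (^-monoʳ-≤ 2 (+-monoˡ-≤ 3 (+-mono-≤ j≤ℓ j≤ℓ)))

    energetic : ∀ {N E} → ⌜ α ⌝ R.* fromℕ N R.^ 3 R.≤ fromℕ E → N * N * N * 15 ≤ B * B * E * 16
    energetic {N} {E} h = certify (B ∷ N ∷ E ∷ []) (v1 :* v1 :* v1 :* con 15) (v0 :* v0 :* v2 :* con 16)
        ((con 15 :* v1 :^ 3 :* con 1 :≤ v2 :* (v0 :* v0 :* con 16 :* con 1 :^ 3) ∶ cross) ∷ []) tt
      where
      nz : NonZero (B * B * 16)
      nz = m*n≢0 (B * B) 16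
      nz₁ : NonZero (B * B * 16 * 1 ^ 3)
      nz₁ = m*n≢0 (B * B * 16) (1 ^ 3) {{nz}}
      cross : 15 * N ^ 3 * 1 ≤ E * (B * B * 16 * 1 ^ 3)
      cross = ÷-≤⁻ {15 * N ^ 3} {B * B * 16 * 1 ^ 3} {E} {1} {{nz₁}} (fromℚ-mono⁻
        (≤-transᶜ (*-lower 15 (B * B * 16) (N ^ 3) (1 ^ 3) {{nz}} {{_}} {{nz₁}} (below-⌜⌝ α α>15/16B²) (^-lower N 1 3 (λ q h → h))) h))

    guarantee-cut : ∀ {S Y : Subset n} {P} → Guarantee S B Y P →
      c-BSG R.* √ ⌜ α ⌝ R.* fromℕ (card S) R.≤ fromℕ (card Y)
      × fromℕ (card (Y ⊕ Y)) R.≤ C-BSG R.* (α ⁻¹) R.^ 4 R.* fromℕ (card Y)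
      × (P → fromℕ (card (Y ⊕ Y)) R.≤ C-BSG-H R.* (α ⁻¹) R.^ 3 R.* fromℕ (card Y))
    guarantee-cut {S} {Y} g = size-cut {card S} {card Y} α<4/B² (Guarantee.size g)
      , doubling-cut {2 ^ 69} {2305843009213693952} {card (Y ⊕ Y)} {card Y} (≤ᵇ⇒≤ _ _ tt) (Guarantee.doubling g)
      , λ p → high-doubling-cut {2 ^ 33} {134217728} {card (Y ⊕ Y)} {card Y} (≤ᵇ⇒≤ _ _ tt) (Guarantee.high-doubling g p)

  algorithm : Algorithm
  algorithm zero    α ρₛ ρ꜀ = return (rec [])
  algorithm (suc n) α ρₛ ρ꜀ = Run.run B k₁
    where open Scales (suc n) α ρₛ ρ꜀ using (B; k₁)

  module _ {n : ℕ} (S : Subset n) (B : ℕ) (Y : Subset n) where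

    -- The good event has to be a Boolean function of the output. It is therefore given by the
    -- decidable integer guarantees, which imply the estimates in the real `α`.
    guaranteeᵇ : Bool → Bool
    guaranteeᵇ h = (card S * 42 ≤ᵇ B * card Y * 128)
      ∧ (card (Y ⊕ Y) * 9 ≤ᵇ B * B * B * B * B * B * B * B * card Y * 2305843009213693952)
      ∧ (not h ∨ (card (Y ⊕ Y) * 9 ≤ᵇ B * B * B * B * B * B * card Y * 134217728))

    guaranteeᵇ-sound : ∀ h → T (guaranteeᵇ h) → Guarantee S B Y (T h)
    guaranteeᵇ-sound h ok =
      let p , ok₁ = T-∧⁻ {card S * 42 ≤ᵇ B * card Y * 128} ok
          q , r   = T-∧⁻ {card (Y ⊕ Y) * 9 ≤ᵇ B * B * B * B * B * B * B * B * card Y * 2305843009213693952} ok₁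
      in record { size = ≤ᵇ⇒≤ _ _ p ; doubling = ≤ᵇ⇒≤ _ _ q ; high-doubling = implied h r }
      where
      implied : ∀ h → T (not h ∨ (card (Y ⊕ Y) * 9 ≤ᵇ B * B * B * B * B * B * card Y * 134217728)) → T h →
                card (Y ⊕ Y) * 9 ≤ B * B * B * B * B * B * card Y * 134217728
      implied true r _ = ≤ᵇ⇒≤ _ _ r

    guaranteeᵇ-complete : ∀ h → Guarantee S B Y (T h) → T (guaranteeᵇ h)
    guaranteeᵇ-complete h g = T-∧⁺ (≤⇒≤ᵇ size) (T-∧⁺ (≤⇒≤ᵇ doubling) (implied h high-doubling))
      where
      open Guarantee g
      implied : ∀ h → (T h → card (Y ⊕ Y) * 9 ≤ B * B * B * B * B * B * card Y * 134217728) →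
                T (not h ∨ (card (Y ⊕ Y) * 9 ≤ᵇ B * B * B * B * B * B * card Y * 134217728))
      implied false _ = tt
      implied true  f = ≤⇒≤ᵇ (f tt)

  isHighᵇ : ∀ {n} → Branch n → Bool
  isHighᵇ (high d)  = true
  isHighᵇ (low a Q) = false

  IsHigh⇒T : ∀ {n} {b : Branch n} → IsHigh b → T (isHighᵇ b)
  IsHigh⇒T high = tt

  T⇒FromFibre : ∀ {n} (c : Candidate n) {w₁ w₂ w₃} → T (isHighᵇ (branchOf (store c w₁ w₂ w₃))) → FromFibre c
  T⇒FromFibre (high d θ) _ = high

  open Reader reader using (Y)

  Claim : ℕ → (n : ℕ) (α ρₛ ρ꜀ : OpenUnit) (S : Subset n) → Set
  Claim K n α ρₛ ρ꜀ S =
    (∀ D s q → S ⊢ run ⇓ rec D ⟨ s , q ⟩ → Y S D ⊆ S × CleanedFrom S (branch n D) (Y S D))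
    × (Σ[ Good ∈ (Output → Bool) ]
        fromℚ (Pr S run (not ∘ Good)) R.≤ ⌜ ρₛ ⌝
        × (∀ D → T (Good (rec D)) →
            c-BSG R.* √ ⌜ α ⌝ R.* fromℕ (card S) R.≤ fromℕ (card (Y S D))
            × fromℕ (card (Y S D ⊕ Y S D)) R.≤ C-BSG R.* (α ⁻¹) R.^ 4 R.* fromℕ (card (Y S D))
            × (IsHigh (branch n D) →
                fromℕ (card (Y S D ⊕ Y S D)) R.≤ C-BSG-H R.* (α ⁻¹) R.^ 3 R.* fromℕ (card (Y S D)))))
    × (⌜ α ⌝ R.* fromℕ (card S) R.^ 3 R.≤ fromℕ (energy S) → fromℚ (Pr S run isFAIL) R.≤ ⌜ ρ꜀ ⌝)
    × (∀ o s q → S ⊢ run ⇓ o ⟨ s , q ⟩ →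
        fromℕ s R.≤ fromℕ K R.* (α ⁻¹) R.^ 2 R.* Λ₀ R.^ 4
        × fromℕ q R.≤ fromℕ K R.* (α ⁻¹) R.^ 4 R.* Λ₀ R.^ 5)
    × (∀ D s q → S ⊢ run ⇓ rec D ⟨ s , q ⟩ →
        (∀ x → fromℕ (#queries (member n D x) S) R.≤ fromℕ K R.* (α ⁻¹) R.^ 4 R.* Λ₀ R.^ 3)
        × fromℕ (length D) R.≤ fromℕ K R.* fromℕ n R.* (α ⁻¹) R.^ 2 R.* Λ₀)
    where
    run = algorithm n α ρₛ ρ꜀
    Λ₀ = Λ n α ρₛ ρ꜀

  -- At most `7 m` points occur, both in the search and in a membership query. The leading term
  -- `49 m³` is below `10 ^ 24 x³`.
  sums-cost : ∀ {x C} a b → 1 ≤ x → 1000000000000000000000000 ≤ C → a ≤ 5 → b ≤ 2 →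
    let m = x * 26214400 ; v = b + m * a in v + (v * v + v * (v * m)) ≤ x * x * x * C
  sums-cost {x} {C} a b 1≤x hC a≤5 b≤2 = ≤-trans (+-mono-≤ v≤ (+-mono-≤ (*-mono-≤ v≤ v≤) (*-mono-≤ v≤ (*-monoˡ-≤ m v≤))))
    (certify (x ∷ C ∷ []) (w :+ (w :* w :+ w :* (w :* (v0 :* con 26214400)))) (v0 :* v0 :* v0 :* v1)
      ((v0 :* v0 :* v0 ×ʰ con 1000000000000000000000000 :≤ v1 ∶ hC) ∷
       (con 183501000 :* v0 ×ʰ con 1 :≤ v0 :* v0 ∶ *-mono-≤ 1≤x 1≤x) ∷
       (con 40000000000000000 :* v0 :* v0 ×ʰ con 1 :≤ v0 ∶ 1≤x) ∷ []) tt)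
    where
    m = x * 26214400
    v = b + m * a
    w = v0 :* con 26214400 :* con 7
    v≤ : v ≤ m * 7
    v≤ = certify (m ∷ a ∷ b ∷ []) (v2 :+ v0 :* v1) (v0 :* con 7)
      ((v2 :≤ con 2 ∶ b≤2) ∷ (v0 ×ʰ v1 :≤ con 5 ∶ a≤5) ∷ (con 2 ×ʰ con 1 :≤ v0 ∶ *-mono-≤ 1≤x (s≤s (z≤n {26214399}))) ∷ []) tt

  module _ {C K : ℕ} (1≤C : 1000000000000000000000000 ≤ C) (C≤K : C * 262144 ≤ K) where

    -- In dimension 0 the length bound forces the empty record, read as Y = S.
    claim-zero : ∀ α ρₛ ρ꜀ (S : Subset 0) → Nonempty S → Claim K 0 α ρₛ ρ꜀ S
    claim-zero α ρₛ ρ꜀ S (x , Sx) =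
        (λ { D s q _⊢_⇓_⟨_,_⟩.return → (λ _ h → h) , fibre })
      , ((λ _ → true) , impossible ρₛ , λ D _ → let p , q , r = guarantee-cut {S} {S} {⊤} guarantee in p , q , λ _ → r tt)
      , (λ _ → impossible ρ꜀)
      , (λ { o s q _⊢_⇓_⟨_,_⟩.return → samples-cut {C} {K} C≤K {0} z≤n , queries-cut {C} {K} C≤K {0} z≤n })
      , (λ { D s q _⊢_⇓_⟨_,_⟩.return → (λ _ → member-cut {C} {K} C≤K {1} one-query) , length-cut {C} {K} C≤K 0 {0} z≤n })
      where
      open Scales 0 α ρₛ ρ꜀
      impossible : ∀ ρ → fromℚ 0ℚ R.≤ ⌜ ρ ⌝
      impossible ρ q Uq = L<U ρ (OpenUnit.positive ρ) Uq
      fibre : ∀ y → y ∈ S → y ∈ S × y ⊞ [] ∈ S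
      fibre [] h = h , h
      1≤x : 1 ≤ B * B * κ
      1≤x = *-mono-≤ (*-mono-≤ 1≤B 1≤B) 1≤κ
      one-query : 1 ≤ B * B * κ * (B * B * κ) * (B * B * κ) * C
      one-query = *-mono-≤ (*-mono-≤ (*-mono-≤ 1≤x 1≤x) 1≤x) (≤-trans (s≤s z≤n) 1≤C)
      card≤1 : ∀ (X : Subset 0) → card X ≤ 1
      card≤1 X = ≤-trans (≤-reflexive (card≡# X)) (#-≤-length (points 0) X)
      pow≥1 : ∀ {a b} → 1 ≤ a → 1 ≤ b → 1 ≤ a * b
      pow≥1 = *-mono-≤
      guarantee : ∀ {P} → Guarantee S B S P
      guarantee = record
        { size = certify (B ∷ card S ∷ []) (v1 :* con 42) (v0 :* v1 :* con 128) ((v1 :* con 42 ×ʰ con 1 :≤ v0 ∶ 1≤B) ∷ []) tt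
        ; doubling = ≤-trans (*-monoˡ-≤ 9 (≤-trans (card≤1 (S ⊕ S)) (pow≥1 (pow≥1 (pow≥1 (pow≥1 (pow≥1 (pow≥1 (pow≥1 (pow≥1 1≤B 1≤B) 1≤B) 1≤B) 1≤B) 1≤B) 1≤B) 1≤B) (0<card S x Sx))))
            (*-monoʳ-≤ (B * B * B * B * B * B * B * B * card S) (≤ᵇ⇒≤ 9 2305843009213693952 tt))
        ; high-doubling = λ _ → ≤-trans (*-monoˡ-≤ 9 (≤-trans (card≤1 (S ⊕ S)) (pow≥1 (pow≥1 (pow≥1 (pow≥1 (pow≥1 (pow≥1 1≤B 1≤B) 1≤B) 1≤B) 1≤B) 1≤B) (0<card S x Sx))))
            (*-monoʳ-≤ (B * B * B * B * B * B * card S) (≤ᵇ⇒≤ 9 134217728 tt))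
        }

    module Positive (n₀ : ℕ) (α ρₛ ρ꜀ : OpenUnit) (S : Subset (suc n₀)) (nonempty : Nonempty S) where

      n : ℕ
      n = suc n₀
      open Scales n α ρₛ ρ꜀
      open Run {n} B k₁ using (run; outcome; report; trace; Trace; Recorded; recorded; decoded; Pr-run; Fairness)
      open Parameters B (k₁ * 8) using (m; θ)
      1≤N : 1 ≤ card S
      1≤N = 0<card S (proj₁ nonempty) (proj₂ nonempty)
      x : ℕ
      x = B * B * κ
      1≤x : 1 ≤ x
      1≤x = *-mono-≤ (*-mono-≤ 1≤B 1≤B) 1≤κ
      m≡ : m ≡ x * 26214400
      m≡ = certify-≡ (B ∷ κ ∷ []) (v0 :* v0 :* (v1 :* con 50 :* con 8) :* con 65536) (v0 :* v0 :* v1 :* con 26214400) [] [] tt tt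
      rare : (m + 2) * (2 ^ n * 2 ^ n) * 2 * 2 * 2 ^ (ℓ + ℓ + 3) ≤ 2 ^ k₁
      rare = rare-failures n i ℓ κ (certify (n ∷ i ∷ ℓₛ ∷ ℓ꜀ ∷ κ ∷ []) (v0 :+ v1 :+ (v2 :+ v3) :+ con 1) v4 ((con 1 :+ v0 :+ v1 :+ v2 :+ v3 :≤ v4 ∶ ≤-reflexive (sym κ≡)) ∷ []) tt)

      not-false : ∀ {b} → T b → not b ≡ false
      not-false {true} _ = refl

      Good : Output → Bool
      Good FAIL    = true
      Good (rec D) = guaranteeᵇ S B (Y S D) (isHighᵇ (branch n D))

      no-failure : ∀ ω₁ ω₂ ω₃ cs → cs ≢ [] → isFAIL (report ω₁ ω₂ ω₃ cs) ≡ false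
      no-failure ω₁ ω₂ ω₃ []       h = ⊥-elim (h refl)
      no-failure ω₁ ω₂ ω₃ (c ∷ cs) h = refl

      good-outcome : ∀ {ω₁ ω₂ ω₃ ω₄} → length ω₁ ≡ m → length ω₂ ≡ m → length ω₃ ≡ m → Fairness S 1≤B 1≤k 1≤N ω₁ ω₂ ω₃ ω₄ →
                     ∀ o → o ≡ outcome S ω₁ ω₂ ω₃ ω₄ → T (Good o)
      good-outcome l₁ l₂ l₃ allFair FAIL    e = tt
      good-outcome {ω₁} {ω₂} {ω₃} {ω₄} l₁ l₂ l₃ allFair (rec D) e =
        subst (λ d → T (guaranteeᵇ S B (λ x → ⟦ memberOf d x ⟧ S) (isHighᵇ (branchOf d)))) (sym (decoded S {ω₄ = ω₄} l₁ l₂ l₃ r))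
          (guaranteeᵇ-complete S B (λ x → ⟦ memberOf d′ x ⟧ S) (isHighᵇ (branchOf d′))
            (Guarantee-cong {S = S} {B} {Membership.clean S w₁ w₂ w₃ c} (λ x → sym (memberOf-clean S c w₁ w₂ w₃ x)) (T⇒FromFibre c {w₁} {w₂} {w₃})
              (accepted-sound S B (k₁ * 8) ω₁ ω₂ ω₃ ω₄ 1≤B 1≤k 1≤N allFair (Recorded.c∈ r))))
        where
        r = recorded S {D} {ω₁} {ω₂} {ω₃} {ω₄} e
        c = Recorded.c r
        w₁ = map proj₁ ω₁
        w₂ = map proj₁ ω₂
        w₃ = map proj₁ ω₃
        d′ = store c w₁ w₂ w₃

      module Recover {D s q} (t : Trace S (rec D) s q) where
        open Trace t public
        w₁ w₂ w₃ : List (𝔽₂^ n)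
        w₁ = map proj₁ ω₁
        w₂ = map proj₁ ω₂
        w₃ = map proj₁ ω₃
        r : Recorded S D ω₁ ω₂ ω₃ ω₄
        r = recorded S {D} {ω₁} {ω₂} {ω₃} {ω₄} output
        c : Candidate n
        c = Recorded.c r
        decode≡ : decode n D ≡ store c w₁ w₂ w₃
        decode≡ = decoded S {ω₄ = ω₄} l₁ l₂ l₃ r
        origin : Provenance S B (k₁ * 8) ω₁ ω₂ ω₃ ω₄ c
        origin = proj₁ (accepted⁻ S B (k₁ * 8) ω₁ ω₂ ω₃ ω₄ {c} (Recorded.c∈ r))
        -- A low-branch centre is the first coordinate of a drawn pair.
        centre∈S : ∀ {a j D′} → c ≡ low a j D′ → a ∈ S
        centre∈S e = go origin e
          where
          go : ∀ {c a j D′} → Provenance S B (k₁ * 8) ω₁ ω₂ ω₃ ω₄ c → c ≡ low a j D′ → a ∈ S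
          go (low a∈ _) refl = let _ , st∈ , a≡ = ∈-map⁻ proj₁ a∈ in subst (_∈ S) (sym a≡) (proj₁ (All.lookup in₄ st∈))
        len : ∀ (ω : List (𝔽₂^ n × 𝔽₂^ n)) → length ω ≡ m → length (map proj₁ ω) ≡ m
        len ω l = trans (length-map proj₁ ω) l
        thresholds≤ : thresholds c ≤ m + m + 1
        thresholds≤ = go origin
          where
          go : ∀ {c} → Provenance S B (k₁ * 8) ω₁ ω₂ ω₃ ω₄ c → thresholds c ≤ m + m + 1
          go (high _) = certify (B ∷ k₁ * 8 ∷ []) (v1 :* con 128) (v0 :* v0 :* v1 :* con 65536 :+ v0 :* v0 :* v1 :* con 65536 :+ con 1)
            ((v1 :* con 128 ×ʰ con 1 :≤ v0 :* v0 ∶ *-mono-≤ 1≤B 1≤B) ∷ []) tt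
          go (low {a} {j} _ j≤m) = ≤-trans (s≤s (+-mono-≤ j≤m (≤-trans (#-≤-length ω₂ _) (≤-reflexive l₂)))) (≤-reflexive (+-comm 1 (m + m)))

      cleaned : ∀ {D s q} → Trace S (rec D) s q → Y S D ⊆ S × CleanedFrom S (branch n D) (Y S D)
      cleaned t = subst (λ d → (λ x → ⟦ memberOf d x ⟧ S) ⊆ S × CleanedFrom S (branchOf d) (λ x → ⟦ memberOf d x ⟧ S)) (sym decode≡)
          (memberOf-⊆ S c w₁ w₂ w₃ , branchOf-cleaned S c w₁ w₂ w₃ centre∈S)
        where open Recover t

      samples≤ : m * 8 ≤ x * C
      samples≤ = ≤-trans (≤-reflexive (cong (_* 8) m≡)) (certify (x ∷ C ∷ []) (v0 :* con 26214400 :* con 8) (v0 :* v1)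
        ((v0 ×ʰ con 1000000000000000000000000 :≤ v1 ∶ 1≤C) ∷ []) tt)

      search-cost : ∀ {o s q} (t : Trace S o s q) → let open Trace t in length (sums (map proj₁ ω₁) (searchPoints ω₂ ω₃ ω₄)) ≤ x * x * x * C
      search-cost t = ≤-trans (≤-reflexive (trans (length-sums (map proj₁ ω₁) (searchPoints ω₂ ω₃ ω₄))
          (cong₂ (λ v w → v + (v * v + v * (v * w))) points≡ (trans (length-map proj₁ ω₁) (trans l₁ m≡)))))
        (sums-cost {x} {C} 5 0 1≤x 1≤C ≤-refl z≤n)
        where
        open Trace t
        points≡ : length (searchPoints ω₂ ω₃ ω₄) ≡ 0 + x * 26214400 * 5
        points≡ = trans (trans (length-++ (map proj₁ ω₂)) (cong₂ _+_ (trans (length-map proj₁ ω₂) l₂)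
            (trans (length-++ (map proj₂ ω₂)) (cong₂ _+_ (trans (length-map proj₂ ω₂) l₂)
            (trans (length-++ (map proj₁ ω₃)) (cong₂ _+_ (trans (length-map proj₁ ω₃) l₃)
            (trans (length-++ (map proj₁ ω₄)) (cong₂ _+_ (trans (length-map proj₁ ω₄) l₄) (trans (length-map _ ω₄) l₄)))))))))
          (trans (sum5 m) (cong (_* 5) m≡))
          where
          sum5 : ∀ m → m + (m + (m + (m + m))) ≡ m * 5
          sum5 m = certify-≡ (m ∷ []) (v0 :+ (v0 :+ (v0 :+ (v0 :+ v0)))) (v0 :* con 5) [] [] tt tt

      member-cost : ∀ {D s q} → Trace S (rec D) s q → ∀ y → #queries (member n D y) S ≤ x * x * x * C
      member-cost t y = subst (λ d → #queries (memberOf d y) S ≤ x * x * x * C) (sym decode≡)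
        (≤-trans (≤-reflexive (trans (#queries-learn (sums w₁ V) _ _ S) (trans (length-sums w₁ V)
            (cong₂ (λ v w → v + (v * v + v * (v * w))) points≡ (trans (len ω₁ l₁) m≡)))))
          (sums-cost {x} {C} 2 2 1≤x 1≤C (s≤s (s≤s z≤n)) ≤-refl))
        where
        open Recover t
        V = y ∷ centre c ∷ w₂ ++ w₃
        points≡ : length V ≡ 2 + x * 26214400 * 2
        points≡ = cong (2 +_) (trans (length-++ w₂) (trans (cong₂ _+_ (len ω₂ l₂) (len ω₃ l₃)) (trans (double m) (cong (_* 2) m≡))))
          where
          double : ∀ m → m + m ≡ m * 2
          double m = certify-≡ (m ∷ []) (v0 :+ v0) (v0 :* con 2) [] [] tt tt

      record-length : ∀ {D s q} → Trace S (rec D) s q → length D ≤ n * x * C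
      record-length t = ≤-trans (≤-reflexive (trans (cong length (Recorded.record≡ r))
          (length-encode c (len ω₁ l₁) (len ω₂ l₂) (len ω₃ l₃))))
        (certify (x ∷ n ∷ C ∷ m ∷ thresholds c ∷ []) (v4 :+ (con 3 :+ v3 :+ v1 :+ (v3 :* v1 :+ (v3 :* v1 :+ v3 :* v1)))) (v1 :* v0 :* v2)
          ((v4 :≤ v3 :+ v3 :+ con 1 ∶ thresholds≤) ∷
           (v1 :* v0 ×ʰ con 1000000000000000000000000 :≤ v2 ∶ 1≤C) ∷
           (con 3 :+ v1 :* con 3 ×ʰ v3 :≤ v0 :* con 26214400 ∶ ≤-reflexive m≡) ∷
           (v0 :* con 78643200 ×ʰ con 1 :≤ v1 ∶ s≤s z≤n) ∷
           (v1 ×ʰ con 1 :≤ v0 ∶ 1≤x) ∷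
           (con 4 ×ʰ con 1 :≤ v1 :* v0 ∶ *-mono-≤ (s≤s (z≤n {n₀})) 1≤x) ∷ []) tt)
        where open Recover t

      claim-suc : Claim K (suc n₀) α ρₛ ρ꜀ S
      claim-suc =
          (λ D s q r → cleaned (trace S r))
        , (Good , failure≤ ρₛ (m≤m+n ℓₛ ℓ꜀) (Pr-run S 1≤B 1≤k 1≤N {ℓ + ℓ + 3} rare (not ∘ Good) λ {ω₁} {ω₂} {ω₃} {ω₄} l₁ l₂ l₃ allFair →
              not-false (good-outcome {ω₁} {ω₂} {ω₃} {ω₄} l₁ l₂ l₃ allFair (outcome S ω₁ ω₂ ω₃ ω₄) refl))
            , λ D ok → let p , q , r = guarantee-cut {S} {Y S D} (guaranteeᵇ-sound S B (Y S D) (isHighᵇ (branch n D)) ok)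
                       in p , q , λ h → r (IsHigh⇒T h))
        , (λ energy≥ → failure≤ ρ꜀ (m≤n+m ℓ꜀ ℓₛ) (Pr-run S 1≤B 1≤k 1≤N {ℓ + ℓ + 3} rare isFAIL λ {ω₁} {ω₂} {ω₃} {ω₄} _ _ _ allFair →
              no-failure ω₁ ω₂ ω₃ (Search.accepted S B (k₁ * 8) ω₁ ω₂ ω₃ ω₄)
                (accepted-complete S B (k₁ * 8) ω₁ ω₂ ω₃ ω₄ 1≤B 1≤k 1≤N allFair (energetic {card S} {energy S} energy≥))))
        , (λ o s q r → let t = trace S r in
              samples-cut {C} {K} C≤K {s} (≤-trans (≤-reflexive (Trace.samples t)) samples≤)
            , queries-cut {C} {K} C≤K {q} (≤-trans (≤-reflexive (Trace.queries t)) (search-cost t)))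
        , λ D s q r → (λ x → member-cut {C} {K} C≤K {#queries (member n D x) S} (member-cost (trace S r) x)) , length-cut {C} {K} C≤K n {length D} (record-length (trace S r))

    claim : ∀ n α ρₛ ρ꜀ (S : Subset n) → Nonempty S → Claim K n α ρₛ ρ꜀ S
    claim zero    = claim-zero
    claim (suc n) α ρₛ ρ꜀ S ne = Positive.claim-suc n α ρₛ ρ꜀ S ne

open import Defs
open import Data.Bool.Base using (Bool; T; not)
open import Data.List.Base using (length)
open import Data.Nat.Base using (ℕ)
open import Data.Product.Base using (Σ-syntax; ∃-syntax; _×_; _,_)
open import Data.Nat.Properties using (≤ᵇ⇒≤)
open import Data.Unit.Base using (tt)
open import Function.Base using (_∘_)

theorem4p1 :
  Σ[ algorithm ∈ Algorithm ] Σ[ reader ∈ Reader ] Σ[ K ∈ ℕ ]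
  (∀ (n : ℕ) (α ρₛ ρ꜀ : OpenUnit) (S : Subset n) → Nonempty S →
    let open Reader reader
        run = algorithm n α ρₛ ρ꜀
        Λ₀ = Λ n α ρₛ ρ꜀
    in
    -- every nonfailure record defines a subset of S of the form given by its tag
    (∀ D s q → S ⊢ run ⇓ rec D ⟨ s , q ⟩ →
        Y S D ⊆ S × CleanedFrom S (branch D) (Y S D))
    -- soundness
    × (Σ[ Good ∈ (Output → Bool) ]
        fromℚ (Pr S run (not ∘ Good)) ≤ ⌜ ρₛ ⌝
        × (∀ D → T (Good (rec D)) →
            c-BSG * √ ⌜ α ⌝ * fromℕ (card S) ≤ fromℕ (card (Y S D))
            × fromℕ (card (Y S D ⊕ Y S D)) ≤ C-BSG * (α ⁻¹) ^ 4 * fromℕ (card (Y S D))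
            × (IsHigh (branch {n} D) →
                fromℕ (card (Y S D ⊕ Y S D)) ≤ C-BSG-H * (α ⁻¹) ^ 3 * fromℕ (card (Y S D)))))
    -- completeness
    × (⌜ α ⌝ * fromℕ (card S) ^ 3 ≤ fromℕ (energy S) →
        fromℚ (Pr S run isFAIL) ≤ ⌜ ρ꜀ ⌝)
    -- resources of the algorithm
    × (∀ o s q → S ⊢ run ⇓ o ⟨ s , q ⟩ →
        fromℕ s ≤ fromℕ K * (α ⁻¹) ^ 2 * Λ₀ ^ 4
        × fromℕ q ≤ fromℕ K * (α ⁻¹) ^ 4 * Λ₀ ^ 5)
    -- resources of the record
    × (∀ D s q → S ⊢ run ⇓ rec D ⟨ s , q ⟩ →
        (∀ x → fromℕ (#queries (member D x) S) ≤ fromℕ K * (α ⁻¹) ^ 4 * Λ₀ ^ 3)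
        × fromℕ (length D) ≤ fromℕ K * fromℕ n * (α ⁻¹) ^ 2 * Λ₀))
-- `2 ^ 110` exceeds `10 ^ 24 · 4 ^ 9`.
theorem4p1 = Assembly.algorithm , Assembly.reader , 2 Data.Nat.Base.^ 110 , λ n α ρₛ ρ꜀ S →
  Assembly.claim {10 Data.Nat.Base.^ 24} {2 Data.Nat.Base.^ 110} (≤ᵇ⇒≤ _ _ tt) (≤ᵇ⇒≤ _ _ tt) n α ρₛ ρ꜀ S
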